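{- Let $G$ be a $5$-regular graph that has no $(4,1)$-coloring, and which is vertex-minimal with this property (every $5$-regular graph with fewer vertices than $G$ has a $(4,1)$-coloring). Then: (a) $G$ does not contain a $4$-regular subgraph with at least $2$ vertices. (b) $G$ does not have $3$ parallel edges. (c) $G$ does not contain a path of length three consisting of double edges, i.e., there are no distinct vertices $v_1,v_2,v_3,v_4$ such that $v_i$ and $v_{i+1}$ are joined by (at least) two parallel edges for $i=1,2,3$. (d) No vertex of $G$ that has a loop is incident to a double edge (two parallel non-loop edges). (e) No two vertices with loops are adjacent. (f) $G$ contains at least $5$ loops. (g) There do not exist vertices $u_1,u_2,u_3,v_1,v_2,v_3\in V(G)$ such that each $u_i$ has a loop and $u_i$ is adjacent to $v_j$ for all $i,j\in\{1,2,3\}$. (h) No vertex is adjacent to more than $3$ vertices with loops. (i) No $4$-vertex subgraph of $G$ has $8$ or more edges.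
   Context: All graphs are finite, undirected pseudographs (multiple edges and loops allowed; a loop contributes $2$ to the degree; loops count as edges of subgraphs). A $(4,1)$-coloring of a $5$-regular graph is an edge-coloring using at least two colors such that every vertex is incident to exactly $4$ edges of one color and exactly $1$ edge of a different color. -}

module Defs where

open import Data.Nat using (ℕ; zero; suc; _+_; _≤_; _<_)
open import Data.Fin using (Fin) renaming (zero to fzero; suc to fsuc)
import Data.Fin as F
import Data.Nat as N
open import Data.Bool using (Bool; true; false; if_then_else_; T)
open import Data.Product using (Σ; ∃; ∃-syntax; _×_; _,_; proj₁; proj₂; swap)
open import Data.Sum using (_⊎_)
open import Relation.Nullary using (¬_)
open import Relation.Nullary.Decidable using (⌊_⌋)
open import Relation.Binary.PropositionalEquality using (_≡_; _≢_)

-- A finite pseudograph: vertices Fin nV, edges Fin nE, each edge has two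
-- endpoints (a loop has equal endpoints). Multiple edges and loops allowed.
record Graph : Set where
  field
    nV   : ℕ
    nE   : ℕ
    ends : Fin nE → Fin nV × Fin nV
open Graph public

sumFin : ∀ {k} → (Fin k → ℕ) → ℕ
sumFin {zero}  f = 0
sumFin {suc k} f = f fzero + sumFin (λ i → f (fsuc i))

count : ∀ {k} → (Fin k → Bool) → ℕ
count p = sumFin (λ i → if p i then 1 else 0)

-- number of times edge e is incident to v (a loop counts 2)
inc : (G : Graph) → Fin (nV G) → Fin (nE G) → ℕ
inc G v e = (if ⌊ proj₁ (ends G e) F.≟ v ⌋ then 1 else 0)
          + (if ⌊ proj₂ (ends G e) F.≟ v ⌋ then 1 else 0)

degIn : (G : Graph) → (Fin (nE G) → Bool) → Fin (nV G) → ℕ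
degIn G S v = sumFin (λ e → if S e then inc G v e else 0)

deg : (G : Graph) → Fin (nV G) → ℕ
deg G v = degIn G (λ _ → true) v

Regular : ℕ → Graph → Set
Regular k G = ∀ v → deg G v ≡ k

colDeg : (G : Graph) → (Fin (nE G) → ℕ) → ℕ → Fin (nV G) → ℕ
colDeg G c a v = degIn G (λ e → ⌊ c e N.≟ a ⌋) v

IsColoring41 : (G : Graph) → (Fin (nE G) → ℕ) → Set
IsColoring41 G c =
  (∃[ e ] ∃[ e' ] c e ≢ c e')
  × (∀ v → ∃[ a ] ∃[ b ] (a ≢ b × colDeg G c a v ≡ 4 × colDeg G c b v ≡ 1))

Has41Coloring : Graph → Set
Has41Coloring G = ∃[ c ] IsColoring41 G c

MinimalCounterexample : Graph → Set
MinimalCounterexample G =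
  1 ≤ nV G × Regular 5 G × ¬ Has41Coloring G
  × (∀ (H : Graph) → 1 ≤ nV H → nV H < nV G → Regular 5 H → Has41Coloring H)

IsSubgraph : (G : Graph) → (Fin (nV G) → Bool) → (Fin (nE G) → Bool) → Set
IsSubgraph G S F = ∀ e → T (F e) → T (S (proj₁ (ends G e))) × T (S (proj₂ (ends G e)))

Has4RegularSubgraph : Graph → Set
Has4RegularSubgraph G =
  Σ (Fin (nV G) → Bool) λ S → Σ (Fin (nE G) → Bool) λ F →
    IsSubgraph G S F × 2 ≤ count S × (∀ v → T (S v) → degIn G F v ≡ 4)

Joins : (G : Graph) → Fin (nE G) → Fin (nV G) → Fin (nV G) → Set
Joins G e u v = (ends G e ≡ (u , v)) ⊎ (ends G e ≡ (v , u))

Parallel : (G : Graph) → Fin (nE G) → Fin (nE G) → Set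
Parallel G e f = Joins G f (proj₁ (ends G e)) (proj₂ (ends G e))

Has3ParallelEdges : Graph → Set
Has3ParallelEdges G = ∃[ e₁ ] ∃[ e₂ ] ∃[ e₃ ]
  (e₁ ≢ e₂ × e₁ ≢ e₃ × e₂ ≢ e₃ × Parallel G e₁ e₂ × Parallel G e₁ e₃)

DoubleEdge : (G : Graph) → Fin (nV G) → Fin (nV G) → Set
DoubleEdge G u v = ∃[ e ] ∃[ f ] (e ≢ f × Joins G e u v × Joins G f u v)

HasDoublePath3 : Graph → Set
HasDoublePath3 G = ∃[ v₁ ] ∃[ v₂ ] ∃[ v₃ ] ∃[ v₄ ]
  ( (v₁ ≢ v₂ × v₁ ≢ v₃ × v₁ ≢ v₄ × v₂ ≢ v₃ × v₂ ≢ v₄ × v₃ ≢ v₄)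
  × DoubleEdge G v₁ v₂ × DoubleEdge G v₂ v₃ × DoubleEdge G v₃ v₄)

HasLoop : (G : Graph) → Fin (nV G) → Set
HasLoop G v = ∃[ e ] ends G e ≡ (v , v)

Adj : (G : Graph) → Fin (nV G) → Fin (nV G) → Set
Adj G u v = u ≢ v × ∃[ e ] Joins G e u v

numLoops : Graph → ℕ
numLoops G = count (λ e → ⌊ proj₁ (ends G e) F.≟ proj₂ (ends G e) ⌋)

HasLoopK33 : Graph → Set
HasLoopK33 G = ∃[ u₁ ] ∃[ u₂ ] ∃[ u₃ ] ∃[ v₁ ] ∃[ v₂ ] ∃[ v₃ ]
  ( (u₁ ≢ u₂ × u₁ ≢ u₃ × u₂ ≢ u₃) × (v₁ ≢ v₂ × v₁ ≢ v₃ × v₂ ≢ v₃)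
  × HasLoop G u₁ × HasLoop G u₂ × HasLoop G u₃
  × Adj G u₁ v₁ × Adj G u₁ v₂ × Adj G u₁ v₃
  × Adj G u₂ v₁ × Adj G u₂ v₂ × Adj G u₂ v₃
  × Adj G u₃ v₁ × Adj G u₃ v₂ × Adj G u₃ v₃)

AdjToFourLooped : (G : Graph) → Fin (nV G) → Set
AdjToFourLooped G v = ∃[ w₁ ] ∃[ w₂ ] ∃[ w₃ ] ∃[ w₄ ]
  ( (w₁ ≢ w₂ × w₁ ≢ w₃ × w₁ ≢ w₄ × w₂ ≢ w₃ × w₂ ≢ w₄ × w₃ ≢ w₄)
  × (HasLoop G w₁ × Adj G v w₁) × (HasLoop G w₂ × Adj G v w₂)
  × (HasLoop G w₃ × Adj G v w₃) × (HasLoop G w₄ × Adj G v w₄))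

HasDense4Subgraph : Graph → Set
HasDense4Subgraph G =
  Σ (Fin (nV G) → Bool) λ S → Σ (Fin (nE G) → Bool) λ F →
    IsSubgraph G S F × count S ≡ 4 × 8 ≤ count F

{-# OPTIONS --safe #-}

-- A (4,1)-colouring lives on the colours of half-edges, so one may delete a set S
-- of vertices, join the outer ends of the cut edges in pairs, colour the smaller
-- 5-regular graph by minimality, and give both halves of a joined pair the colour
-- of the new edge. G being uncolourable, this colouring never extends to S.
-- If S carries a 4-regular subgraph, a fresh colour on it always extends: (a).
-- For S of bounded size the extension problem depends only on the multigraph
-- induced on S and on which pairs received equal colours, a finite problem: it is
-- solvable for all forbidden configurations in (b), (d), (e), (g), (h), (i).
-- For (c) the inner vertices of the path are replaced by a double edge between its
-- ends; if the three new edges get distinct colours, the minority colours at the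
-- ends of the path can be changed to the third one.
-- For (f), let the weight of a vertex set be twice its number of loops plus the
-- number of edges leaving it. Every odd set C weighs at least 5: in a smallest
-- counterexample C has 1 or 3 leaving edges and, by counting in a Tutte barrier,
-- C minus the end of any leaving edge has a perfect matching; contracting C to a
-- vertex and colouring C by this matching colours G. Since G has no perfect
-- matching, a Tutte barrier T leaves |T| + 2 odd sets, so 5 (|T| + 2) is at most
-- twice the number of loops plus 5 |T|.
module Submission where

open import Defs
open import Data.Bool using (Bool; true; false; if_then_else_; T; _∧_; _∨_; not)
open import Data.Bool.ListAction using (any; all)
open import Data.Bool.Properties using (∧-comm)
open import Data.Empty using (⊥; ⊥-elim)
open import Data.Fin using (Fin) renaming (zero to fzero; suc to fsuc)
import Data.Fin as F
import Data.Fin.Properties as Fₚ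
open import Data.List using (List; []; _∷_; _++_; map; length; tabulate; lookup; replicate; allFin; filter; zip; concatMap; foldr; filterᵇ)
import Data.List.Properties as Lₚ
import Data.List.Membership.DecPropositional as DecMembership
open import Data.List.Membership.Propositional using (_∈_)
open import Data.List.Membership.Propositional.Properties using (∈-filter⁺; ∈-filter⁻; ∈-allFin; ∈-lookup)
open import Data.List.Relation.Binary.Permutation.Propositional using (_↭_)
import Data.List.Relation.Binary.Permutation.Propositional as Perm
import Data.List.Relation.Binary.Permutation.Propositional.Properties as Permₚ
open import Data.List.Relation.Unary.All using (All; []; _∷_)
import Data.List.Relation.Unary.All as All
import Data.List.Relation.Unary.All.Properties as Allₚ
open import Data.List.Relation.Unary.AllPairs using (AllPairs; []; _∷_; allPairs?)
import Data.List.Relation.Unary.AllPairs as AP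
import Data.List.Relation.Unary.AllPairs.Properties as APₚ
open import Data.List.Relation.Unary.Any using (Any; here; there)
import Data.List.Relation.Unary.Any as Any
import Data.List.Relation.Unary.Any.Properties as Anyₚ
open import Data.List.Relation.Unary.Unique.Propositional using (Unique)
import Data.List.Relation.Unary.Unique.Propositional.Properties as Uniqueₚ
open import Data.Maybe using (Maybe; just; nothing; fromMaybe)
open import Data.Nat using (ℕ; zero; suc; _+_; _*_; _∸_; _≤_; _<_; z≤n; s≤s; _≡ᵇ_; _≤ᵇ_; _<ᵇ_; _⊔_)
import Data.Nat as N
open import Data.Nat.DivMod using (_%_; _/_; m≡m%n+[m/n]*n; m%n<n; [m+kn]%n≡m%n; m*n%n≡0)
open import Data.Nat.Properties
open import Data.Nat.Tactic.RingSolver using (solve-∀)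
open import Data.Product using (Σ; ∃-syntax; _×_; _,_; proj₁; proj₂)
open import Data.Sum using (_⊎_; inj₁; inj₂)
open import Data.Unit using (tt)
open import Data.Vec using (Vec)
import Data.Vec as Vec
open import Function using (_∘_; id; case_of_)
open import Relation.Nullary using (¬_; Dec; yes; no; contradiction)
open import Relation.Nullary.Decidable using (⌊_⌋; T?; _×-dec_; _⊎-dec_; ¬?; True; toWitness; fromWitness; isYes≗does)
open import Relation.Binary.PropositionalEquality using (_≡_; _≢_; refl; sym; trans; cong; cong₂; subst; subst₂; module ≡-Reasoning)

-- When the number of cut edges is odd, one of them has no partner; its inner end then stays, filled
-- up with two loops. Hence S must have two vertices for the new graph to be smaller. Graphs are
-- treated as edge lists on the vertices of G, up to order and orientation, so that a smaller graph
-- keeps the old vertex names and colourings are cut and glued as lists. The finite problems are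
-- decided by evaluation: an unverified search proposes colours and a verified test accepts them,
-- for every multigraph on S that extends the forced edges. To keep this enumeration small, the
-- configurations on two vertices are settled first, and their absence prunes the larger searches.
-- Matching theory is classical here: no maximum matching is computed. Since its conclusions are
-- contradictions, it is carried out under a double negation. In a Tutte barrier the surplus of odd
-- sets is two, not one, because the vertex set in question has even size. One surplus set pays for
-- the vertex removed from C; the edge leaving C at this vertex gains another 2, and so a light odd
-- set would weigh at least 7.

private variable
  A B : Set
  n k : ℕ

-- Sums over lists

sumL : (A → ℕ) → List A → ℕ
sumL f []       = 0
sumL f (x ∷ xs) = f x + sumL f xs

sumL-++ : ∀ (f : A → ℕ) xs ys → sumL f (xs ++ ys) ≡ sumL f xs + sumL f ys
sumL-++ f []       ys = refl
sumL-++ f (x ∷ xs) ys rewrite sumL-++ f xs ys = sym (+-assoc (f x) _ _)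

sumL-map : ∀ (f : B → ℕ) (g : A → B) xs → sumL f (map g xs) ≡ sumL (f ∘ g) xs
sumL-map f g []       = refl
sumL-map f g (x ∷ xs) = cong (f (g x) +_) (sumL-map f g xs)

sumL-congᴬ : ∀ {f g : A → ℕ} {xs} → All (λ x → f x ≡ g x) xs → sumL f xs ≡ sumL g xs
sumL-congᴬ []       = refl
sumL-congᴬ (p ∷ ps) = cong₂ _+_ p (sumL-congᴬ ps)

sumL-cong : ∀ {f g : A → ℕ} → (∀ x → f x ≡ g x) → ∀ xs → sumL f xs ≡ sumL g xs
sumL-cong p xs = sumL-congᴬ (All.universal p xs)

sumL-≤ᴬ : ∀ {f g : A → ℕ} {xs} → All (λ x → f x ≤ g x) xs → sumL f xs ≤ sumL g xs
sumL-≤ᴬ []       = z≤n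
sumL-≤ᴬ (p ∷ ps) = +-mono-≤ p (sumL-≤ᴬ ps)

sumL-≤ : ∀ {f g : A → ℕ} → (∀ x → f x ≤ g x) → ∀ xs → sumL f xs ≤ sumL g xs
sumL-≤ p xs = sumL-≤ᴬ (All.universal p xs)

sumL-0ᴬ : ∀ {f : A → ℕ} {xs} → All (λ x → f x ≡ 0) xs → sumL f xs ≡ 0
sumL-0ᴬ []       = refl
sumL-0ᴬ (p ∷ ps) = cong₂ _+_ p (sumL-0ᴬ ps)

interchange : ∀ a b c d → (a + b) + (c + d) ≡ (a + c) + (b + d)
interchange = solve-∀

sumL-+ : ∀ (f g : A → ℕ) xs → sumL (λ x → f x + g x) xs ≡ sumL f xs + sumL g xs
sumL-+ f g []       = refl
sumL-+ f g (x ∷ xs) rewrite sumL-+ f g xs = interchange (f x) (g x) _ _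

sumL-const0 : ∀ (xs : List A) → sumL (λ _ → 0) xs ≡ 0
sumL-const0 []       = refl
sumL-const0 (x ∷ xs) = sumL-const0 xs

sumL-swap : ∀ (f : A → B → ℕ) xs ys →
  sumL (λ x → sumL (f x) ys) xs ≡ sumL (λ y → sumL (λ x → f x y) xs) ys
sumL-swap f []       ys = sym (sumL-const0 ys)
sumL-swap f (x ∷ xs) ys = begin
  sumL (f x) ys + sumL (λ x → sumL (f x) ys) xs ≡⟨ cong (sumL (f x) ys +_) (sumL-swap f xs ys) ⟩
  sumL (f x) ys + sumL (λ y → sumL (λ x → f x y) xs) ys ≡⟨ sumL-+ (f x) _ ys ⟨
  sumL (λ y → f x y + sumL (λ x → f x y) xs) ys ∎
  where open ≡-Reasoning

sumL-tabulate : ∀ (f : A → ℕ) {m} (g : Fin m → A) → sumL f (tabulate g) ≡ sumFin (f ∘ g)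
sumL-tabulate f {zero}  g = refl
sumL-tabulate f {suc m} g = cong (f (g fzero) +_) (sumL-tabulate f (g ∘ fsuc))

sumFin-lookup : ∀ (f : A → ℕ) xs → sumFin (λ i → f (lookup xs i)) ≡ sumL f xs
sumFin-lookup f []       = refl
sumFin-lookup f (x ∷ xs) = cong (f x +_) (sumFin-lookup f xs)

sumFin-cong : ∀ {m} {f g : Fin m → ℕ} → (∀ i → f i ≡ g i) → sumFin f ≡ sumFin g
sumFin-cong {zero}  p = refl
sumFin-cong {suc m} p = cong₂ _+_ (p fzero) (sumFin-cong (p ∘ fsuc))

sumFin-pos : ∀ {m} (f : Fin m → ℕ) → 1 ≤ sumFin f → ∃[ i ] 1 ≤ f i
sumFin-pos {suc m} f p with f fzero in eq
... | suc x = fzero , subst (1 ≤_) (sym eq) (s≤s z≤n)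
... | zero  = let i , q = sumFin-pos (f ∘ fsuc) p in fsuc i , q

-- Edge lists

Edge : ℕ → Set
Edge n = Fin n × Fin n

CEdge : ℕ → Set
CEdge n = ℕ × Edge n

δ : Fin n → Fin n → ℕ
δ x v = if ⌊ x F.≟ v ⌋ then 1 else 0

δ-refl : ∀ (x : Fin n) → δ x x ≡ 1
δ-refl x with x F.≟ x
... | yes _ = refl
... | no ¬p = contradiction refl ¬p

δ-≢ : ∀ {x v : Fin n} → x ≢ v → δ x v ≡ 0
δ-≢ {x = x} {v} x≢v with x F.≟ v
... | yes p = contradiction p x≢v
... | no  _ = refl

δ-⇔ : ∀ {x v : Fin n} {y w : Fin k} → (x ≡ v → y ≡ w) → (y ≡ w → x ≡ v) → δ x v ≡ δ y w
δ-⇔ {x = x} {v} {y} {w} f g with x F.≟ v | y F.≟ w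
... | yes p | yes q = refl
... | yes p | no ¬q = contradiction (f p) ¬q
... | no ¬p | yes q = contradiction (g q) ¬p
... | no ¬p | no ¬q = refl

δ-pos : ∀ {x v : Fin n} → 1 ≤ δ x v → x ≡ v
δ-pos {x = x} {v} p with x F.≟ v
... | yes q = q
... | no  _ = contradiction p λ ()

ends# : Edge n → Fin n → ℕ
ends# (x , y) v = δ x v + δ y v

deg# : List (Edge n) → Fin n → ℕ
deg# L v = sumL (λ e → ends# e v) L

cends# : ℕ → Fin n → CEdge n → ℕ
cends# a v (c , e) = if ⌊ c N.≟ a ⌋ then ends# e v else 0

cdeg : List (CEdge n) → ℕ → Fin n → ℕ
cdeg C a v = sumL (cends# a v) C

OK : List (CEdge n) → Fin n → Set
OK C v = ∃[ a ] ∃[ b ] (a ≢ b × cdeg C a v ≡ 4 × cdeg C b v ≡ 1)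

strip : List (CEdge n) → List (Edge n)
strip = map proj₂

OK-resp : ∀ {C D : List (CEdge n)} {v} → (∀ a → cdeg C a v ≡ cdeg D a v) → OK C v → OK D v
OK-resp eq (a , b , a≢b , p , q) = a , b , a≢b , trans (sym (eq a)) p , trans (sym (eq b)) q

infix 3 _∼_
-- Equality of undirected multigraphs on a fixed vertex set. As it is generated by few moves, each
-- invariant and the transport of colours need only a five-case induction.
data _∼_ {n} : List (Edge n) → List (Edge n) → Set where
  ∼refl  : ∀ {L} → L ∼ L
  ∼trans : ∀ {L M N} → L ∼ M → M ∼ N → L ∼ N
  ∼prep  : ∀ {e L M} → L ∼ M → e ∷ L ∼ e ∷ M
  ∼swap  : ∀ {e f L} → e ∷ f ∷ L ∼ f ∷ e ∷ L
  ∼flip  : ∀ {x y L} → (x , y) ∷ L ∼ (y , x) ∷ L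

∼sym : ∀ {L M : List (Edge n)} → L ∼ M → M ∼ L
∼sym ∼refl        = ∼refl
∼sym (∼trans p q) = ∼trans (∼sym q) (∼sym p)
∼sym (∼prep p)    = ∼prep (∼sym p)
∼sym ∼swap        = ∼swap
∼sym ∼flip        = ∼flip

∼reflexive : ∀ {L M : List (Edge n)} → L ≡ M → L ∼ M
∼reflexive refl = ∼refl

↭⇒∼ : ∀ {L M : List (Edge n)} → L ↭ M → L ∼ M
↭⇒∼ Perm.refl         = ∼refl
↭⇒∼ (Perm.prep x p)   = ∼prep (↭⇒∼ p)
↭⇒∼ (Perm.swap x y p) = ∼trans ∼swap (∼prep (∼prep (↭⇒∼ p)))
↭⇒∼ (Perm.trans p q)  = ∼trans (↭⇒∼ p) (↭⇒∼ q)

∼++ˡ : ∀ (K : List (Edge n)) {L M} → L ∼ M → K ++ L ∼ K ++ M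
∼++ˡ []      p = p
∼++ˡ (e ∷ K) p = ∼prep (∼++ˡ K p)

∼++ʳ : ∀ {L M : List (Edge n)} (K : List (Edge n)) → L ∼ M → L ++ K ∼ M ++ K
∼++ʳ K ∼refl        = ∼refl
∼++ʳ K (∼trans p q) = ∼trans (∼++ʳ K p) (∼++ʳ K q)
∼++ʳ K (∼prep p)    = ∼prep (∼++ʳ K p)
∼++ʳ K ∼swap        = ∼swap
∼++ʳ K ∼flip        = ∼flip

∼map : ∀ (s : Fin n → Fin k) {L M} → L ∼ M → map (λ (x , y) → s x , s y) L ∼ map (λ (x , y) → s x , s y) M
∼map s ∼refl        = ∼refl
∼map s (∼trans p q) = ∼trans (∼map s p) (∼map s q)
∼map s (∼prep p)    = ∼prep (∼map s p)
∼map s ∼swap        = ∼swap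
∼map s ∼flip        = ∼flip

swap-heads : ∀ a b s → a + (b + s) ≡ b + (a + s)
swap-heads = solve-∀

sumL-∼ : ∀ {f : Edge n → ℕ} → (∀ x y → f (x , y) ≡ f (y , x)) →
  ∀ {L M} → L ∼ M → sumL f L ≡ sumL f M
sumL-∼ fl ∼refl        = refl
sumL-∼ fl (∼trans p q) = trans (sumL-∼ fl p) (sumL-∼ fl q)
sumL-∼ {f = f} fl (∼prep {e} p) = cong (f e +_) (sumL-∼ fl p)
sumL-∼ {f = f} fl (∼swap {e} {g} {L}) = swap-heads (f e) (f g) _
sumL-∼ {f = f} fl (∼flip {x} {y} {L}) = cong (_+ sumL f L) (fl x y)

All-∼ : ∀ {P : Edge n → Set} → (∀ {x y} → P (x , y) → P (y , x)) →
  ∀ {L M} → L ∼ M → All P L → All P M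
All-∼ fl ∼refl        ps           = ps
All-∼ fl (∼trans p q) ps           = All-∼ fl q (All-∼ fl p ps)
All-∼ fl (∼prep p)    (x ∷ ps)     = x ∷ All-∼ fl p ps
All-∼ fl ∼swap        (x ∷ y ∷ ps) = y ∷ x ∷ ps
All-∼ fl ∼flip        (x ∷ ps)     = fl x ∷ ps

ends#-flip : ∀ (v x y : Fin n) → ends# (x , y) v ≡ ends# (y , x) v
ends#-flip v x y = +-comm (δ x v) (δ y v)

deg#-∼ : ∀ {L M : List (Edge n)} → L ∼ M → ∀ v → deg# L v ≡ deg# M v
deg#-∼ p v = sumL-∼ (ends#-flip v) p

deg#-++ : ∀ (L M : List (Edge n)) v → deg# (L ++ M) v ≡ deg# L v + deg# M v
deg#-++ L M v = sumL-++ _ L M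

cdeg-++ : ∀ (C D : List (CEdge n)) a v → cdeg (C ++ D) a v ≡ cdeg C a v + cdeg D a v
cdeg-++ C D a v = sumL-++ _ C D

length-∼ : ∀ {L M : List (Edge n)} → L ∼ M → length L ≡ length M
length-∼ ∼refl        = refl
length-∼ (∼trans p q) = trans (length-∼ p) (length-∼ q)
length-∼ (∼prep p)    = cong suc (length-∼ p)
length-∼ ∼swap        = refl
length-∼ ∼flip        = refl

-- Each generating move also acts on coloured edges, the colour travelling with its edge. So edges
-- may be listed in whatever arrangement suits an argument.
recolour : ∀ {L M : List (Edge n)} → L ∼ M → ∀ C → strip C ≡ L →
  ∃[ D ] (strip D ≡ M × ∀ a v → cdeg C a v ≡ cdeg D a v)
recolour ∼refl C eq = C , eq , λ _ _ → refl
recolour (∼trans p q) C eq =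
  let D , eqD , cD = recolour p C eq
      D′ , eqD′ , cD′ = recolour q D eqD
  in D′ , eqD′ , λ a v → trans (cD a v) (cD′ a v)
recolour (∼prep p) (c ∷ C) refl =
  let D , eqD , cD = recolour p C refl
  in c ∷ D , cong (_ ∷_) eqD , λ a v → cong (cends# a v c +_) (cD a v)
recolour ∼swap (c ∷ d ∷ C) refl =
  d ∷ c ∷ C , refl , λ a v → swap-heads (cends# a v c) (cends# a v d) _
recolour ∼flip ((c , x , y) ∷ C) refl =
  (c , y , x) ∷ C , refl , λ a v →
    cong (λ t → (if ⌊ c N.≟ a ⌋ then t else 0) + cdeg C a v) (ends#-flip v x y)

strip-++⁻ : ∀ (L M : List (Edge n)) C → strip C ≡ L ++ M →
  ∃[ D ] ∃[ D′ ] (C ≡ D ++ D′ × strip D ≡ L × strip D′ ≡ M)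
strip-++⁻ []      M C eq = [] , C , refl , refl , eq
strip-++⁻ (e ∷ L) M (c ∷ C) eq =
  let D , D′ , p , q , r = strip-++⁻ L M C (Lₚ.∷-injectiveʳ eq)
  in c ∷ D , D′ , cong (c ∷_) p , cong₂ _∷_ (Lₚ.∷-injectiveˡ eq) q , r

strip-++ : ∀ (C D : List (CEdge n)) → strip (C ++ D) ≡ strip C ++ strip D
strip-++ = Lₚ.map-++ proj₂

paint : ℕ → List (Edge n) → List (CEdge n)
paint c = map (c ,_)

strip-paint : ∀ c (L : List (Edge n)) → strip (paint c L) ≡ L
strip-paint c []      = refl
strip-paint c (e ∷ L) = cong (e ∷_) (strip-paint c L)

cends#-same : ∀ a v (e : Edge n) → cends# a v (a , e) ≡ ends# e v
cends#-same a v e with a N.≟ a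
... | yes _ = refl
... | no ¬p = contradiction refl ¬p

cends#-diff : ∀ {a c} → c ≢ a → ∀ v (e : Edge n) → cends# a v (c , e) ≡ 0
cends#-diff {a = a} {c} c≢a v e with c N.≟ a
... | yes p = contradiction p c≢a
... | no  _ = refl

cdeg-paint : ∀ a (L : List (Edge n)) v → cdeg (paint a L) a v ≡ deg# L v
cdeg-paint a L v = trans (sumL-map _ _ L) (sumL-cong (cends#-same a v) L)

cdeg-paint-≢ : ∀ {a c} → c ≢ a → ∀ (L : List (Edge n)) v → cdeg (paint c L) a v ≡ 0
cdeg-paint-≢ c≢a L v =
  trans (sumL-map _ _ L) (sumL-0ᴬ (All.universal (λ e → cends#-diff c≢a v e) L))

cends#-≤ : ∀ a v (c : CEdge n) → cends# a v c ≤ ends# (proj₂ c) v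
cends#-≤ a v (c , e) with c N.≟ a
... | yes _ = ≤-refl
... | no  _ = z≤n

cdeg-≤ : ∀ (C : List (CEdge n)) a v → cdeg C a v ≤ deg# (strip C) v
cdeg-≤ C a v = ≤-trans (sumL-≤ (cends#-≤ a v) C) (≤-reflexive (sym (sumL-map _ proj₂ C)))

fresh : ∀ (C : List (CEdge n)) → ∃[ b ] (∀ a → b ≤ a → ∀ v → cdeg C a v ≡ 0)
fresh [] = 0 , λ _ _ _ → refl
fresh ((c , e) ∷ C) =
  let b , p = fresh C in
  suc c + b , λ a le v → cong₂ _+_
    (cends#-diff (<⇒≢ (≤-trans (m≤m+n (suc c) b) le)) v e)
    (p a (≤-trans (m≤n+m b (suc c)) le) v)

-- Multiplicities and extraction of edges

Same : Edge n → Edge n → Set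
Same (a , b) (x , y) = (a ≡ x × b ≡ y) ⊎ (a ≡ y × b ≡ x)

same? : (e f : Edge n) → Dec (Same e f)
same? (a , b) (x , y) = ((a F.≟ x) ×-dec (b F.≟ y)) ⊎-dec ((a F.≟ y) ×-dec (b F.≟ x))

-- A loop counts once here, unlike in `ends#`, so that `mult L v v` is the number of loops at `v`.
joins : Edge n → Fin n → Fin n → ℕ
joins e x y = if ⌊ same? e (x , y) ⌋ then 1 else 0

joins-pos : ∀ (e : Edge n) x y → 1 ≤ joins e x y → Same e (x , y)
joins-pos e x y p with same? e (x , y)
... | yes q = q
... | no  _ = contradiction p λ ()

joins-same : ∀ (e : Edge n) x y → Same e (x , y) → joins e x y ≡ 1
joins-same e x y p with same? e (x , y)
... | yes _ = refl
... | no ¬q = contradiction p ¬q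

joins-diff : ∀ (e : Edge n) x y → ¬ Same e (x , y) → joins e x y ≡ 0
joins-diff e x y ¬p with same? e (x , y)
... | yes q = contradiction q ¬p
... | no  _ = refl

Same-flip : ∀ {a b : Fin n} {f} → Same (a , b) f → Same (b , a) f
Same-flip (inj₁ (p , q)) = inj₂ (q , p)
Same-flip (inj₂ (p , q)) = inj₁ (q , p)

joins-flip : ∀ (x y a b : Fin n) → joins (a , b) x y ≡ joins (b , a) x y
joins-flip x y a b with same? (a , b) (x , y) | same? (b , a) (x , y)
... | yes _ | yes _ = refl
... | yes p | no ¬q = contradiction (Same-flip p) ¬q
... | no ¬p | yes q = contradiction (Same-flip q) ¬p
... | no  _ | no  _ = refl

mult : List (Edge n) → Fin n → Fin n → ℕ
mult L x y = sumL (λ e → joins e x y) L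

mult-∼ : ∀ {L M : List (Edge n)} → L ∼ M → ∀ x y → mult L x y ≡ mult M x y
mult-∼ p x y = sumL-∼ (joins-flip x y) p

Same⇒∼ : ∀ {e f : Edge n} {L} → Same e f → e ∷ L ∼ f ∷ L
Same⇒∼ (inj₁ (refl , refl)) = ∼refl
Same⇒∼ (inj₂ (refl , refl)) = ∼flip

sumL-extract : ∀ (f : Edge n → ℕ) L → 1 ≤ sumL f L → ∃[ e ] ∃[ L′ ] (1 ≤ f e × L ∼ e ∷ L′)
sumL-extract f (e ∷ L) p with f e in eq
... | suc _ = e , L , subst (1 ≤_) (sym eq) (s≤s z≤n) , ∼refl
... | zero  = let e′ , L′ , q , r = sumL-extract f L p in e′ , e ∷ L′ , q , ∼trans (∼prep r) ∼swap

mult-extract : ∀ (L : List (Edge n)) x y → 1 ≤ mult L x y → ∃[ L′ ] L ∼ (x , y) ∷ L′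
mult-extract L x y p =
  let e , L′ , q , r = sumL-extract _ L p
  in L′ , ∼trans r (Same⇒∼ (joins-pos e x y q))

deg#-extract : ∀ (L : List (Edge n)) v → 1 ≤ deg# L v → ∃[ x ] ∃[ L′ ] L ∼ (v , x) ∷ L′
deg#-extract L v p with sumL-extract (λ e → ends# e v) L p
... | (x , y) , L′ , q , r with x F.≟ v
...   | yes refl = y , L′ , r
...   | no  _ with refl ← δ-pos {x = y} q = x , L′ , ∼trans r ∼flip

-- Multiplicities determine a multigraph up to `∼`. Taking the first edge of `K` out of both lists
-- lowers both multiplicity functions alike, which keeps the hypothesis alive.
mult-sub : ∀ (K L : List (Edge n)) → (∀ x y → mult K x y ≤ mult L x y) → ∃[ R ] L ∼ K ++ R
mult-sub [] L le = L , ∼refl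
mult-sub ((x , y) ∷ K) L le =
  let L′ , p = mult-extract L x y (≤-trans (m≤m+n 1 (mult K x y))
                 (subst (λ t → t + mult K x y ≤ mult L x y) (joins-same (x , y) x y (inj₁ (refl , refl))) (le x y)))
      R , q = mult-sub K L′ (λ a b → +-cancelˡ-≤ (joins (x , y) a b) _ _
                 (≤-trans (le a b) (≤-reflexive (mult-∼ p a b))))
  in R , ∼trans p (∼prep q)

-- Passing between graphs and edge lists; minimality

lookup-injective : ∀ {xs : List A} → Unique xs → ∀ {i j} → lookup xs i ≡ lookup xs j → i ≡ j
lookup-injective (x∉ ∷ u) {fzero}  {fzero}  eq = refl
lookup-injective (x∉ ∷ u) {fzero}  {fsuc j} eq = contradiction eq (All.lookup x∉ (∈-lookup j))
lookup-injective (x∉ ∷ u) {fsuc i} {fzero}  eq = contradiction (sym eq) (All.lookup x∉ (∈-lookup i))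
lookup-injective (x∉ ∷ u) {fsuc i} {fsuc j} eq = cong fsuc (lookup-injective u eq)

colours-tabulate : ∀ {m} (g : Fin m → Edge n) C → strip C ≡ tabulate g →
  Σ (Fin m → ℕ) λ c → C ≡ tabulate (λ i → c i , g i)
colours-tabulate {m = zero}  g [] eq = (λ ()) , refl
colours-tabulate {m = suc m} g ((c₀ , e) ∷ C) eq =
  let c , p = colours-tabulate (g ∘ fsuc) C (Lₚ.∷-injectiveʳ eq)
  in (λ { fzero → c₀ ; (fsuc i) → c i })
   , cong₂ _∷_ (cong (c₀ ,_) (Lₚ.∷-injectiveˡ eq)) p

colDeg-pos : ∀ G c a v → 1 ≤ colDeg G c a v → ∃[ e ] c e ≡ a
colDeg-pos G c a v p with sumFin-pos _ p
... | e , q with c e N.≟ a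
...   | yes r = e , r
...   | no  _ = contradiction q λ ()

edges : (G : Graph) → List (Edge (nV G))
edges G = tabulate (ends G)

deg#-edges : ∀ G v → deg# (edges G) v ≡ deg G v
deg#-edges G v = sumL-tabulate (λ e → ends# e v) (ends G)

-- The vertex is there to supply the two different colours that a colouring must use.
OK⇒Has41Coloring : ∀ G → Fin (nV G) → ∀ C → strip C ≡ edges G → (∀ v → OK C v) → Has41Coloring G
OK⇒Has41Coloring G v₀ C eq ok with colours-tabulate (ends G) C eq
... | c , refl = c , two , good
  where
  cdeg≡ : ∀ a v → cdeg C a v ≡ colDeg G c a v
  cdeg≡ a v = sumL-tabulate (cends# a v) (λ i → c i , ends G i)
  good : ∀ v → ∃[ a ] ∃[ b ] (a ≢ b × colDeg G c a v ≡ 4 × colDeg G c b v ≡ 1)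
  good v = let a , b , a≢b , p , q = ok v in
    a , b , a≢b , trans (sym (cdeg≡ a v)) p , trans (sym (cdeg≡ b v)) q
  two : ∃[ e ] ∃[ e′ ] c e ≢ c e′
  two = let a , b , a≢b , p , q = good v₀
            e , ce = colDeg-pos G c a v₀ (subst (1 ≤_) (sym p) (s≤s z≤n))
            f , cf = colDeg-pos G c b v₀ (≤-reflexive (sym q))
        in e , f , λ r → a≢b (trans (sym ce) (trans r cf))

module Relabel {n} (kept : Fin n → Bool) (v₀ : Fin n) (kv₀ : T (kept v₀)) where
  open DecMembership (F._≟_ {n}) using (_∈?_)

  vs : List (Fin n)
  vs = filter (T? ∘ kept) (allFin n)

  ∈vs : ∀ {v} → T (kept v) → v ∈ vs
  ∈vs {v} kv = ∈-filter⁺ (T? ∘ kept) (∈-allFin v) kv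

  idx : Fin n → Fin (length vs)
  idx v with v ∈? vs
  ... | yes p = Any.index p
  -- Default for vertices that are not kept; the edges relabelled later have no such end.
  ... | no  _ = Any.index (∈vs kv₀)

  lookup-idx : ∀ {v} → T (kept v) → lookup vs (idx v) ≡ v
  lookup-idx {v} kv with v ∈? vs
  ... | yes p = sym (Anyₚ.lookup-index p)
  ... | no ¬p = contradiction (∈vs kv) ¬p

  kept-lookup : ∀ j → T (kept (lookup vs j))
  kept-lookup j = proj₂ (∈-filter⁻ (T? ∘ kept) {xs = allFin n} (∈-lookup j))

  idx-lookup : ∀ j → idx (lookup vs j) ≡ j
  idx-lookup j = lookup-injective (Uniqueₚ.filter⁺ (T? ∘ kept) (Uniqueₚ.allFin⁺ n))
    (lookup-idx (kept-lookup j))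

  δ-idx : ∀ {x} → T (kept x) → ∀ j → δ (idx x) j ≡ δ x (lookup vs j)
  δ-idx kx j = δ-⇔ (λ { refl → sym (lookup-idx kx) }) (λ { refl → idx-lookup j })

  smaller : ∀ v → ¬ T (kept v) → length vs < n
  smaller v ¬kv = subst (length vs <_) (Lₚ.length-tabulate id)
    (Lₚ.filter-notAll (T? ∘ kept) (allFin n) (Any.map (λ { refl → ¬kv }) (∈-allFin v)))

Within : (Fin n → Bool) → Edge n → Set
Within S (x , y) = T (S x) × T (S y)

module Minimal (G : Graph) (mc : MinimalCounterexample G) where

  V : Set
  V = Fin (nV G)

  E : List (Edge (nV G))
  E = edges G

  degE : ∀ v → deg# E v ≡ 5
  degE v = trans (deg#-edges G v) (proj₁ (proj₂ mc) v)

  v₀ : V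
  v₀ with nV G | proj₁ mc
  ... | suc _ | _ = fzero

  uncolourable : ∀ C → strip C ∼ E → ¬ (∀ v → OK C v)
  uncolourable C p ok =
    let D , eq , cd = recolour p C refl
    in proj₁ (proj₂ (proj₂ mc)) (OK⇒Has41Coloring G v₀ D eq
         (λ v → OK-resp {C = C} {D} (λ a → cd a v) (ok v)))

  -- Minimality, restated for edge lists on the old vertices. The two existence hypotheses make the
  -- new graph nonempty and smaller than `G`.
  smaller-colourable : ∀ (kept : V → Bool) L → All (Within kept) L →
    (∀ v → T (kept v) → deg# L v ≡ 5) → ∃[ v ] T (kept v) → ∃[ v ] ¬ T (kept v) →
    ∃[ C ] (strip C ≡ L × ∀ v → T (kept v) → OK C v)
  smaller-colourable kept L within deg5 (v , kv) (w , ¬kw) = C , stripC , okC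
    where
    open Relabel kept v kv
    H : Graph
    H = record { nV = length vs ; nE = length L
               ; ends = λ i → idx (proj₁ (lookup L i)) , idx (proj₂ (lookup L i)) }
    incH : ∀ j i → inc H j i ≡ ends# (lookup L i) (lookup vs j)
    incH j i = let kx , ky = All.lookup within (∈-lookup i) in cong₂ _+_ (δ-idx kx j) (δ-idx ky j)
    regular : Regular 5 H
    regular j = trans (sumFin-cong (incH j))
      (trans (sumFin-lookup (λ e → ends# e (lookup vs j)) L) (deg5 _ (kept-lookup j)))
    coloured : Has41Coloring H
    coloured = proj₂ (proj₂ (proj₂ mc)) H (≤-trans (s≤s z≤n) (Fₚ.toℕ<n (idx v))) (smaller w ¬kw) regular
    c : Fin (length L) → ℕ
    c = proj₁ coloured
    C : List (CEdge (nV G))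
    C = tabulate (λ i → c i , lookup L i)
    stripC : strip C ≡ L
    stripC = trans (Lₚ.map-tabulate (λ i → c i , lookup L i) proj₂) (Lₚ.tabulate-lookup L)
    cdegC : ∀ a j → colDeg H c a j ≡ cdeg C a (lookup vs j)
    cdegC a j = trans
      (sumFin-cong λ i → cong (λ t → if ⌊ c i N.≟ a ⌋ then t else 0) (incH j i))
      (sym (sumL-tabulate (cends# a (lookup vs j)) (λ i → c i , lookup L i)))
    okC : ∀ v → T (kept v) → OK C v
    okC v kv = let a , b , a≢b , p , q = proj₂ (proj₂ coloured) (idx v) in
      subst (OK C) (lookup-idx kv)
        (a , b , a≢b , trans (sym (cdegC a (idx v))) p , trans (sym (cdegC b (idx v))) q)

-- Deleting a vertex set

Outside : (Fin n → Bool) → Edge n → Set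
Outside S (x , y) = ¬ T (S x) × ¬ T (S y)

-- Crossing edges are oriented from S to its complement.
Crosses : (Fin n → Bool) → Edge n → Set
Crosses S (x , y) = T (S x) × ¬ T (S y)

Avoids : Fin n → Edge n → Set
Avoids v (x , y) = x ≢ v × y ≢ v

deg#-Avoids : ∀ {v} {L : List (Edge n)} → All (Avoids v) L → deg# L v ≡ 0
deg#-Avoids av = sumL-0ᴬ (All.map (λ (p , q) → cong₂ _+_ (δ-≢ p) (δ-≢ q)) av)

separated : ∀ (S : Fin n → Bool) {x v} → T (S x) → ¬ T (S v) → x ≢ v
separated S Sx ¬Sv refl = ¬Sv Sx

Within-Avoids : ∀ {S : Fin n → Bool} {v} → ¬ T (S v) → ∀ {e} → Within S e → Avoids v e
Within-Avoids {S = S} ¬Sv (p , q) = separated S p ¬Sv , separated S q ¬Sv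

Outside-Avoids : ∀ {S : Fin n → Bool} {v} → T (S v) → ∀ {e} → Outside S e → Avoids v e
Outside-Avoids {S = S} Sv (p , q) = (λ r → separated S Sv p (sym r)) , (λ r → separated S Sv q (sym r))

cdeg-0 : ∀ (C : List (CEdge n)) a v → deg# (strip C) v ≡ 0 → cdeg C a v ≡ 0
cdeg-0 C a v p = n≤0⇒n≡0 (subst (cdeg C a v ≤_) p (cdeg-≤ C a v))

All-⊥ : ∀ {P : A → Set} {xs} → (∀ {x} → P x → ⊥) → All P xs → xs ≡ []
All-⊥ ¬P []      = refl
All-⊥ ¬P (p ∷ _) = ⊥-elim (¬P p)

-- Colours of the cut edges in the order of joining: the two halves of a new edge share its colour,
-- and the last cut edge may be without partner.
data Paired : List ℕ → Set where
  []     : Paired []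
  single : ∀ c → Paired (c ∷ [])
  pair   : ∀ c {cs} → Paired cs → Paired (c ∷ c ∷ cs)

-- If the number of cut edges is odd, the inner end of the last one survives
-- as a vertex with two loops.
pairUp : List (Edge n) → List (Edge n)
pairUp []                      = []
pairUp ((s , x) ∷ [])          = (s , x) ∷ (s , s) ∷ (s , s) ∷ []
pairUp ((s , x) ∷ (t , y) ∷ B) = (x , y) ∷ pairUp B

isPendant : List (Edge n) → Fin n → Bool
isPendant []             v = false
isPendant ((s , x) ∷ []) v = ⌊ s F.≟ v ⌋
isPendant (_ ∷ _ ∷ B)    v = isPendant B v

isPendant-unique : ∀ (B : List (Edge n)) {v w} → T (isPendant B v) → T (isPendant B w) → v ≡ w
isPendant-unique ((s , x) ∷ []) {v} {w} p q with s F.≟ v | s F.≟ w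
... | yes refl | yes refl = refl
isPendant-unique (_ ∷ _ ∷ B) p q = isPendant-unique B p q

module _ (S : Fin n → Bool) where

  keptBy : List (Edge n) → Fin n → Bool
  keptBy B v = not (S v) ∨ isPendant B v

  keptBy-out : ∀ B {v} → ¬ T (S v) → T (keptBy B v)
  keptBy-out B {v} ¬Sv with S v
  ... | true  = contradiction tt ¬Sv
  ... | false = tt

  keptBy-pendant : ∀ B {v} → T (isPendant B v) → T (keptBy B v)
  keptBy-pendant B {v} p with S v
  ... | true  = p
  ... | false = tt

  keptBy-cases : ∀ B {v} → T (keptBy B v) → ¬ T (S v) ⊎ (T (S v) × T (isPendant B v))
  keptBy-cases B {v} p with S v
  ... | true  = inj₂ (tt , p)
  ... | false = inj₁ λ ()

  pairUp-Within : ∀ {B} → All (Crosses S) B → All (Within (keptBy B)) (pairUp B)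
  pairUp-Within [] = []
  pairUp-Within {(s , x) ∷ []} ((_ , ¬Sx) ∷ []) = (ks , keptBy-out ((s , x) ∷ []) ¬Sx) ∷ (ks , ks) ∷ (ks , ks) ∷ []
    where
    ks : T (keptBy ((s , x) ∷ []) s)
    ks = keptBy-pendant ((s , x) ∷ []) (subst T (sym (dec-true-s)) tt)
      where
      dec-true-s : ⌊ s F.≟ s ⌋ ≡ true
      dec-true-s with s F.≟ s
      ... | yes _ = refl
      ... | no ¬p = contradiction refl ¬p
  pairUp-Within {_ ∷ _ ∷ B} ((_ , ¬Sx) ∷ (_ , ¬Sy) ∷ cr) =
    (keptBy-out B ¬Sx , keptBy-out B ¬Sy) ∷ pairUp-Within cr

  deg#-pairUp : ∀ {B v} → All (Crosses S) B → ¬ T (S v) → deg# (pairUp B) v ≡ deg# B v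
  deg#-pairUp [] ¬Sv = refl
  deg#-pairUp ((Ss , _) ∷ []) ¬Sv rewrite δ-≢ (separated S Ss ¬Sv) = refl
  deg#-pairUp {(s , x) ∷ (t , y) ∷ B} {v} ((Ss , _) ∷ (St , _) ∷ cr) ¬Sv
    rewrite δ-≢ (separated S Ss ¬Sv) | δ-≢ (separated S St ¬Sv) | deg#-pairUp cr ¬Sv = +-assoc (δ x v) (δ y v) _

  deg#-pendant : ∀ {B v} → All (Crosses S) B → T (S v) → T (isPendant B v) → deg# (pairUp B) v ≡ 5
  deg#-pendant {(s , x) ∷ []} {v} ((Ss , ¬Sx) ∷ []) Sv p with s F.≟ v
  ... | yes refl rewrite δ-≢ (λ r → separated S Sv ¬Sx (sym r)) = refl
  deg#-pendant {(s , x) ∷ (t , y) ∷ B} ((_ , ¬Sx) ∷ (_ , ¬Sy) ∷ cr) Sv p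
    rewrite δ-≢ (λ r → separated S Sv ¬Sx (sym r)) | δ-≢ (λ r → separated S Sv ¬Sy (sym r)) = deg#-pendant cr Sv p

  -- A new edge `(x , y)` is cut back into the two edges it came from, both inheriting its colour.
  -- Vertices off `S` notice no difference, because the inner ends and the two auxiliary loops lie
  -- in `S`.
  unpair : ∀ {B} → All (Crosses S) B → ∀ C → strip C ≡ pairUp B →
    ∃[ D ] (strip D ≡ B × Paired (map proj₁ D) × ∀ {v} → ¬ T (S v) → ∀ a → cdeg C a v ≡ cdeg D a v)
  unpair [] [] eq = [] , refl , [] , λ _ _ → refl
  unpair {(s , x) ∷ []} ((Ss , _) ∷ []) ((c , _) ∷ C@((d , _) ∷ (e , _) ∷ [])) refl =
    (c , s , x) ∷ [] , refl , single c , λ {v} ¬Sv a →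
      cong (cends# a v (c , s , x) +_) (cdeg-0 C a v (deg#-Avoids ((separated S Ss ¬Sv , separated S Ss ¬Sv) ∷ (separated S Ss ¬Sv , separated S Ss ¬Sv) ∷ [])))
  unpair {(s , x) ∷ (t , y) ∷ B} ((Ss , _) ∷ (St , _) ∷ cr) ((c , xy) ∷ C) eq with Lₚ.∷-injectiveˡ eq
  ... | refl with unpair cr C (Lₚ.∷-injectiveʳ eq)
  ...   | D , sD , pD , cD = (c , s , x) ∷ (c , t , y) ∷ D , cong (λ L → _ ∷ _ ∷ L) sD , pair c pD , same
    where
    same : ∀ {v} → ¬ T (S v) → ∀ a → cdeg ((c , x , y) ∷ C) a v ≡ cdeg ((c , s , x) ∷ (c , t , y) ∷ D) a v
    same {v} ¬Sv a rewrite cD ¬Sv a with c N.≟ a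
    ... | no _ = refl
    ... | yes _ rewrite δ-≢ (separated S Ss ¬Sv) | δ-≢ (separated S St ¬Sv) = +-assoc (δ x v) (δ y v) _

module Cutting (G : Graph) (mc : MinimalCounterexample G) where
  open Minimal G mc

  -- Edges inside and edges outside `S` have no common vertex, so each vertex sees only `C ++ D` or
  -- only `D ++ D′`.
  glue : ∀ (S : V → Bool) {I B R} → E ∼ I ++ B ++ R → All (Within S) I → All (Outside S) R →
    ∀ C D D′ → strip C ≡ I → strip D ≡ B → strip D′ ≡ R →
    (∀ v → T (S v) → OK (C ++ D) v) → ¬ (∀ v → ¬ T (S v) → OK (D ++ D′) v)
  glue S {I} {B} {R} E∼ wI oR C D D′ sC sD sD′ okIn okOut =
    uncolourable (C ++ D ++ D′) (∼trans (∼reflexive stripped) (∼sym E∼)) ok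
    where
    stripped : strip (C ++ D ++ D′) ≡ I ++ B ++ R
    stripped = trans (strip-++ C _) (cong₂ _++_ sC (trans (strip-++ D D′) (cong₂ _++_ sD sD′)))
    ok : ∀ v → OK (C ++ D ++ D′) v
    ok v with T? (S v)
    ... | yes Sv = OK-resp {C = C ++ D} {C ++ D ++ D′} eq (okIn v Sv)
      where
      eq : ∀ a → cdeg (C ++ D) a v ≡ cdeg (C ++ D ++ D′) a v
      eq a rewrite cdeg-++ C D a v | cdeg-++ C (D ++ D′) a v | cdeg-++ D D′ a v
        | cdeg-0 D′ a v (trans (cong (λ L → deg# L v) sD′) (deg#-Avoids (All.map (Outside-Avoids {S = S} Sv) oR)))
        | +-identityʳ (cdeg D a v) = refl
    ... | no ¬Sv = OK-resp {C = D ++ D′} {C ++ D ++ D′} eq (okOut v ¬Sv)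
      where
      eq : ∀ a → cdeg (D ++ D′) a v ≡ cdeg (C ++ D ++ D′) a v
      eq a rewrite cdeg-++ C (D ++ D′) a v
        | cdeg-0 C a v (trans (cong (λ L → deg# L v) sC) (deg#-Avoids (All.map (Within-Avoids {S = S} ¬Sv) wI))) = refl

  -- The reduction shared by (a), by all gadgets and by odd sets with one leaving edge. Two vertices
  -- of `S` are demanded because one of them may survive as the pendant vertex.
  no-extendable-cut : ∀ (S : V → Bool) {s t} → T (S s) → T (S t) → s ≢ t →
    ∀ {I B R} → E ∼ I ++ B ++ R → All (Within S) I → All (Crosses S) B → All (Outside S) R →
    ¬ (∀ D → strip D ≡ B → Paired (map proj₁ D) →
         ∃[ C ] (strip C ≡ I × ∀ v → T (S v) → OK (C ++ D) v))
  no-extendable-cut S {s} {t} Ss St s≢t {I} {B} {R} E∼ wI crB oR extend = conclude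
    where
    kept = keptBy S B

    assemble : ∀ D → strip D ≡ B → Paired (map proj₁ D) → ∀ D′ → strip D′ ≡ R →
      (∀ v → ¬ T (S v) → OK (D ++ D′) v) → ⊥
    assemble D sD pD D′ sD′ okOut =
      let C , sC , okIn = extend D sD pD in glue S E∼ wI oR C D D′ sC sD sD′ okIn okOut

    deleted : ∃[ v ] ¬ T (kept v)
    deleted with T? (kept s) | T? (kept t)
    ... | no ¬ks | _ = s , ¬ks
    ... | yes ks | no ¬kt = t , ¬kt
    ... | yes ks | yes kt with keptBy-cases S B ks | keptBy-cases S B kt
    ...   | inj₁ ¬Ss | _ = contradiction Ss ¬Ss
    ...   | inj₂ _ | inj₁ ¬St = contradiction St ¬St
    ...   | inj₂ (_ , p) | inj₂ (_ , q) = contradiction (isPendant-unique B p q) s≢t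

    within : All (Within kept) (pairUp B ++ R)
    within = Allₚ.++⁺ (pairUp-Within S crB) (All.map (λ (p , q) → keptBy-out S B p , keptBy-out S B q) oR)

    deg5 : ∀ v → T (kept v) → deg# (pairUp B ++ R) v ≡ 5
    deg5 v kv with keptBy-cases S B kv
    ... | inj₁ ¬Sv = begin
      deg# (pairUp B ++ R) v ≡⟨ deg#-++ (pairUp B) R v ⟩
      deg# (pairUp B) v + deg# R v ≡⟨ cong (_+ deg# R v) (deg#-pairUp S crB ¬Sv) ⟩
      deg# B v + deg# R v ≡⟨ deg#-++ B R v ⟨
      deg# (B ++ R) v ≡⟨ cong (_+ deg# (B ++ R) v) (deg#-Avoids (All.map (Within-Avoids {S = S} ¬Sv) wI)) ⟨
      deg# I v + deg# (B ++ R) v ≡⟨ deg#-++ I (B ++ R) v ⟨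
      deg# (I ++ B ++ R) v ≡⟨ deg#-∼ E∼ v ⟨
      deg# E v ≡⟨ degE v ⟩
      5 ∎
      where open ≡-Reasoning
    ... | inj₂ (Sv , pv) = trans (deg#-++ (pairUp B) R v) (cong₂ _+_ (deg#-pendant S crB Sv pv)
                             (deg#-Avoids (All.map (Outside-Avoids {S = S} Sv) oR)))

    conclude : ⊥
    conclude with Fₚ.any? (T? ∘ kept)
    -- Nothing is kept: `S` is the whole vertex set, there is no cut edge, and the extension alone
    -- colours `G`.
    ... | no none = assemble [] (sym B≡[]) [] [] (sym R≡[]) (λ v ¬Sv → contradiction (v , keptBy-out S B ¬Sv) none)
      where
      B≡[] : B ≡ []
      B≡[] = All-⊥ (λ (_ , ¬Sx) → none (_ , keptBy-out S B ¬Sx)) crB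
      R≡[] : R ≡ []
      R≡[] = All-⊥ (λ (¬Sx , _) → none (_ , keptBy-out S B ¬Sx)) oR
    ... | yes some with smaller-colourable kept (pairUp B ++ R) within deg5 some deleted
    ...   | C , sC , okC with strip-++⁻ (pairUp B) R C sC
    ...     | CN , CR , refl , sN , sR with unpair S crB CN sN
    ...       | D , sD , pD , cD = assemble D sD pD CR sR λ v ¬Sv →
      OK-resp {C = CN ++ CR} {D ++ CR} (λ a → trans (cdeg-++ CN CR a v)
         (trans (cong (_+ cdeg CR a v) (cD ¬Sv a)) (sym (cdeg-++ D CR a v)))) (okC v (keptBy-out S B ¬Sv))

classify : ∀ (S : Fin n → Bool) L → ∃[ I ] ∃[ B ] ∃[ R ]
  (L ∼ I ++ B ++ R × All (Within S) I × All (Crosses S) B × All (Outside S) R)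
classify S [] = [] , [] , [] , ∼refl , [] , [] , []
classify S ((x , y) ∷ L) with classify S L
... | I , B , R , p , wI , cB , oR with T? (S x) | T? (S y)
...   | yes Sx | yes Sy = (x , y) ∷ I , B , R , ∼prep p , (Sx , Sy) ∷ wI , cB , oR
...   | yes Sx | no ¬Sy = I , (x , y) ∷ B , R
  , ∼trans (∼prep p) (∼sym (↭⇒∼ (Permₚ.shift (x , y) I (B ++ R)))) , wI , (Sx , ¬Sy) ∷ cB , oR
...   | no ¬Sx | yes Sy = I , (y , x) ∷ B , R
  , ∼trans (∼prep p) (∼trans ∼flip (∼sym (↭⇒∼ (Permₚ.shift (y , x) I (B ++ R))))) , wI , (Sy , ¬Sx) ∷ cB , oR
...   | no ¬Sx | no ¬Sy = I , B , (x , y) ∷ R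
  , ∼trans (∼prep p) (∼sym (∼trans (∼++ˡ I (↭⇒∼ (Permₚ.shift (x , y) B R))) (↭⇒∼ (Permₚ.shift (x , y) I (B ++ R)))))
  , wI , cB , (¬Sx , ¬Sy) ∷ oR

-- 4-regular subgraphs

m+n≡1 : ∀ m {n} → m + n ≡ 1 → (m ≡ 1 × n ≡ 0) ⊎ (m ≡ 0 × n ≡ 1)
m+n≡1 zero    p = inj₂ (refl , p)
m+n≡1 (suc m) p = inj₁ (cong suc (m+n≡0⇒m≡0 m (suc-injective p)) , m+n≡0⇒n≡0 m (suc-injective p))

one-colour : ∀ (D : List (CEdge n)) v → deg# (strip D) v ≡ 1 → ∃[ c ] cdeg D c v ≡ 1
one-colour ((c , e) ∷ D) v p with m+n≡1 (ends# e v) p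
... | inj₁ (q , r) = c , cong₂ _+_ (trans (cends#-same c v e) q) (cdeg-0 D c v r)
... | inj₂ (q , r) = let d , t = one-colour D v r in
  d , cong₂ _+_ (n≤0⇒n≡0 (subst (cends# d v (c , e) ≤_) q (cends#-≤ d v (c , e)))) t

select : ∀ {m} → (Fin m → A) → (Fin m → Bool) → List A
select {m = zero}  g F = []
select {m = suc m} g F = if F fzero then g fzero ∷ rest else rest
  where rest = select (g ∘ fsuc) (F ∘ fsuc)

select-↭ : ∀ {m} (g : Fin m → A) F → tabulate g ↭ select g F ++ select g (not ∘ F)
select-↭ {m = zero}  g F = Perm.refl
select-↭ {m = suc m} g F with F fzero
... | true  = Perm.prep _ (select-↭ (g ∘ fsuc) (F ∘ fsuc))
... | false = Perm.trans (Perm.prep _ (select-↭ (g ∘ fsuc) (F ∘ fsuc)))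
                (Perm.↭-sym (Permₚ.shift _ (select (g ∘ fsuc) (F ∘ fsuc)) _))

sumL-select : ∀ (f : A → ℕ) {m} (g : Fin m → A) F →
  sumL f (select g F) ≡ sumFin (λ i → if F i then f (g i) else 0)
sumL-select f {zero}  g F = refl
sumL-select f {suc m} g F with F fzero
... | true  = cong (f (g fzero) +_) (sumL-select f (g ∘ fsuc) (F ∘ fsuc))
... | false = sumL-select f (g ∘ fsuc) (F ∘ fsuc)

All-select : ∀ {P : A → Set} {m} (g : Fin m → A) F → (∀ i → T (F i) → P (g i)) → All P (select g F)
All-select {m = zero}  g F p = []
All-select {m = suc m} g F p with F fzero | p fzero
... | true  | q = q tt ∷ All-select (g ∘ fsuc) (F ∘ fsuc) (p ∘ fsuc)
... | false | _ = All-select (g ∘ fsuc) (F ∘ fsuc) (p ∘ fsuc)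

elements : (S : Fin n → Bool) → List (Fin n)
elements {n} S = filter (T? ∘ S) (allFin n)

length-elements : ∀ (S : Fin n → Bool) → length (elements S) ≡ count S
length-elements S = go id
  where
  go : ∀ {m} (g : Fin m → Fin _) → length (filter (T? ∘ S) (tabulate g)) ≡ count (S ∘ g)
  go {zero}  g = refl
  go {suc m} g with S (g fzero)
  ... | true  = cong suc (go (g ∘ fsuc))
  ... | false = go (g ∘ fsuc)

elements-unique : ∀ (S : Fin n → Bool) → Unique (elements S)
elements-unique {n} S = Uniqueₚ.filter⁺ (T? ∘ S) (Uniqueₚ.allFin⁺ n)

∈-elements⁻ : ∀ (S : Fin n → Bool) {v} → v ∈ elements S → T (S v)
∈-elements⁻ {n} S v∈ = proj₂ (∈-filter⁻ (T? ∘ S) {xs = allFin n} v∈)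

∈-elements⁺ : ∀ (S : Fin n → Bool) {v} → T (S v) → v ∈ elements S
∈-elements⁺ S {v} Sv = ∈-filter⁺ (T? ∘ S) (∈-allFin v) Sv

two-elements : ∀ (S : Fin n → Bool) → 2 ≤ count S → ∃[ s ] ∃[ t ] (T (S s) × T (S t) × s ≢ t)
two-elements S le with elements S | elements-unique S | ∈-elements⁻ S | length-elements S
... | []        | _ | _ | eq = contradiction (subst (2 ≤_) (sym eq) le) λ ()
... | _ ∷ []    | _ | _ | eq = contradiction (subst (2 ≤_) (sym eq) le) λ { (s≤s ()) }
... | s ∷ t ∷ _ | (s≢t ∷ _) ∷ _ | ∈S | _ = s , t , ∈S (here refl) , ∈S (there (here refl)) , s≢t

module FourRegular (G : Graph) (mc : MinimalCounterexample G) where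
  open Minimal G mc
  open Cutting G mc

  -- Each vertex of `S` has just one edge end off `F`. Once `F` has a fresh colour, that remaining
  -- edge may have any other colour, so whatever colours arrive through the cut do no harm.
  no-4-regular : ∀ (S : V → Bool) {s t} → T (S s) → T (S t) → s ≢ t →
    ∀ {F Q} → E ∼ F ++ Q → All (Within S) F → ¬ (∀ v → T (S v) → deg# F v ≡ 4)
  no-4-regular S Ss St s≢t {F} {Q} E∼ wF deg4 with classify S Q
  ... | I , B , R , Q∼ , wI , cB , oR =
    no-extendable-cut S Ss St s≢t
      (∼trans E∼ (∼trans (∼++ˡ F Q∼) (∼reflexive (sym (Lₚ.++-assoc F I _)))))
      (Allₚ.++⁺ wF wI) cB oR extend
    where
    rest1 : ∀ v → T (S v) → deg# I v + deg# B v ≡ 1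
    rest1 v Sv = +-cancelˡ-≡ 4 _ _ (begin
      4 + (deg# I v + deg# B v) ≡⟨ cong (_+ (deg# I v + deg# B v)) (deg4 v Sv) ⟨
      deg# F v + (deg# I v + deg# B v) ≡⟨ cong (λ t → deg# F v + (deg# I v + t)) (+-identityʳ _) ⟨
      deg# F v + (deg# I v + (deg# B v + 0)) ≡⟨ cong (λ t → deg# F v + (deg# I v + (deg# B v + t))) (deg#-Avoids (All.map (Outside-Avoids {S = S} Sv) oR)) ⟨
      deg# F v + (deg# I v + (deg# B v + deg# R v)) ≡⟨ cong (λ t → deg# F v + (deg# I v + t)) (deg#-++ B R v) ⟨
      deg# F v + (deg# I v + deg# (B ++ R) v) ≡⟨ cong (deg# F v +_) (deg#-++ I (B ++ R) v) ⟨
      deg# F v + deg# (I ++ B ++ R) v ≡⟨ cong (deg# F v +_) (deg#-∼ Q∼ v) ⟨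
      deg# F v + deg# Q v ≡⟨ deg#-++ F Q v ⟨
      deg# (F ++ Q) v ≡⟨ deg#-∼ E∼ v ⟨
      deg# E v ≡⟨ degE v ⟩
      5 ∎)
      where open ≡-Reasoning
    extend : ∀ D → strip D ≡ B → Paired (map proj₁ D) →
      ∃[ C ] (strip C ≡ F ++ I × ∀ v → T (S v) → OK (C ++ D) v)
    extend D refl _ = C , trans (strip-++ (paint b F) _) (cong₂ _++_ (strip-paint b F) (strip-paint (suc b) I)) , ok
      where
      b = proj₁ (fresh D)
      b-fresh = proj₂ (fresh D)
      C = paint b F ++ paint (suc b) I
      split : ∀ a v → cdeg (C ++ D) a v ≡ (cdeg (paint b F) a v + cdeg (paint (suc b) I) a v) + cdeg D a v
      split a v = trans (cdeg-++ C D a v) (cong (_+ cdeg D a v) (cdeg-++ (paint b F) _ a v))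
      ok : ∀ v → T (S v) → OK (C ++ D) v
      ok v Sv with m+n≡1 (deg# I v) (rest1 v Sv)
      ... | inj₁ (pI , pB) = b , suc b , 1+n≢n ∘ sym
        , trans (split b v) (cong₂ _+_ (cong₂ _+_ (trans (cdeg-paint b F v) (deg4 v Sv)) (cdeg-paint-≢ 1+n≢n I v)) (b-fresh b ≤-refl v))
        , trans (split (suc b) v) (cong₂ _+_ (cong₂ _+_ (cdeg-paint-≢ (1+n≢n ∘ sym) F v) (trans (cdeg-paint (suc b) I v) pI)) (b-fresh (suc b) (n≤1+n b) v))
      ... | inj₂ (pI , pB) =
        let c , pc = one-colour D v pB
            b≢c = λ b≡c → 0≢1+n (trans (sym (b-fresh b ≤-refl v)) (trans (cong (λ t → cdeg D t v) b≡c) pc))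
        in b , c , b≢c
        , trans (split b v) (cong₂ _+_ (cong₂ _+_ (trans (cdeg-paint b F v) (deg4 v Sv)) (cdeg-paint-≢ 1+n≢n I v)) (b-fresh b ≤-refl v))
        , trans (split c v) (cong₂ _+_ (cong₂ _+_ (cdeg-paint-≢ b≢c F v)
             (cdeg-0 (paint (suc b) I) c v (trans (cong (λ L → deg# L v) (strip-paint (suc b) I)) pI))) pc)

  no-4-regular-subgraph : ¬ Has4RegularSubgraph G
  no-4-regular-subgraph (S , F , sub , two , deg4) =
    let s , t , Ss , St , s≢t = two-elements S two in
    no-4-regular S Ss St s≢t (↭⇒∼ (select-↭ (ends G) F)) (All-select (ends G) F sub)
      (λ v Sv → trans (sumL-select _ (ends G) F) (deg4 v Sv))

-- Finite verification of gadgets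

allBelow : ℕ → (ℕ → Bool) → Bool
allBelow zero    P = true
allBelow (suc m) P = P m ∧ allBelow m P

-- Missing colours default to 0, so even a failed search produces a full candidate, which is then
-- judged by `valid` like any other.
colourWith : List ℕ → List (Edge k) → List (CEdge k)
colourWith cs       []      = []
colourWith []       (e ∷ L) = (0 , e) ∷ colourWith [] L
colourWith (c ∷ cs) (e ∷ L) = (c , e) ∷ colourWith cs L

-- Pruning test of the search: the colours seen so far at a vertex must be at most four copies of
-- one colour and at most one copy of another.
extendable : List ℕ → Bool
extendable []       = true
extendable (c ∷ cs) with filterᵇ (λ d → not (c ≡ᵇ d)) cs
... | []     = length cs <ᵇ 4
... | d ∷ ds = all (_≡ᵇ d) ds ∧ ((length ds <ᵇ 4) ∧ (length cs ≡ᵇ suc (length ds))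
                              ∨ (length ds ≡ᵇ 0) ∧ (length cs ≤ᵇ 4))

-- A half-edge of colour c at i is written (c , i).
coloursAt : List (ℕ × Fin k) → Fin k → List ℕ
coloursAt []            i = []
coloursAt ((c , j) ∷ H) i = if ⌊ j F.≟ i ⌋ then c ∷ coloursAt H i else coloursAt H i

place : ℕ × Fin k → Vec (List ℕ) k → Vec (List ℕ) k
place (c , i) = λ st → Vec.updateAt st i (c ∷_)

-- Backtracking search for colours of the listed edges; its answers are
-- checked afterwards, so nothing needs to be proved about it.
solve : List (Edge k) → ℕ → Vec (List ℕ) k → Maybe (List ℕ)
solve []            p st = just []
solve ((i , j) ∷ L) p st = try p 0
  where
  try : ℕ → ℕ → Maybe (List ℕ)
  next : ℕ → ℕ → Vec (List ℕ) _ → Maybe (List ℕ)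
  try zero    c = nothing
  try (suc f) c = next f c (place (c , j) (place (c , i) st))
  next f c st′ with extendable (Vec.lookup st′ i) ∧ extendable (Vec.lookup st′ j)
  ... | false = try f (suc c)
  ... | true with solve L p st′
  ...   | just cs = just (c ∷ cs)
  ...   | nothing = try f (suc c)

occ : ℕ → List ℕ → ℕ
occ a []       = 0
occ a (c ∷ cs) = if c ≡ᵇ a then suc (occ a cs) else occ a cs

okᵇ : List ℕ → Bool
okᵇ cs = any (λ a → occ a cs ≡ᵇ 4) cs ∧ any (λ b → occ b cs ≡ᵇ 1) cs

halves : List (CEdge k) → List (ℕ × Fin k)
halves []                = []
halves ((c , i , j) ∷ C) = (c , i) ∷ (c , j) ∷ halves C

solved : List (Edge k) → List (ℕ × Fin k) → ℕ → List (CEdge k)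
solved L H p = colourWith (fromMaybe [] (solve L p (foldr place (Vec.replicate _ []) H))) L

valid : List (ℕ × Fin k) → Bool
valid {k} H = all (λ i → okᵇ (coloursAt H i)) (allFin k)

solvable : List (Edge k) → List (ℕ × Fin k) → ℕ → Bool
solvable L H p = valid (halves (solved L H p) ++ H)

-- The paired colour lists of length m up to renaming; u colours are in use.
allPatterns : ℕ → ℕ → (List ℕ → Bool) → Bool
allPatterns 0             u P = P []
allPatterns 1             u P = allBelow (suc u) λ d → P (d ∷ [])
allPatterns (suc (suc m)) u P = allBelow (suc u) λ d →
  allPatterns m (if d ≡ᵇ u then suc u else u) (λ ds → P (d ∷ d ∷ ds))

boundary : List (Edge k) → List (Fin k)
boundary {k} L = concatMap (λ i → replicate (5 ∸ deg# L i) i) (allFin k)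

-- The three pairings of four half-edges; for other numbers the given order suffices.
orders : List A → List (List A)
orders bs@(a ∷ b ∷ c ∷ d ∷ []) = bs ∷ (a ∷ c ∷ b ∷ d ∷ []) ∷ (a ∷ d ∷ b ∷ c ∷ []) ∷ []
orders bs = bs ∷ []

-- Tests directly what soundness relies on, in place of a proof about `boundary` and `orders`: the
-- listed half-edges raise every degree to 5.
fits : List (Edge k) → List (Fin k) → Bool
fits {k} L bs = all (λ i → deg# L i + sumL (λ j → δ j i) bs ≡ᵇ 5) (allFin k)

-- The pairing of the cut edges is free to choose, hence `any`; the colours are dictated by the
-- smaller graph, hence all patterns. The bound `2 + foldr _⊔_ 0 cs` admits the colours of the cut
-- and at least one that is absent from it.
reducible : List (Edge k) → Bool
reducible L = any (λ bs → fits L bs ∧ allPatterns (length bs) 0 (λ cs → solvable L (zip cs bs) (2 + foldr _⊔_ 0 cs))) (orders (boundary L))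

leafTest : (List (Edge k) → Bool) → List (Edge k) → Bool
leafTest pre L = not (pre L) ∨ reducible L

-- Multiplicities are guessed for one vertex pair after another. A branch is cut as soon as
-- `allowed` fails, which is sound when `allowed` holds for every part of the multigraph sought.
module Explore (allowed : Edge k → List (Edge k) → Bool) (leaf : List (Edge k) → Bool) where
  -- The sixth copy of an edge exceeds degree 5, so running out of fuel may count as failure.
  explore : List (Edge k) → List (Edge k) → Bool
  repeat  : Edge k → List (Edge k) → ℕ → List (Edge k) → Bool
  explore []      acc = leaf acc
  explore (p ∷ P) acc = repeat p P 6 acc
  repeat p P zero    acc = false
  repeat p P (suc f) acc = explore P acc ∧ (not (allowed p (p ∷ acc)) ∨ repeat p P f (p ∷ acc))

pairs : ∀ k → List (Edge k)
pairs k = map (λ i → i , i) (allFin k) ++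
  concatMap (λ i → map (i ,_) (filterᵇ (λ j → F.toℕ i <ᵇ F.toℕ j) (allFin k))) (allFin k)

-- a and b loops at two vertices joined by c edges
Bad₂ : ℕ → ℕ → ℕ → Set
Bad₂ a b c = 3 ≤ c ⊎ (2 ≤ c × 1 ≤ a + b) ⊎ (1 ≤ c × 1 ≤ a × 1 ≤ b) ⊎ (2 ≤ a × 2 ≤ b)

bad₂? : ∀ a b c → Dec (Bad₂ a b c)
bad₂? a b c = (3 N.≤? c) ⊎-dec ((2 N.≤? c) ×-dec (1 N.≤? a + b))
  ⊎-dec ((1 N.≤? c) ×-dec (1 N.≤? a) ×-dec (1 N.≤? b)) ⊎-dec ((2 N.≤? a) ×-dec (2 N.≤? b))

degree≤5 : Edge k → List (Edge k) → Bool
degree≤5 (i , j) L = (deg# L i ≤ᵇ 5) ∧ (deg# L j ≤ᵇ 5)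

good : List (Edge k) → Fin k → Fin k → Bool
good L i j = ⌊ i F.≟ j ⌋ ∨ not ⌊ bad₂? (mult L i i) (mult L j j) (mult L i j) ⌋

-- Only pairs touched by the new edge are tested again: a loop touches all pairs at its vertex, any
-- other edge just its own pair.
sparse : Edge k → List (Edge k) → Bool
sparse {k} (i , j) L = degree≤5 (i , j) L ∧ (if ⌊ i F.≟ j ⌋ then all (good L i) (allFin k) else good L i j)

f0 : Fin (1 + k)
f0 = fzero
f1 : Fin (2 + k)
f1 = fsuc fzero
f2 : Fin (3 + k)
f2 = fsuc f1
f3 : Fin (4 + k)
f3 = fsuc f2
f4 : Fin (5 + k)
f4 = fsuc f3
f5 : Fin (6 + k)
f5 = fsuc f4

loopedStar : List (Edge 5)
loopedStar = (f0 , f0) ∷ (f1 , f1) ∷ (f2 , f2) ∷ (f3 , f3) ∷ (f0 , f4) ∷ (f1 , f4) ∷ (f2 , f4) ∷ (f3 , f4) ∷ []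

loopedK₃₃ : List (Edge 6)
loopedK₃₃ = (f0 , f0) ∷ (f1 , f1) ∷ (f2 , f2) ∷ concatMap (λ i → (i , f3) ∷ (i , f4) ∷ (i , f5) ∷ []) (f0 ∷ f1 ∷ f2 ∷ [])

-- Soundness of the finite checks

T-∧ : ∀ {x y} → T (x ∧ y) → T x × T y
T-∧ {true} p = tt , p

T-∨-not : ∀ {x y} → T (not x ∨ y) → T x → T y
T-∨-not {true} p _ = p

T-all : ∀ (P : A → Bool) {xs} → T (all P xs) → ∀ {x} → x ∈ xs → T (P x)
T-all P {y ∷ xs} p (here refl) = proj₁ (T-∧ p)
T-all P {y ∷ xs} p (there x∈)  = T-all P (proj₂ (T-∧ {P y} p)) x∈

T-all⁺ : ∀ (P : A → Bool) xs → (∀ x → T (P x)) → T (all P xs)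
T-all⁺ P []       p = tt
T-all⁺ P (x ∷ xs) p with P x | p x
... | true | _ = T-all⁺ P xs p

T-any : ∀ (P : A → Bool) xs → T (any P xs) → ∃[ x ] T (P x)
T-any P (x ∷ xs) p with P x in eq
... | true  = x , subst T (sym eq) tt
... | false = T-any P xs p

T-allBelow : ∀ {P m} → T (allBelow m P) → ∀ {d} → d < m → T (P d)
T-allBelow {P} {suc m} p {d} d<1+m with d N.≟ m
... | yes refl = proj₁ (T-∧ p)
... | no d≢m   = T-allBelow {P} {m} (proj₂ (T-∧ {P m} p)) (≤∧≢⇒< (≤-pred d<1+m) d≢m)

-- Renaming of colours: index d stands for the d-th of the colours us, and
-- for a colour not below b beyond their end.
rename : List ℕ → ℕ → ℕ → ℕ
rename []       b d       = b + d
rename (u ∷ us) b zero    = u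
rename (u ∷ us) b (suc d) = rename us b d

rename-fresh : ∀ {us b u} → u < b → All (u ≢_) us → ∀ d → u ≢ rename us b d
rename-fresh {[]}     u<b _ d eq = <⇒≢ (≤-trans u<b (m≤m+n _ d)) eq
rename-fresh {_ ∷ us} u<b (p ∷ ps) zero    eq = p eq
rename-fresh {_ ∷ us} u<b (p ∷ ps) (suc d) eq = rename-fresh u<b ps d eq

rename-injective : ∀ {us b} → Unique us → All (_< b) us → ∀ {d e} → rename us b d ≡ rename us b e → d ≡ e
rename-injective {[]} {b} _ _ eq = +-cancelˡ-≡ b _ _ eq
rename-injective {u ∷ us} (x ∷ un) (l ∷ ls) {zero}  {zero}  eq = refl
rename-injective {u ∷ us} (x ∷ un) (l ∷ ls) {zero}  {suc e} eq = contradiction eq (rename-fresh l x e)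
rename-injective {u ∷ us} (x ∷ un) (l ∷ ls) {suc d} {zero}  eq = contradiction (sym eq) (rename-fresh l x d)
rename-injective {u ∷ us} (x ∷ un) (l ∷ ls) {suc d} {suc e} eq = cong suc (rename-injective un ls eq)

rename-++ : ∀ us ws b {d} → d < length us → rename (us ++ ws) b d ≡ rename us b d
rename-++ (u ∷ us) ws b {zero}  _       = refl
rename-++ (u ∷ us) ws b {suc d} (s≤s p) = rename-++ us ws b p

rename-last : ∀ us c ws b → rename ((us ++ c ∷ []) ++ ws) b (length us) ≡ c
rename-last []       c ws b = refl
rename-last (u ∷ us) c ws b = rename-last us c ws b

rename-index : ∀ {us c} (c∈ : c ∈ us) b → rename us b (F.toℕ (Any.index c∈)) ≡ c
rename-index (here refl) b = refl
rename-index (there c∈)  b = rename-index c∈ b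

index<length : ∀ {us : List ℕ} {c} (c∈ : c ∈ us) → F.toℕ (Any.index c∈) < length us
index<length c∈ = Fₚ.toℕ<n (Any.index c∈)

open DecMembership N._≟_ using (_∈?_)

-- The digit written by allPatterns for the next colour c, and the colours in use afterwards.
digit : ∀ us c → Unique us → ∃[ d ] ∃[ ws ]
  (d < suc (length us) × Unique (us ++ ws) × (if d ≡ᵇ length us then suc (length us) else length us) ≡ length (us ++ ws)
   × ∀ vs b → rename ((us ++ ws) ++ vs) b d ≡ c)
digit us c un with c ∈? us
... | yes c∈ = F.toℕ (Any.index c∈) , [] , <-trans lt (n<1+n _) , subst Unique (sym (Lₚ.++-identityʳ us)) un
  , trans (cong (λ t → if t then suc (length us) else length us) (≢⇒≡ᵇ-false (<⇒≢ lt))) (cong length (sym (Lₚ.++-identityʳ us)))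
  , λ vs b → trans (cong (λ t → rename (t ++ vs) b (F.toℕ (Any.index c∈))) (Lₚ.++-identityʳ us)) (trans (rename-++ us vs b lt) (rename-index c∈ b))
  where
  lt = index<length c∈
  ≢⇒≡ᵇ-false : ∀ {x y} → x ≢ y → (x ≡ᵇ y) ≡ false
  ≢⇒≡ᵇ-false {x} {y} x≢y with x ≡ᵇ y in eq
  ... | false = refl
  ... | true  = contradiction (≡ᵇ⇒≡ x y (subst T (sym eq) tt)) x≢y
... | no c∉ = length us , c ∷ [] , n<1+n _ , Uniqueₚ.++⁺ un ([] ∷ []) (λ { (c∈ , here refl) → c∉ c∈ })
  , trans (cong (λ t → if t then suc (length us) else length us) (≡ᵇ-refl (length us)))
      (sym (trans (Lₚ.length-++ us) (+-comm (length us) 1)))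
  , λ vs b → rename-last us c vs b
  where
  ≡ᵇ-refl : ∀ x → (x ≡ᵇ x) ≡ true
  ≡ᵇ-refl zero    = refl
  ≡ᵇ-refl (suc x) = ≡ᵇ-refl x

-- Colours are numbered by first occurrence: `us` are those already numbered, `ws` those still to
-- come. The last equation is stated for all `b` because a bound on the colours can be chosen only
-- once `ws` is complete.
allPatterns-sound : ∀ {cs} → Paired cs → ∀ us → Unique us → ∀ P → T (allPatterns (length cs) (length us) P) →
  ∃[ ds ] ∃[ ws ] (Unique (us ++ ws) × T (P ds) × ∀ b → cs ≡ map (rename (us ++ ws) b) ds)
allPatterns-sound [] us un P p = [] , [] , subst Unique (sym (Lₚ.++-identityʳ us)) un , p , λ b → refl
allPatterns-sound (single c) us un P p with digit us c un
... | d , ws , d< , un′ , _ , ren =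
  d ∷ [] , ws , un′ , T-allBelow {λ d → P (d ∷ [])} {suc (length us)} p d<
  , λ b → cong (_∷ []) (sym (trans (cong (λ t → rename t b d) (sym (Lₚ.++-identityʳ (us ++ ws)))) (ren [] b)))
allPatterns-sound (pair c {cs} pcs) us un P p with digit us c un
... | d , ws , d< , un′ , len , ren
  with allPatterns-sound pcs (us ++ ws) un′ (λ ds → P (d ∷ d ∷ ds))
         (subst (λ t → T (allPatterns (length cs) t (λ ds → P (d ∷ d ∷ ds)))) len
           (T-allBelow {λ d → allPatterns (length cs) (if d ≡ᵇ length us then suc (length us) else length us) (λ ds → P (d ∷ d ∷ ds))} {suc (length us)} p d<))
...   | ds , vs , un″ , pds , eqs = d ∷ d ∷ ds , ws ++ vs , subst Unique assoc un″ , pds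
  , λ b → cong₂ _∷_ (sym (ren′ b)) (cong₂ _∷_ (sym (ren′ b)) (trans (eqs b) (cong (λ t → map (rename t b) ds) assoc)))
  where
  assoc : (us ++ ws) ++ vs ≡ us ++ (ws ++ vs)
  assoc = Lₚ.++-assoc us ws vs
  ren′ : ∀ b → rename (us ++ (ws ++ vs)) b d ≡ c
  ren′ b = trans (cong (λ t → rename t b d) (sym assoc)) (ren vs b)

upper-bound : ∀ us → ∃[ b ] All (_< b) us
upper-bound []       = 0 , []
upper-bound (u ∷ us) = let b , p = upper-bound us in
  suc u + b , m≤m+n (suc u) b ∷ All.map (λ q → ≤-trans q (m≤n+m b (suc u))) p

-- The solution of a gadget may use colours absent from the cut, so `ι` has to be injective on all
-- numbers; past the colours of the cut it continues above a bound for them.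
patterns-sound : ∀ {cs} → Paired cs → ∀ P → T (allPatterns (length cs) 0 P) →
  Σ (ℕ → ℕ) λ ι → (∀ {d e} → ι d ≡ ι e → d ≡ e) × ∃[ ds ] (T (P ds) × cs ≡ map ι ds)
patterns-sound pcs P p =
  let ds , ws , un , pds , eq = allPatterns-sound pcs [] [] P p
      b , lt = upper-bound ws
  in rename ws b , rename-injective un lt , ds , pds , eq b

strip-colourWith : ∀ cs (L : List (Edge k)) → strip (colourWith cs L) ≡ L
strip-colourWith cs       []      = refl
strip-colourWith []       (e ∷ L) = cong (e ∷_) (strip-colourWith [] L)
strip-colourWith (c ∷ cs) (e ∷ L) = cong (e ∷_) (strip-colourWith cs L)

hdeg : List (ℕ × Fin k) → ℕ → Fin k → ℕ
hdeg H a i = sumL (λ (c , j) → if ⌊ c N.≟ a ⌋ then δ j i else 0) H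

⌊≟⌋ : ∀ c a → ⌊ c N.≟ a ⌋ ≡ (c ≡ᵇ a)
⌊≟⌋ c a = isYes≗does (c N.≟ a)

hdeg-coloursAt : ∀ (H : List (ℕ × Fin k)) a i → hdeg H a i ≡ occ a (coloursAt H i)
hdeg-coloursAt [] a i = refl
hdeg-coloursAt ((c , j) ∷ H) a i rewrite hdeg-coloursAt H a i | ⌊≟⌋ c a with j F.≟ i
... | no _ = cong (_+ occ a (coloursAt H i)) (if-0 (c ≡ᵇ a))
  where
  if-0 : ∀ b → (if b then 0 else 0) ≡ 0
  if-0 true  = refl
  if-0 false = refl
... | yes _ = if-suc (c ≡ᵇ a)
  where
  if-suc : ∀ b → (if b then 1 else 0) + occ a (coloursAt H i) ≡ (if b then suc (occ a (coloursAt H i)) else occ a (coloursAt H i))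
  if-suc true  = refl
  if-suc false = refl

hdeg-halves : ∀ (C : List (CEdge k)) a i → hdeg (halves C) a i ≡ cdeg C a i
hdeg-halves [] a i = refl
hdeg-halves ((c , x , y) ∷ C) a i rewrite hdeg-halves C a i with ⌊ c N.≟ a ⌋
... | true  = sym (+-assoc (δ x i) (δ y i) _)
... | false = refl

okᵇ-sound : ∀ (H : List (ℕ × Fin k)) i → T (okᵇ (coloursAt H i)) →
  ∃[ a ] ∃[ b ] (a ≢ b × hdeg H a i ≡ 4 × hdeg H b i ≡ 1)
okᵇ-sound H i p with T-∧ {any (λ a → occ a (coloursAt H i) ≡ᵇ 4) (coloursAt H i)} p
... | p₄ , p₁ with T-any _ (coloursAt H i) p₄ | T-any _ (coloursAt H i) p₁
...   | a , qa | b , qb = a , b , (λ { refl → case trans (sym e₄) e₁ of λ () }) , e₄ , e₁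
  where
  e₄ = trans (hdeg-coloursAt H a i) (≡ᵇ⇒≡ _ 4 qa)
  e₁ = trans (hdeg-coloursAt H b i) (≡ᵇ⇒≡ _ 1 qb)

module _ {allowed : Edge k → List (Edge k) → Bool} {leaf : List (Edge k) → Bool} where
  open Explore allowed leaf

  Covered : List (Edge k) → List (Edge k) → Set
  Covered P = All (λ e → Any (Same e) P)

  uncovered : ∀ x y P L → Covered ((x , y) ∷ P) L → mult L x y ≡ 0 → Covered P L
  uncovered x y P [] [] _ = []
  uncovered x y P (e ∷ L) (here s ∷ cov) eq = contradiction (trans (sym (joins-same e x y s)) (m+n≡0⇒m≡0 _ eq)) λ ()
  uncovered x y P (e ∷ L) (there c ∷ cov) eq = c ∷ uncovered x y P L cov (m+n≡0⇒n≡0 (joins e x y) eq)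

  Covered-flip : ∀ (P : List (Edge k)) {x y} → Any (Same (x , y)) P → Any (Same (y , x)) P
  Covered-flip P = Any.map Same-flip

  module _ (I : List (Edge k)) (al : ∀ p A L → I ∼ A ++ L → T (allowed p A)) where
    -- Invariant: the edges of `L` still to be placed lie on the pairs of `P` still to be visited. A
    -- pair without remaining copies is dropped; otherwise one copy moves to `acc`, and `al` says
    -- that this branch was not cut.
    explore-sound : ∀ P acc L → I ∼ acc ++ L → Covered P L → T (explore P acc) → ∃[ A ] (I ∼ A × T (leaf A))
    repeat-sound : ∀ x y P f acc L → I ∼ acc ++ L → Covered ((x , y) ∷ P) L → T (repeat (x , y) P f acc) →
      ∃[ A ] (I ∼ A × T (leaf A))
    explore-sound [] acc [] I∼ _ p = acc , ∼trans I∼ (∼reflexive (Lₚ.++-identityʳ acc)) , p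
    explore-sound [] acc (_ ∷ _) I∼ (() ∷ _) p
    explore-sound ((x , y) ∷ P) acc L I∼ cov p = repeat-sound x y P 6 acc L I∼ cov p
    repeat-sound x y P (suc f) acc L I∼ cov p with T-∧ {explore P acc} p | mult L x y in eq
    ... | p₁ , p₂ | zero  = explore-sound P acc L I∼ (uncovered x y P L cov eq) p₁
    ... | p₁ , p₂ | suc _ with mult-extract L x y (subst (1 ≤_) (sym eq) (s≤s z≤n))
    ...   | L′ , L∼ = repeat-sound x y P f ((x , y) ∷ acc) L′ I∼′ (All.tail (All-∼ (Covered-flip ((x , y) ∷ P)) L∼ cov))
                        (T-∨-not p₂ (al (x , y) ((x , y) ∷ acc) L′ I∼′))
      where
      I∼′ : I ∼ ((x , y) ∷ acc) ++ L′
      I∼′ = ∼trans I∼ (∼trans (∼++ˡ acc L∼) (↭⇒∼ (Permₚ.shift (x , y) acc L′)))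

-- Embedding of a gadget

module Embedding (s : Fin k → Fin n) (s-inj : ∀ {i j} → s i ≡ s j → i ≡ j) where

  embed : Edge k → Edge n
  embed (i , j) = s i , s j

  attach : Fin k × Fin n → Edge n
  attach (i , x) = s i , x

  image : Fin n → Bool
  image v = ⌊ Fₚ.any? (λ i → s i F.≟ v) ⌋

  image⁺ : ∀ i → T (image (s i))
  image⁺ i with Fₚ.any? (λ j → s j F.≟ s i)
  ... | yes _ = tt
  ... | no ¬p = ¬p (i , refl)

  image⁻ : ∀ {v} → T (image v) → ∃[ i ] s i ≡ v
  image⁻ {v} p with Fₚ.any? (λ j → s j F.≟ v)
  ... | yes q = q

  lift-Within : ∀ {L} → All (Within image) L → ∃[ I ] L ≡ map embed I
  lift-Within [] = [] , refl
  lift-Within ((p , q) ∷ w) =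
    let i , si = image⁻ p ; j , sj = image⁻ q ; I , eq = lift-Within w
    in (i , j) ∷ I , cong₂ _∷_ (cong₂ _,_ (sym si) (sym sj)) eq

  lift-Crosses : ∀ {L} → All (Crosses image) L → ∃[ B ] L ≡ map attach B
  lift-Crosses [] = [] , refl
  lift-Crosses ((p , q) ∷ w) =
    let i , si = image⁻ p ; B , eq = lift-Crosses w
    in (i , _) ∷ B , cong₂ _∷_ (cong (_, _) (sym si)) eq

  Within-embed : ∀ I → All (Within image) (map embed I)
  Within-embed []            = []
  Within-embed ((i , j) ∷ I) = (image⁺ i , image⁺ j) ∷ Within-embed I

  δ-s : ∀ i j → δ (s i) (s j) ≡ δ i j
  δ-s i j = δ-⇔ s-inj (cong s)

  deg#-embed : ∀ I i → deg# (map embed I) (s i) ≡ deg# I i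
  deg#-embed I i = trans (sumL-map _ embed I) (sumL-cong (λ (x , y) → cong₂ _+_ (δ-s x i) (δ-s y i)) I)

  joins-embed : ∀ e i j → joins (embed e) (s i) (s j) ≡ joins e i j
  joins-embed e@(a , b) i j with same? (embed e) (s i , s j) | same? e (i , j)
  ... | yes _ | yes _ = refl
  ... | no  _ | no  _ = refl
  ... | yes (inj₁ (p , q)) | no ¬r = contradiction (inj₁ (s-inj p , s-inj q)) ¬r
  ... | yes (inj₂ (p , q)) | no ¬r = contradiction (inj₂ (s-inj p , s-inj q)) ¬r
  ... | no ¬p | yes (inj₁ (refl , refl)) = contradiction (inj₁ (refl , refl)) ¬p
  ... | no ¬p | yes (inj₂ (refl , refl)) = contradiction (inj₂ (refl , refl)) ¬p

  mult-embed : ∀ I i j → mult (map embed I) (s i) (s j) ≡ mult I i j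
  mult-embed I i j = trans (sumL-map _ embed I) (sumL-cong (λ e → joins-embed e i j) I)

  deg#-attach : ∀ B i → All (Crosses image) (map attach B) →
    deg# (map attach B) (s i) ≡ sumL (λ j → δ j i) (map proj₁ B)
  deg#-attach []            i []             = refl
  deg#-attach ((j , x) ∷ B) i ((_ , ¬x) ∷ cr) = cong₂ _+_
    (trans (cong₂ _+_ (δ-s j i) (δ-≢ {x = x} (λ { refl → ¬x (image⁺ i) }))) (+-identityʳ _)) (deg#-attach B i cr)

  module Renaming (ι : ℕ → ℕ) (ι-inj : ∀ {d e} → ι d ≡ ι e → d ≡ e) where

    if-ι : ∀ c a {t u : ℕ} → t ≡ u → (if ⌊ ι c N.≟ ι a ⌋ then t else 0) ≡ (if ⌊ c N.≟ a ⌋ then u else 0)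
    if-ι c a refl with ι c N.≟ ι a | c N.≟ a
    ... | yes _ | yes _ = refl
    ... | no  _ | no  _ = refl
    ... | yes p | no ¬q = contradiction (ι-inj p) ¬q
    ... | no ¬p | yes q = contradiction (cong ι q) ¬p

    transfer : List (CEdge k) → List (CEdge n)
    transfer = map (λ (c , e) → ι c , embed e)

    strip-transfer : ∀ C → strip (transfer C) ≡ map embed (strip C)
    strip-transfer []      = refl
    strip-transfer (c ∷ C) = cong (_ ∷_) (strip-transfer C)

    cdeg-transfer : ∀ C a i → cdeg (transfer C) (ι a) (s i) ≡ cdeg C a i
    cdeg-transfer C a i = trans (sumL-map _ _ C)
      (sumL-cong (λ (c , x , y) → if-ι c a (cong₂ _+_ (δ-s x i) (δ-s y i))) C)

    cdeg-attach : ∀ B D ds a i → All (Crosses image) (map attach B) → strip D ≡ map attach B →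
      map proj₁ D ≡ map ι ds → cdeg D (ι a) (s i) ≡ hdeg (zip ds (map proj₁ B)) a i
    cdeg-attach [] [] [] a i _ _ _ = refl
    cdeg-attach ((j , x) ∷ B) ((_ , _) ∷ D) (d ∷ ds) a i ((_ , ¬x) ∷ cr) eq eqc
      with refl ← Lₚ.∷-injectiveˡ eq | refl ← Lₚ.∷-injectiveˡ eqc =
      cong₂ _+_ (if-ι d a (trans (cong₂ _+_ (δ-s j i) (δ-≢ {x = x} (λ { refl → ¬x (image⁺ i) }))) (+-identityʳ _)))
        (cdeg-attach B D ds a i cr (Lₚ.∷-injectiveʳ eq) (Lₚ.∷-injectiveʳ eqc))

-- A gadget knows only the inner ends of the cut edges, so these edges may be permuted until their
-- inner ends come in the order for which the pairing was tested.
rearrange : ∀ {X : Set} (bs : List (Fin k)) (B : List (Fin k × X)) →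
  (∀ i → sumL (λ j → δ j i) bs ≡ sumL (λ j → δ j i) (map proj₁ B)) → ∃[ B′ ] (B ↭ B′ × map proj₁ B′ ≡ bs)
rearrange [] [] eq = [] , Perm.refl , refl
rearrange [] ((i , _) ∷ B) eq = contradiction (trans (eq i) (cong (_+ sumL (λ j → δ j i) (map proj₁ B)) (δ-refl i))) λ ()
rearrange {k} {X} (b ∷ bs) B eq =
  let x , B₁ , p = find B (subst (1 ≤_) (eq b) (subst (λ t → 1 ≤ t + sumL (λ j → δ j b) bs) (sym (δ-refl b)) (s≤s z≤n)))
      B′ , q , r = rearrange bs B₁ (λ i → +-cancelˡ-≡ (δ b i) _ _ (trans (eq i) (count-↭ p i)))
  in (b , x) ∷ B′ , Perm.trans p (Perm.prep _ q) , cong (b ∷_) r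
  where
  find : ∀ B → 1 ≤ sumL (λ j → δ j b) (map proj₁ B) → ∃[ x ] ∃[ B₁ ] B ↭ (b , x) ∷ B₁
  find ((j , x) ∷ B) le with j F.≟ b
  ... | yes refl = x , B , Perm.refl
  ... | no  _    = let y , B₁ , p = find B le in y , (j , x) ∷ B₁ , Perm.trans (Perm.prep _ p) (Perm.swap _ _ Perm.refl)
  count-↭ : ∀ {B B′ : List (Fin k × X)} → B ↭ B′ → ∀ i →
    sumL (λ j → δ j i) (map proj₁ B) ≡ sumL (λ j → δ j i) (map proj₁ B′)
  count-↭ Perm.refl i = refl
  count-↭ (Perm.prep (j , _) p) i = cong (δ j i +_) (count-↭ p i)
  count-↭ (Perm.swap (j , _) (l , _) p) i rewrite count-↭ p i = swap-heads (δ j i) (δ l i) _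
  count-↭ (Perm.trans p q) i = trans (count-↭ p i) (count-↭ q i)

module Gadgets (G : Graph) (mc : MinimalCounterexample G) where
  open Minimal G mc
  open Cutting G mc

  module _ {k} (s : Fin (2 + k) → V) (s-inj : ∀ {i j} → s i ≡ s j → i ≡ j) where
    open Embedding s s-inj

    -- By 5-regularity the cut edges supply exactly the half-edges missing in `L`, so they can be
    -- listed in the tested order `bs`. The solution found for the colour pattern, renamed by `ι`,
    -- then extends the colouring to the gadget.
    not-reducible : ∀ L B R → E ∼ map embed L ++ map attach B ++ R → All (Crosses image) (map attach B) →
      All (Outside image) R → ¬ T (reducible L)
    not-reducible L B R E∼ crB oR red
      with T-any (λ bs → fits L bs ∧ allPatterns (length bs) 0 (λ cs → solvable L (zip cs bs) (2 + foldr _⊔_ 0 cs))) (orders (boundary L)) red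
    ... | bs , q with T-∧ {fits L bs} q
    ... | fit , pat with rearrange bs B balance
      where
      balance : ∀ i → sumL (λ j → δ j i) bs ≡ sumL (λ j → δ j i) (map proj₁ B)
      balance i = +-cancelˡ-≡ (deg# L i) _ _ (begin
        deg# L i + sumL (λ j → δ j i) bs ≡⟨ ≡ᵇ⇒≡ _ 5 (T-all (λ i → deg# L i + sumL (λ j → δ j i) bs ≡ᵇ 5) fit (∈-allFin i)) ⟩
        5 ≡⟨ degE (s i) ⟨
        deg# E (s i) ≡⟨ deg#-∼ E∼ (s i) ⟩
        deg# (map embed L ++ map attach B ++ R) (s i) ≡⟨ deg#-++ (map embed L) _ (s i) ⟩
        deg# (map embed L) (s i) + deg# (map attach B ++ R) (s i) ≡⟨ cong₂ _+_ (deg#-embed L i) (deg#-++ (map attach B) R (s i)) ⟩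
        deg# L i + (deg# (map attach B) (s i) + deg# R (s i)) ≡⟨ cong (deg# L i +_) (cong₂ _+_ (deg#-attach B i crB) (deg#-Avoids (All.map (Outside-Avoids {S = image} (image⁺ i)) oR))) ⟩
        deg# L i + (sumL (λ j → δ j i) (map proj₁ B) + 0) ≡⟨ cong (deg# L i +_) (+-identityʳ _) ⟩
        deg# L i + sumL (λ j → δ j i) (map proj₁ B) ∎)
        where open ≡-Reasoning
    ... | B′ , B↭ , refl = no-extendable-cut image (image⁺ fzero) (image⁺ (fsuc fzero)) (λ p → case s-inj p of λ ())
      (∼trans E∼ (∼++ˡ (map embed L) (∼++ʳ R (↭⇒∼ (Permₚ.map⁺ attach B↭)))))
      (Within-embed L) crB′ oR extend
      where
      crB′ : All (Crosses image) (map attach B′)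
      crB′ = Permₚ.All-resp-↭ (Permₚ.map⁺ attach B↭) crB
      extend : ∀ D → strip D ≡ map attach B′ → Paired (map proj₁ D) →
        ∃[ C ] (strip C ≡ map embed L × ∀ v → T (image v) → OK (C ++ D) v)
      extend D sD pD with patterns-sound pD _ (subst (λ t → T (allPatterns t 0 (λ cs → solvable L (zip cs (map proj₁ B′)) (2 + foldr _⊔_ 0 cs)))) len pat)
        where
        len : length (map proj₁ B′) ≡ length (map proj₁ D)
        len = trans (Lₚ.length-map proj₁ B′) (trans (sym (Lₚ.length-map attach B′))
          (trans (cong length (sym sD)) (trans (Lₚ.length-map proj₂ D) (sym (Lₚ.length-map proj₁ D)))))
      ... | ι , ι-inj , ds , sol , eqc = transfer C
          , trans (strip-transfer C) (cong (map embed) (strip-colourWith _ L)) , ok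
        where
        open Renaming ι ι-inj
        H = zip ds (map proj₁ B′)
        C = solved L H (2 + foldr _⊔_ 0 ds)
        cdeg≡ : ∀ a i → cdeg (transfer C ++ D) (ι a) (s i) ≡ hdeg (halves C ++ H) a i
        cdeg≡ a i = begin
          cdeg (transfer C ++ D) (ι a) (s i) ≡⟨ cdeg-++ (transfer C) D (ι a) (s i) ⟩
          cdeg (transfer C) (ι a) (s i) + cdeg D (ι a) (s i) ≡⟨ cong₂ _+_ (cdeg-transfer C a i) (cdeg-attach B′ D ds a i crB′ sD eqc) ⟩
          cdeg C a i + hdeg H a i ≡⟨ cong (_+ hdeg H a i) (hdeg-halves C a i) ⟨
          hdeg (halves C) a i + hdeg H a i ≡⟨ sumL-++ _ (halves C) H ⟨
          hdeg (halves C ++ H) a i ∎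
          where open ≡-Reasoning
        ok : ∀ v → T (image v) → OK (transfer C ++ D) v
        ok v iv with image⁻ iv
        ... | i , refl with okᵇ-sound (halves C ++ H) i (T-all (λ i → okᵇ (coloursAt (halves C ++ H) i)) sol (∈-allFin i))
        ...   | a , b , a≢b , p , q = ι a , ι b , (λ r → a≢b (ι-inj r)) , trans (cdeg≡ a i) p , trans (cdeg≡ b i) q

    -- `al` speaks of every part `A` of the edges of `G`, because the search meets partial
    -- multigraphs; `pr` only of the full set of edges inside the image, which is the meaning of its
    -- hypothesis on `R`.
    module _ {allowed : Edge (2 + k) → List (Edge (2 + k)) → Bool} {pre : List (Edge (2 + k)) → Bool}
      (al : ∀ p A R → E ∼ map embed A ++ R → T (allowed p A))
      (pr : ∀ A R → E ∼ map embed A ++ R → All (λ e → ¬ Within image e) R → T (pre A))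
      (cov : ∀ e → Any (Same e) (pairs (2 + k))) where

      gadget-lifted : ∀ K I B R → E ∼ map embed (K ++ I) ++ map attach B ++ R → All (Crosses image) (map attach B) →
        All (Outside image) R → ¬ Explore.explore allowed (leafTest pre) (pairs (2 + k)) K ≡ true
      gadget-lifted K I B R E∼ crB oR ex =
        conclude (explore-sound {allowed = allowed} {leafTest pre} (K ++ I) al′ (pairs (2 + k)) K I ∼refl (All.universal cov I) (subst T (sym ex) tt))
        where
        al′ : ∀ p A L → K ++ I ∼ A ++ L → T (allowed p A)
        al′ p A L KI∼ = al p A (map embed L ++ map attach B ++ R)
          (∼trans E∼ (∼trans (∼++ʳ (map attach B ++ R) (∼map s KI∼))
            (∼reflexive (trans (cong (_++ (map attach B ++ R)) (Lₚ.map-++ embed A L)) (Lₚ.++-assoc (map embed A) _ _)))))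
        conclude : ∃[ A ] (K ++ I ∼ A × T (leafTest pre A)) → ⊥
        conclude (A , KI∼A , lf) = not-reducible A B R E∼A crB oR
          (T-∨-not {pre A} lf (pr A (map attach B ++ R) E∼A
            (Allₚ.++⁺ (All.map (λ (_ , ¬x) (_ , x) → ¬x x) crB) (All.map (λ (¬x , _) (x , _) → ¬x x) oR))))
          where
          E∼A : E ∼ map embed A ++ map attach B ++ R
          E∼A = ∼trans E∼ (∼++ʳ (map attach B ++ R) (∼map s KI∼A))

      gadget : ∀ K R₀ → E ∼ map embed K ++ R₀ → ¬ Explore.explore allowed (leafTest pre) (pairs (2 + k)) K ≡ true
      gadget K R₀ E∼ ex =
        let I , B , R , R₀∼ , wI , crB , oR = classify image R₀
            I′ , I≡ = lift-Within wI
            B′ , B≡ = lift-Crosses crB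
        in gadget-lifted K I′ B′ R
             (∼trans E∼ (∼trans (∼++ˡ (map embed K) R₀∼) (∼reflexive (regroup K I′ B′ R I≡ B≡))))
             (subst (All (Crosses image)) B≡ crB) oR ex
        where
        regroup : ∀ K {I} I′ {B} B′ R → I ≡ map embed I′ → B ≡ map attach B′ →
          map embed K ++ I ++ B ++ R ≡ map embed (K ++ I′) ++ map attach B′ ++ R
        regroup K I′ B′ R refl refl = trans (sym (Lₚ.++-assoc (map embed K) _ _))
          (cong (_++ (map attach B′ ++ R)) (sym (Lₚ.map-++ embed K I′)))

-- Small forbidden configurations

badPair : List (Edge 2) → Bool
badPair L = ⌊ bad₂? (mult L f0 f0) (mult L f1 f1) (mult L f0 f1) ⌋

anything : List (Edge k) → Bool
anything _ = true

dense : List (Edge k) → Bool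
dense L = 8 ≤ᵇ length L

check₂ : Explore.explore degree≤5 (leafTest badPair) (pairs 2) [] ≡ true
check₂ = refl

-- From here on the two-vertex configurations ruled out through `check₂` prune the search, by way of
-- `sparse`.
check₅ : Explore.explore sparse (leafTest anything) (pairs 5) loopedStar ≡ true
check₅ = refl

check₆ : Explore.explore sparse (leafTest anything) (pairs 6) loopedK₃₃ ≡ true
check₆ = refl

check₄ : Explore.explore sparse (leafTest dense) (pairs 4) [] ≡ true
check₄ = refl

without : ∀ {m} → Fin m → (Fin m → ℕ) → Fin m → ℕ
without e f i = if ⌊ e F.≟ i ⌋ then 0 else f i

without-≢ : ∀ {m} (f : Fin m → ℕ) {e i} → e ≢ i → without e f i ≡ f i
without-≢ f {e} {i} e≢i with e F.≟ i
... | yes p = contradiction p e≢i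
... | no  _ = refl

sumFin-≤ : ∀ {m} {f g : Fin m → ℕ} → (∀ i → f i ≤ g i) → sumFin f ≤ sumFin g
sumFin-≤ {zero}  p = z≤n
sumFin-≤ {suc m} p = +-mono-≤ (p fzero) (sumFin-≤ (p ∘ fsuc))

sumFin-without : ∀ {m} (f : Fin m → ℕ) e → sumFin f ≡ f e + sumFin (without e f)
sumFin-without {suc m} f fzero    = refl
sumFin-without {suc m} f (fsuc e) = trans (cong (f fzero +_) (sumFin-without (f ∘ fsuc) e))
  (trans (swap-heads (f fzero) (f (fsuc e)) _) (cong (λ t → f (fsuc e) + (f fzero + t)) (sumFin-cong shift)))
  where
  shift : ∀ i → without e (f ∘ fsuc) i ≡ without (fsuc e) f (fsuc i)
  shift i with e F.≟ i
  ... | yes _ = refl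
  ... | no  _ = refl

sumL≤sumFin : ∀ {m} (f : Fin m → ℕ) {is} → Unique is → sumL f is ≤ sumFin f
sumL≤sumFin f [] = z≤n
sumL≤sumFin f {i ∷ is} (i∉ ∷ un) = begin
  f i + sumL f is ≡⟨ cong (f i +_) (sumL-congᴬ (All.map (λ i≢j → sym (without-≢ f i≢j)) i∉)) ⟩
  f i + sumL (without i f) is ≤⟨ +-monoʳ-≤ (f i) (sumL≤sumFin (without i f) un) ⟩
  f i + sumFin (without i f) ≡⟨ sumFin-without f i ⟨
  sumFin f ∎
  where open ≤-Reasoning

mult-edges : ∀ G u v → mult (edges G) u v ≡ sumFin (λ e → joins (ends G e) u v)
mult-edges G u v = sumL-tabulate _ (ends G)

Joins⇒joins : ∀ G e {u v} → Joins G e u v → joins (ends G e) u v ≡ 1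
Joins⇒joins G e {u} {v} (inj₁ p) rewrite p = joins-same (u , v) u v (inj₁ (refl , refl))
Joins⇒joins G e {u} {v} (inj₂ p) rewrite p = joins-same (v , u) u v (inj₂ (refl , refl))

mult≥ : ∀ G {u v is} → Unique is → All (λ e → Joins G e u v) is → length is ≤ mult (edges G) u v
mult≥ G {u} {v} {is} un js = begin
  length is ≡⟨ ones is js ⟨
  sumL (λ e → joins (ends G e) u v) is ≤⟨ sumL≤sumFin _ un ⟩
  sumFin (λ e → joins (ends G e) u v) ≡⟨ mult-edges G u v ⟨
  mult (edges G) u v ∎
  where
  open ≤-Reasoning
  ones : ∀ is → All (λ e → Joins G e u v) is → sumL (λ e → joins (ends G e) u v) is ≡ length is
  ones []       []       = refl
  ones (i ∷ is) (j ∷ js) = cong₂ _+_ (Joins⇒joins G i j) (ones is js)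

module _ (G : Graph) where
  HasLoop⇒mult : ∀ v → HasLoop G v → 1 ≤ mult (edges G) v v
  HasLoop⇒mult v (e , p) = mult≥ G {is = e ∷ []} ([] ∷ []) (inj₁ p ∷ [])

  Adj⇒mult : ∀ u v → Adj G u v → 1 ≤ mult (edges G) u v
  Adj⇒mult u v (_ , e , p) = mult≥ G {is = e ∷ []} ([] ∷ []) (p ∷ [])

  DoubleEdge⇒mult : ∀ u v → DoubleEdge G u v → 2 ≤ mult (edges G) u v
  DoubleEdge⇒mult u v (e , f , e≢f , p , q) = mult≥ G {is = e ∷ f ∷ []} ((e≢f ∷ []) ∷ [] ∷ []) (p ∷ q ∷ [])

ends#-loop : ∀ (v : Fin n) → ends# (v , v) v ≡ 2
ends#-loop v rewrite δ-refl v = refl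

2*mult≤deg# : ∀ (L : List (Edge n)) v → 2 * mult L v v ≤ deg# L v
2*mult≤deg# L v = subst (_≤ deg# L v) (sym (scale L)) (sumL-≤ step L)
  where
  scale : ∀ L → 2 * mult L v v ≡ sumL (λ e → 2 * joins e v v) L
  scale [] = refl
  scale (e ∷ L) = trans (*-distribˡ-+ 2 (joins e v v) _) (cong (2 * joins e v v +_) (scale L))
  step : ∀ e → 2 * joins e v v ≤ ends# e v
  step e with same? e (v , v)
  ... | no _ = z≤n
  ... | yes (inj₁ (refl , refl)) = ≤-reflexive (sym (ends#-loop v))
  ... | yes (inj₂ (refl , refl)) = ≤-reflexive (sym (ends#-loop v))

joins-sym : ∀ (e : Edge n) a b → joins e a b ≡ joins e b a
joins-sym e a b with same? e (a , b) | same? e (b , a)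
... | yes _ | yes _ = refl
... | no  _ | no  _ = refl
... | yes (inj₁ p) | no ¬q = contradiction (inj₂ p) ¬q
... | yes (inj₂ p) | no ¬q = contradiction (inj₁ p) ¬q
... | no ¬q | yes (inj₁ p) = contradiction (inj₂ p) ¬q
... | no ¬q | yes (inj₂ p) = contradiction (inj₁ p) ¬q

mult-sym : ∀ (L : List (Edge n)) a b → mult L a b ≡ mult L b a
mult-sym L a b = sumL-cong (λ e → joins-sym e a b) L

-- Pairwise different edges have multiplicity at most 1 in `K`, so occurring in `L` at all is
-- enough.
pick : ∀ (K L : List (Edge n)) → AllPairs (λ e f → ¬ Same e f) K → All (λ (x , y) → 1 ≤ mult L x y) K →
  ∃[ R ] L ∼ K ++ R
pick K L ap ms = mult-sub K L le
  where
  absent : ∀ {x y} K → All (λ f → ¬ Same f (x , y)) K → mult K x y ≡ 0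
  absent K ns = sumL-0ᴬ (All.map (λ {e} ¬p → joins-diff e _ _ ¬p) ns)
  transport : ∀ {x y} e f → Same e (x , y) → ¬ Same e f → ¬ Same f (x , y)
  transport e f (inj₁ (refl , refl)) ns (inj₁ (refl , refl)) = ns (inj₁ (refl , refl))
  transport e f (inj₁ (refl , refl)) ns (inj₂ (refl , refl)) = ns (inj₂ (refl , refl))
  transport e f (inj₂ (refl , refl)) ns (inj₁ (refl , refl)) = ns (inj₂ (refl , refl))
  transport e f (inj₂ (refl , refl)) ns (inj₂ (refl , refl)) = ns (inj₁ (refl , refl))
  go : ∀ K → AllPairs (λ e f → ¬ Same e f) K → All (λ (x , y) → 1 ≤ mult L x y) K → ∀ x y → mult K x y ≤ mult L x y
  go [] _ _ x y = z≤n
  go (e@(a , b) ∷ K) (n ∷ ap) (m ∷ ms) x y with same? e (x , y)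
  ... | no _ = go K ap ms x y
  ... | yes p rewrite absent K (All.map (λ {f} → transport e f p) n) = ≤-trans m (≤-reflexive (mult-same p))
    where
    mult-same : Same e (x , y) → mult L a b ≡ mult L x y
    mult-same (inj₁ (refl , refl)) = refl
    mult-same (inj₂ (refl , refl)) = mult-sym L a b
  le : ∀ x y → mult K x y ≤ mult L x y
  le = go K ap ms

Bad₂-mono : ∀ {a b c a′ b′ c′} → a ≤ a′ → b ≤ b′ → c ≤ c′ → Bad₂ a b c → Bad₂ a′ b′ c′
Bad₂-mono p q r (inj₁ x) = inj₁ (≤-trans x r)
Bad₂-mono p q r (inj₂ (inj₁ (x , y))) = inj₂ (inj₁ (≤-trans x r , ≤-trans y (+-mono-≤ p q)))
Bad₂-mono p q r (inj₂ (inj₂ (inj₁ (x , y , z)))) = inj₂ (inj₂ (inj₁ (≤-trans x r , ≤-trans y p , ≤-trans z q)))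
Bad₂-mono p q r (inj₂ (inj₂ (inj₂ (x , y)))) = inj₂ (inj₂ (inj₂ (≤-trans x p , ≤-trans y q)))

covers : ∀ k → True (Fₚ.all? λ (i : Fin k) → Fₚ.all? λ j → Any.any? (same? (i , j)) (pairs k)) →
  ∀ e → Any (Same e) (pairs k)
covers k t (i , j) = toWitness t i j

T-∧⁺ : ∀ {x y} → T x → T y → T (x ∧ y)
T-∧⁺ {true} _ q = q

T-if : ∀ b {x y} → T x → T y → T (if b then x else y)
T-if true  p q = p
T-if false p q = q

T-not-⌊⌋ : ∀ {P : Set} (d : Dec P) → ¬ P → T (not ⌊ d ⌋)
T-not-⌊⌋ (yes p) ¬p = ¬p p
T-not-⌊⌋ (no  _) ¬p = tt

module GadgetParts (G : Graph) (mc : MinimalCounterexample G) where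
  open Minimal G mc
  open Gadgets G mc

  module _ {k} (s : Fin k → V) (s-inj : ∀ {i j} → s i ≡ s j → i ≡ j) where
    open Embedding s s-inj

    mult-≤E : ∀ A R → E ∼ map embed A ++ R → ∀ i j → mult A i j ≤ mult E (s i) (s j)
    mult-≤E A R E∼ i j = subst₂ _≤_ (mult-embed A i j)
      (sym (trans (mult-∼ E∼ (s i) (s j)) (sumL-++ _ (map embed A) R))) (m≤m+n _ _)

    mult-≡E : ∀ A R → E ∼ map embed A ++ R → All (λ e → ¬ Within image e) R →
      ∀ i j → mult E (s i) (s j) ≡ mult A i j
    mult-≡E A R E∼ out i j = begin
      mult E (s i) (s j) ≡⟨ mult-∼ E∼ (s i) (s j) ⟩
      mult (map embed A ++ R) (s i) (s j) ≡⟨ sumL-++ _ (map embed A) R ⟩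
      mult (map embed A) (s i) (s j) + mult R (s i) (s j) ≡⟨ cong₂ _+_ (mult-embed A i j) (sumL-0ᴬ (All.map none out)) ⟩
      mult A i j + 0 ≡⟨ +-identityʳ _ ⟩
      mult A i j ∎
      where
      open ≡-Reasoning
      none : ∀ {e} → ¬ Within image e → joins e (s i) (s j) ≡ 0
      none {e} ¬w = joins-diff e (s i) (s j) λ
        { (inj₁ (refl , refl)) → ¬w (image⁺ i , image⁺ j) ; (inj₂ (refl , refl)) → ¬w (image⁺ j , image⁺ i) }

    degree-ok : ∀ p A R → E ∼ map embed A ++ R → T (degree≤5 p A)
    degree-ok (i , j) A R E∼ = T-∧⁺ (≤⇒≤ᵇ (le i)) (≤⇒≤ᵇ (le j))
      where
      le : ∀ i → deg# A i ≤ 5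
      le i = subst₂ _≤_ (deg#-embed A i)
        (trans (sym (deg#-++ (map embed A) R (s i))) (trans (sym (deg#-∼ E∼ (s i))) (degE (s i)))) (m≤m+n _ _)

  -- Yields (d), (e), and (b) for edges that are not loops. The last alternative of `Bad₂`, two
  -- vertices with two loops each, spans a 4-regular subgraph and sharpens the pruning of the larger
  -- searches.
  not-Bad₂ : ∀ {u v} → u ≢ v → ¬ Bad₂ (mult E u u) (mult E v v) (mult E u v)
  not-Bad₂ {u} {v} u≢v bad = gadget s s-inj {degree≤5} {badPair} (degree-ok s s-inj) pr (covers 2 tt) [] E ∼refl check₂
    where
    s = lookup (u ∷ v ∷ [])
    s-inj : ∀ {i j} → s i ≡ s j → i ≡ j
    s-inj = lookup-injective ((u≢v ∷ []) ∷ [] ∷ [])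
    open Embedding s s-inj
    pr : ∀ A R → E ∼ map embed A ++ R → All (λ e → ¬ Within image e) R → T (badPair A)
    pr A R E∼ out = fromWitness (subst₃ (eq f0 f0) (eq f1 f1) (eq f0 f1))
      where
      eq = mult-≡E s s-inj A R E∼ out
      subst₃ : ∀ {a b c} → mult E u u ≡ a → mult E v v ≡ b → mult E u v ≡ c → Bad₂ a b c
      subst₃ refl refl refl = bad

  module _ {k} (s : Fin k → V) (s-inj : ∀ {i j} → s i ≡ s j → i ≡ j) where
    open Embedding s s-inj

    -- `Bad₂` is monotone in the multiplicities, so its absence passes from `G` to each partial
    -- gadget.
    sparse-ok : ∀ p A R → E ∼ map embed A ++ R → T (sparse p A)
    sparse-ok (i , j) A R E∼ = T-∧⁺ (degree-ok s s-inj (i , j) A R E∼) both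
      where
      good-ok : ∀ i j → T (good A i j)
      good-ok i j with i F.≟ j
      ... | yes _  = tt
      ... | no i≢j = T-not-⌊⌋ (bad₂? (mult A i i) (mult A j j) (mult A i j)) λ bad →
        not-Bad₂ (i≢j ∘ s-inj) (Bad₂-mono (mult-≤E s s-inj A R E∼ i i) (mult-≤E s s-inj A R E∼ j j) (mult-≤E s s-inj A R E∼ i j) bad)
      both : T (if ⌊ i F.≟ j ⌋ then all (good A i) (allFin k) else good A i j)
      both = T-if ⌊ i F.≟ j ⌋ (T-all⁺ (good A i) (allFin k) (good-ok i)) (good-ok i j)

    pick-gadget : ∀ K → True (allPairs? (λ e f → ¬? (same? e f)) K) →
      All (λ (i , j) → 1 ≤ mult E (s i) (s j)) K → ∃[ R ] E ∼ map embed K ++ R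
    pick-gadget K ap ms = pick (map embed K) E (APₚ.map⁺ (AP.map (λ ¬p q → ¬p (Same⁻ q)) (toWitness ap))) (Allₚ.map⁺ ms)
      where
      Same⁻ : ∀ {e f} → Same (embed e) (embed f) → Same e f
      Same⁻ (inj₁ (p , q)) = inj₁ (s-inj p , s-inj q)
      Same⁻ (inj₂ (p , q)) = inj₂ (s-inj p , s-inj q)

  no-3-parallel-edges : ¬ Has3ParallelEdges G
  no-3-parallel-edges (e₁ , e₂ , e₃ , n₁₂ , n₁₃ , n₂₃ , p , q) with proj₁ (ends G e₁) F.≟ proj₂ (ends G e₁)
  ... | no u≢v = not-Bad₂ u≢v (inj₁ three)
    where
    three : 3 ≤ mult E (proj₁ (ends G e₁)) (proj₂ (ends G e₁))
    three = mult≥ G {is = e₁ ∷ e₂ ∷ e₃ ∷ []} ((n₁₂ ∷ n₁₃ ∷ []) ∷ (n₂₃ ∷ []) ∷ [] ∷ []) (inj₁ refl ∷ p ∷ q ∷ [])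
  -- Three parallel loops would give their vertex degree at least 6.
  ... | yes u≡v = contradiction (≤-trans (*-monoʳ-≤ 2 three) (≤-trans (2*mult≤deg# E u) (≤-reflexive (degE u)))) λ { (s≤s (s≤s (s≤s (s≤s (s≤s ()))))) }
    where
    u = proj₁ (ends G e₁)
    three : 3 ≤ mult E u u
    three = subst (λ w → 3 ≤ mult E u w) (sym u≡v)
      (mult≥ G {is = e₁ ∷ e₂ ∷ e₃ ∷ []} ((n₁₂ ∷ n₁₃ ∷ []) ∷ (n₂₃ ∷ []) ∷ [] ∷ []) (inj₁ refl ∷ p ∷ q ∷ []))

  no-loop-at-double-edge : ∀ v w → HasLoop G v → v ≢ w → ¬ DoubleEdge G v w
  no-loop-at-double-edge v w lv v≢w dbl = not-Bad₂ v≢w (inj₂ (inj₁ (DoubleEdge⇒mult G v w dbl , ≤-trans (HasLoop⇒mult G v lv) (m≤m+n _ _))))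

  looped-not-adjacent : ∀ u v → HasLoop G u → HasLoop G v → ¬ Adj G u v
  looped-not-adjacent u v lu lv adj = not-Bad₂ (proj₁ adj) (inj₂ (inj₂ (inj₁ (Adj⇒mult G u v adj , HasLoop⇒mult G u lu , HasLoop⇒mult G v lv))))

  no-four-looped-neighbours : ∀ v → ¬ AdjToFourLooped G v
  no-four-looped-neighbours v (w₁ , w₂ , w₃ , w₄ , (n₁₂ , n₁₃ , n₁₄ , n₂₃ , n₂₄ , n₃₄) , (l₁ , a₁) , (l₂ , a₂) , (l₃ , a₃) , (l₄ , a₄)) =
    conclude (pick-gadget s s-inj loopedStar tt
      (HasLoop⇒mult G w₁ l₁ ∷ HasLoop⇒mult G w₂ l₂ ∷ HasLoop⇒mult G w₃ l₃ ∷ HasLoop⇒mult G w₄ l₄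
       ∷ Adj⇒mult G w₁ v (Adj-sym a₁) ∷ Adj⇒mult G w₂ v (Adj-sym a₂) ∷ Adj⇒mult G w₃ v (Adj-sym a₃) ∷ Adj⇒mult G w₄ v (Adj-sym a₄) ∷ []))
    where
    s = lookup (w₁ ∷ w₂ ∷ w₃ ∷ w₄ ∷ v ∷ [])
    s-inj : ∀ {i j} → s i ≡ s j → i ≡ j
    s-inj = lookup-injective ((n₁₂ ∷ n₁₃ ∷ n₁₄ ∷ proj₁ a₁ ∘ sym ∷ []) ∷ (n₂₃ ∷ n₂₄ ∷ proj₁ a₂ ∘ sym ∷ [])
      ∷ (n₃₄ ∷ proj₁ a₃ ∘ sym ∷ []) ∷ (proj₁ a₄ ∘ sym ∷ []) ∷ [] ∷ [])
    Adj-sym : ∀ {x y} → Adj G x y → Adj G y x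
    Adj-sym (x≢y , e , inj₁ p) = x≢y ∘ sym , e , inj₂ p
    Adj-sym (x≢y , e , inj₂ p) = x≢y ∘ sym , e , inj₁ p
    conclude : ∃[ R ] E ∼ map (Embedding.embed s s-inj) loopedStar ++ R → ⊥
    conclude (R , E∼) = gadget s s-inj {sparse} {anything} (sparse-ok s s-inj) (λ _ _ _ _ → tt) (covers 5 tt) loopedStar R E∼ check₅

  no-looped-K₃₃ : ¬ HasLoopK33 G
  no-looped-K₃₃ (u₁ , u₂ , u₃ , v₁ , v₂ , v₃ , (n₁₂ , n₁₃ , n₂₃) , (m₁₂ , m₁₃ , m₂₃) , l₁ , l₂ , l₃
    , a₁₁ , a₁₂ , a₁₃ , a₂₁ , a₂₂ , a₂₃ , a₃₁ , a₃₂ , a₃₃) =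
    conclude (pick-gadget s s-inj loopedK₃₃ tt
      (HasLoop⇒mult G u₁ l₁ ∷ HasLoop⇒mult G u₂ l₂ ∷ HasLoop⇒mult G u₃ l₃
       ∷ Adj⇒mult G u₁ v₁ a₁₁ ∷ Adj⇒mult G u₁ v₂ a₁₂ ∷ Adj⇒mult G u₁ v₃ a₁₃ ∷ Adj⇒mult G u₂ v₁ a₂₁ ∷ Adj⇒mult G u₂ v₂ a₂₂ ∷ Adj⇒mult G u₂ v₃ a₂₃
       ∷ Adj⇒mult G u₃ v₁ a₃₁ ∷ Adj⇒mult G u₃ v₂ a₃₂ ∷ Adj⇒mult G u₃ v₃ a₃₃ ∷ []))
    where
    s = lookup (u₁ ∷ u₂ ∷ u₃ ∷ v₁ ∷ v₂ ∷ v₃ ∷ [])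
    s-inj : ∀ {i j} → s i ≡ s j → i ≡ j
    s-inj = lookup-injective ((n₁₂ ∷ n₁₃ ∷ proj₁ a₁₁ ∷ proj₁ a₁₂ ∷ proj₁ a₁₃ ∷ []) ∷ (n₂₃ ∷ proj₁ a₂₁ ∷ proj₁ a₂₂ ∷ proj₁ a₂₃ ∷ [])
      ∷ (proj₁ a₃₁ ∷ proj₁ a₃₂ ∷ proj₁ a₃₃ ∷ []) ∷ (m₁₂ ∷ m₁₃ ∷ []) ∷ (m₂₃ ∷ []) ∷ [] ∷ [])
    conclude : ∃[ R ] E ∼ map (Embedding.embed s s-inj) loopedK₃₃ ++ R → ⊥
    conclude (R , E∼) = gadget s s-inj {sparse} {anything} (sparse-ok s s-inj) (λ _ _ _ _ → tt) (covers 6 tt) loopedK₃₃ R E∼ check₆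

  no-dense-4-subgraph : ¬ HasDense4Subgraph G
  no-dense-4-subgraph (S , F , sub , four , eight) =
    -- No particular edge is forced, so the search starts from the empty multigraph and `dense`
    -- picks out the leaves with eight edges.
    gadget s s-inj {sparse} {dense} (sparse-ok s s-inj) pr (covers 4 tt) [] E ∼refl check₄
    where
    len : 4 ≡ length (elements S)
    len = sym (trans (length-elements S) four)
    s : Fin 4 → V
    s i = lookup (elements S) (F.cast len i)
    s-inj : ∀ {i j} → s i ≡ s j → i ≡ j
    s-inj {i} {j} eq = Fₚ.toℕ-injective (trans (sym (Fₚ.toℕ-cast len i))
      (trans (cong F.toℕ (lookup-injective (elements-unique S) eq)) (Fₚ.toℕ-cast len j)))
    open Embedding s s-inj
    S⇒image : ∀ {v} → T (S v) → T (image v)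
    S⇒image {v} Sv = subst (T ∘ image) eq (image⁺ i)
      where
      j = Any.index (∈-elements⁺ S Sv)
      i = F.cast (sym len) j
      eq : s i ≡ v
      eq = trans (cong (lookup (elements S)) (Fₚ.toℕ-injective (trans (Fₚ.toℕ-cast len i) (Fₚ.toℕ-cast (sym len) j))))
        (sym (Anyₚ.lookup-index (∈-elements⁺ S Sv)))
    inner : Edge (nV G) → ℕ
    inner (x , y) = if S x ∧ S y then 1 else 0
    pr : ∀ A R → E ∼ map embed A ++ R → All (λ e → ¬ Within image e) R → T (dense A)
    pr A R E∼ out = ≤⇒≤ᵇ (begin
      8 ≤⟨ eight ⟩
      count F ≤⟨ sumFin-≤ F≤inner ⟩
      sumFin (λ e → inner (ends G e)) ≡⟨ sumL-tabulate inner (ends G) ⟨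
      sumL inner E ≡⟨ sumL-∼ (λ x y → cong (λ b → if b then 1 else 0) (∧-comm (S x) (S y))) E∼ ⟩
      sumL inner (map embed A ++ R) ≡⟨ sumL-++ inner (map embed A) R ⟩
      sumL inner (map embed A) + sumL inner R ≤⟨ +-mono-≤ (≤-trans (sumL-≤ {g = λ _ → 1} inner≤1 (map embed A)) (≤-reflexive (sumL-1 (map embed A)))) (≤-reflexive (sumL-0ᴬ (All.map none out))) ⟩
      length (map embed A) + 0 ≡⟨ +-identityʳ _ ⟩
      length (map embed A) ≡⟨ Lₚ.length-map embed A ⟩
      length A ∎)
      where
      open ≤-Reasoning
      sumL-1 : ∀ (L : List (Edge (nV G))) → sumL (λ _ → 1) L ≡ length L
      sumL-1 []      = refl
      sumL-1 (_ ∷ L) = cong suc (sumL-1 L)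
      inner≤1 : ∀ e → inner e ≤ 1
      inner≤1 (x , y) with S x ∧ S y
      ... | true  = ≤-refl
      ... | false = z≤n
      none : ∀ {e} → ¬ Within image e → inner e ≡ 0
      none {x , y} ¬w with S x | S y | S⇒image {x} | S⇒image {y}
      ... | true  | true  | f | g = contradiction (f tt , g tt) ¬w
      ... | true  | false | _ | _ = refl
      ... | false | _     | _ | _ = refl
      F≤inner : ∀ e → (if F e then 1 else 0) ≤ inner (ends G e)
      F≤inner e with F e | sub e
      ... | false | _ = z≤n
      ... | true  | w with S (proj₁ (ends G e)) | S (proj₂ (ends G e)) | w tt
      ...   | true | true | _ = ≤-refl

-- Paths of double edges

-- The Kronecker delta on colours. It turns colour degrees into polynomials in `χ` and `δ`, whose
-- comparison is left to the ring solver.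
χ : ℕ → ℕ → ℕ
χ c a = if ⌊ c N.≟ a ⌋ then 1 else 0

χ-refl : ∀ a → χ a a ≡ 1
χ-refl a with a N.≟ a
... | yes _ = refl
... | no ¬p = contradiction refl ¬p

χ-≢ : ∀ {c a} → c ≢ a → χ c a ≡ 0
χ-≢ {c} {a} c≢a with c N.≟ a
... | yes p = contradiction p c≢a
... | no  _ = refl

cends#-χ : ∀ a v c (x y : Fin n) → cends# a v (c , x , y) ≡ χ c a * (δ x v + δ y v)
cends#-χ a v c x y with c N.≟ a
... | yes _ = sym (+-identityʳ _)
... | no  _ = refl

Is41 : (ℕ → ℕ) → Set
Is41 f = ∃[ a ] ∃[ b ] (a ≢ b × f a ≡ 4 × f b ≡ 1)

Is41-resp : ∀ {f g : ℕ → ℕ} → (∀ a → f a ≡ g a) → Is41 g → Is41 f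
Is41-resp eq (a , b , a≢b , p , q) = a , b , a≢b , trans (eq a) p , trans (eq b) q

Is41-χ : ∀ {f : ℕ → ℕ} {m s} → m ≢ s → (∀ a → f a ≡ 4 * χ m a + χ s a) → Is41 f
Is41-χ {m = m} {s} m≢s eq = m , s , m≢s
  , trans (eq m) (cong₂ (λ i j → 4 * i + j) (χ-refl m) (χ-≢ (m≢s ∘ sym)))
  , trans (eq s) (cong₂ (λ i j → 4 * i + j) (χ-≢ m≢s) (χ-refl s))

three-colours : ∀ (C : List (CEdge n)) v {a b c} → a ≢ b → a ≢ c → b ≢ c →
  cdeg C a v + (cdeg C b v + cdeg C c v) ≤ deg# (strip C) v
three-colours [] v _ _ _ = z≤n
three-colours ((d , e) ∷ C) v {a} {b} {c} a≢b a≢c b≢c = begin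
  (i + X) + ((j + Y) + (l + Z)) ≡⟨ regroup i X j Y l Z ⟩
  (i + (j + l)) + (X + (Y + Z)) ≤⟨ +-mono-≤ one (three-colours C v a≢b a≢c b≢c) ⟩
  ends# e v + deg# (strip C) v ∎
  where
  open ≤-Reasoning
  i = cends# a v (d , e)
  j = cends# b v (d , e)
  l = cends# c v (d , e)
  X = cdeg C a v
  Y = cdeg C b v
  Z = cdeg C c v
  regroup : ∀ i X j Y l Z → (i + X) + ((j + Y) + (l + Z)) ≡ (i + (j + l)) + (X + (Y + Z))
  regroup = solve-∀
  one : i + (j + l) ≤ ends# e v
  one with d N.≟ a | d N.≟ b | d N.≟ c
  ... | yes refl | yes refl | _        = contradiction refl a≢b
  ... | yes refl | no _     | yes refl = contradiction refl a≢c
  ... | yes refl | no _     | no _     = ≤-reflexive (+-identityʳ _)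
  ... | no _     | yes refl | yes refl = contradiction refl b≢c
  ... | no _     | yes refl | no _     = ≤-reflexive (+-identityʳ _)
  ... | no _     | no _     | yes refl = ≤-refl
  ... | no _     | no _     | no _     = z≤n

-- The colours `a` and `b` already account for 4 + 1 of the five edge ends.
OK-exhausts : ∀ (C : List (CEdge n)) v → deg# (strip C) v ≡ 5 → ∀ {a b} → a ≢ b →
  cdeg C a v ≡ 4 → cdeg C b v ≡ 1 → ∀ {c} → cdeg C c v ≢ 0 → c ≡ a ⊎ c ≡ b
OK-exhausts C v five {a} {b} a≢b p q {c} nz with c N.≟ a | c N.≟ b
... | yes r | _     = inj₁ r
... | no  _ | yes r = inj₂ r
... | no c≢a | no c≢b = contradiction (n≤0⇒n≡0 (+-cancelˡ-≤ 5 _ _ le)) nz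
  where
  le : 5 + cdeg C c v ≤ 5 + 0
  le = subst₂ _≤_ (trans (cong₂ (λ i j → i + (j + cdeg C c v)) p q) refl) five
    (three-colours C v a≢b (c≢a ∘ sym) (c≢b ∘ sym))

-- Being distinct, `p` and `q` are the two colours at `v`: one is the majority colour `m`, and the
-- other occurs only on its new edge. Giving that edge the colour `r` leaves four ends of colour `m`
-- and one of colour `r`.
swap-minor : ∀ (C : List (CEdge n)) v → deg# (strip C) v ≡ 5 → ∀ {p q r} {f : ℕ → ℕ} → p ≢ q → r ≢ p → r ≢ q →
  (∀ a → cdeg C a v ≡ χ p a + (χ q a + f a)) → OK C v →
  ∃[ m ] (m ≢ r × Is41 (λ a → χ m a + (χ r a + f a)))
swap-minor C v five {p} {q} {r} {f} p≢q r≢p r≢q eq (a , b , a≢b , e₄ , e₁) = conclude (exhaust occurs-p) (exhaust occurs-q)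
  where
  exhaust : ∀ {c} → cdeg C c v ≢ 0 → c ≡ a ⊎ c ≡ b
  exhaust = OK-exhausts C v five a≢b e₄ e₁
  occurs-p : cdeg C p v ≢ 0
  occurs-p z = case trans (sym z) (trans (eq p) (cong (_+ (χ q p + f p)) (χ-refl p))) of λ ()
  occurs-q : cdeg C q v ≢ 0
  occurs-q z = case trans (sym z) (trans (eq q) (cong₂ (λ i j → i + (j + f q)) (χ-≢ p≢q) (χ-refl q))) of λ ()
  r-absent : r ≢ a → r ≢ b → f r ≡ 0
  r-absent r≢a r≢b with cdeg C r v in z
  ... | zero  = trans (sym (cong₂ (λ i j → i + (j + f r)) (χ-≢ (r≢p ∘ sym)) (χ-≢ (r≢q ∘ sym)))) (trans (sym (eq r)) z)
  ... | suc _ with exhaust {r} (λ z′ → case trans (sym z) z′ of λ ())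
  ...   | inj₁ r≡a = contradiction r≡a r≢a
  ...   | inj₂ r≡b = contradiction r≡b r≢b
  f-major : ∀ {m s} → m ≢ s → (∀ a → cdeg C a v ≡ χ m a + (χ s a + f a)) → cdeg C m v ≡ 4 → f m ≡ 3
  f-major {m} {s} m≢s eq′ e = suc-injective (trans (sym (cong₂ (λ i j → i + (j + f m)) (χ-refl m) (χ-≢ (m≢s ∘ sym)))) (trans (sym (eq′ m)) e))
  result : ∀ {m} → r ≢ m → f r ≡ 0 → f m ≡ 3 → ∃[ m ] (m ≢ r × Is41 (λ a → χ m a + (χ r a + f a)))
  result {m} r≢m fr fm = m , r≢m ∘ sym , m , r , r≢m ∘ sym
    , cong₂ _+_ (χ-refl m) (cong₂ _+_ (χ-≢ r≢m) fm) , cong₂ _+_ (χ-≢ (r≢m ∘ sym)) (cong₂ _+_ (χ-refl r) fr)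
  conclude : p ≡ a ⊎ p ≡ b → q ≡ a ⊎ q ≡ b → ∃[ m ] (m ≢ r × Is41 (λ a → χ m a + (χ r a + f a)))
  conclude (inj₁ refl) (inj₁ refl) = contradiction refl p≢q
  conclude (inj₂ refl) (inj₂ refl) = contradiction refl p≢q
  conclude (inj₁ refl) (inj₂ refl) = result r≢p (r-absent r≢p r≢q) (f-major p≢q eq e₄)
  conclude (inj₂ refl) (inj₁ refl) = result r≢q (r-absent r≢q r≢p)
    (f-major (p≢q ∘ sym) (λ a → trans (eq a) (swap-heads (χ p a) (χ q a) (f a))) e₄)

mult-extract₂ : ∀ (L : List (Edge n)) x y → 2 ≤ mult L x y → ∃[ L′ ] L ∼ (x , y) ∷ (x , y) ∷ L′
mult-extract₂ L x y le =
  let L₁ , p = mult-extract L x y (≤-trans (s≤s z≤n) le)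
      L₂ , q = mult-extract L₁ x y (≤-pred (≤-trans le (≤-reflexive
                 (trans (mult-∼ p x y) (cong (_+ mult L₁ x y) (joins-same (x , y) x y (inj₁ (refl , refl))))))))
  in L₂ , ∼trans p (∼prep q)

mult-skip : ∀ {L : List (Edge n)} {e f L′ x y} → L ∼ e ∷ f ∷ L′ → ¬ Same e (x , y) → ¬ Same f (x , y) → mult L x y ≡ mult L′ x y
mult-skip {L = L} {e} {f} {L′} {x} {y} L∼ ¬e ¬f = trans (mult-∼ L∼ x y)
  (cong₂ (λ i j → i + (j + mult L′ x y)) (joins-diff e x y ¬e) (joins-diff f x y ¬f))

strip-∷³ : ∀ (C : List (CEdge n)) {e f g L} → strip C ≡ e ∷ f ∷ g ∷ L →
  ∃[ p ] ∃[ q ] ∃[ r ] ∃[ D ] (C ≡ (p , e) ∷ (q , f) ∷ (r , g) ∷ D × strip D ≡ L)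
strip-∷³ ((p , _) ∷ (q , _) ∷ (r , _) ∷ D) refl = p , q , r , D , refl , refl

Avoids-deg# : ∀ {v} (L : List (Edge n)) → deg# L v ≡ 0 → All (Avoids v) L
Avoids-deg# [] _ = []
Avoids-deg# {v = v} ((x , y) ∷ L) eq = (misses x (m+n≡0⇒m≡0 _ e0) , misses y (m+n≡0⇒n≡0 (δ x v) e0)) ∷ Avoids-deg# L (m+n≡0⇒n≡0 (ends# (x , y) v) eq)
  where
  e0 : ends# (x , y) v ≡ 0
  e0 = m+n≡0⇒m≡0 _ eq
  misses : ∀ z → δ z v ≡ 0 → z ≢ v
  misses z z0 refl = case trans (sym (δ-refl z)) z0 of λ ()

doublePath : (v₁ v₂ v₃ v₄ : Fin n) → List (Edge n) → List (Edge n)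
doublePath v₁ v₂ v₃ v₄ L = (v₁ , v₂) ∷ (v₁ , v₂) ∷ (v₂ , v₃) ∷ (v₂ , v₃) ∷ (v₃ , v₄) ∷ (v₃ , v₄) ∷ L

module DoublePath (G : Graph) (mc : MinimalCounterexample G) where
  open Minimal G mc
  open GadgetParts G mc

  -- Here `x` and `y` are the far ends of the fifth edges at `v₂` and `v₃`. Apart from the double
  -- edge between `v₁` and `v₄`, the smaller graph `N` receives an edge from `x` to `y`, which
  -- restores their degrees.
  module Reduced {v₁ v₂ v₃ v₄ x y : V} {R : List (Edge (nV G))}
    (n₁₂ : v₁ ≢ v₂) (n₁₃ : v₁ ≢ v₃) (n₁₄ : v₁ ≢ v₄) (n₂₃ : v₂ ≢ v₃) (n₂₄ : v₂ ≢ v₄) (n₃₄ : v₃ ≢ v₄)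
    (x≢v₂ : x ≢ v₂) (x≢v₃ : x ≢ v₃) (y≢v₂ : y ≢ v₂) (y≢v₃ : y ≢ v₃)
    (R₂ : deg# R v₂ ≡ 0) (R₃ : deg# R v₃ ≡ 0)
    (E∼ : E ∼ doublePath v₁ v₂ v₃ v₄ ((v₂ , x) ∷ (v₃ , y) ∷ R))
    where

    kept : V → Bool
    kept v = not (⌊ v₂ F.≟ v ⌋ ∨ ⌊ v₃ F.≟ v ⌋)

    kept⁺ : ∀ {v} → v ≢ v₂ → v ≢ v₃ → T (kept v)
    kept⁺ {v} p q with v₂ F.≟ v | v₃ F.≟ v
    ... | yes r | _     = p (sym r)
    ... | no  _ | yes r = q (sym r)
    ... | no  _ | no _  = tt

    kept⁻ : ∀ {v} → T (kept v) → v₂ ≢ v × v₃ ≢ v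
    kept⁻ {v} k with v₂ F.≟ v | v₃ F.≟ v
    ... | no p | no q = p , q

    ¬kept : ¬ T (kept v₂)
    ¬kept k = proj₁ (kept⁻ k) refl

    N : List (Edge (nV G))
    N = (v₁ , v₄) ∷ (v₁ , v₄) ∷ (x , y) ∷ R

    within : All (Within kept) N
    within = (k₁ , k₄) ∷ (k₁ , k₄) ∷ (kept⁺ x≢v₂ x≢v₃ , kept⁺ y≢v₂ y≢v₃) ∷
      All.zipWith (λ ((p , q) , (p′ , q′)) → kept⁺ p p′ , kept⁺ q q′) (Avoids-deg# R R₂ , Avoids-deg# R R₃)
      where
      k₁ = kept⁺ n₁₂ n₁₃
      k₄ = kept⁺ (n₂₄ ∘ sym) (n₃₄ ∘ sym)

    deg-N : ∀ {v} → T (kept v) → deg# N v ≡ 5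
    deg-N {v} kv = trans (sym (trans (deg#-∼ E∼ v) collapse)) (degE v)
      where
      collapse : deg# (doublePath v₁ v₂ v₃ v₄ ((v₂ , x) ∷ (v₃ , y) ∷ R)) v ≡ deg# N v
      collapse rewrite δ-≢ (proj₁ (kept⁻ kv)) | δ-≢ (proj₂ (kept⁻ kv)) =
        regroup (δ v₁ v) (δ v₄ v) (δ x v) (δ y v) (deg# R v)
        where
        regroup : ∀ a d x y t → (a + 0) + ((a + 0) + (d + (d + (x + (y + t))))) ≡ (a + d) + ((a + d) + ((x + y) + t))
        regroup = solve-∀

    coloured : ∃[ C ] (strip C ≡ N × ∀ v → T (kept v) → OK C v)
    coloured = smaller-colourable kept N within (λ v → deg-N) (v₁ , kept⁺ n₁₂ n₁₃) (v₂ , ¬kept)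

    module Extend (p q r : ℕ) (CR : List (CEdge (nV G))) (sR : strip CR ≡ R)
      (ok : ∀ v → T (kept v) → OK ((p , v₁ , v₄) ∷ (q , v₁ , v₄) ∷ (r , x , y) ∷ CR) v) where

      C : List (CEdge (nV G))
      C = (p , v₁ , v₄) ∷ (q , v₁ , v₄) ∷ (r , x , y) ∷ CR

      other : V → ℕ → ℕ
      other v a = χ r a * (δ x v + δ y v) + cdeg CR a v

      cdeg-C : ∀ a v → cdeg C a v ≡ (χ p a + χ q a) * (δ v₁ v + δ v₄ v) + other v a
      cdeg-C a v = trans (cong₂ _+_ (cends#-χ a v p v₁ v₄) (cong₂ _+_ (cends#-χ a v q v₁ v₄) (cong (_+ cdeg CR a v) (cends#-χ a v r x y))))
        (regroup (χ p a) (χ q a) (δ v₁ v + δ v₄ v) (χ r a * (δ x v + δ y v)) (cdeg CR a v))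
        where
        regroup : ∀ p q s t u → p * s + (q * s + (t + u)) ≡ (p + q) * s + (t + u)
        regroup = solve-∀

      cdeg-C₁ : ∀ a → cdeg C a v₁ ≡ χ p a + (χ q a + other v₁ a)
      cdeg-C₁ a = trans (cdeg-C a v₁) (trans (cong (λ t → (χ p a + χ q a) * t + other v₁ a) (cong₂ _+_ (δ-refl v₁) (δ-≢ (n₁₄ ∘ sym)))) (simplify (χ p a) (χ q a) (other v₁ a)))
        where
        simplify : ∀ p q t → (p + q) * 1 + t ≡ p + (q + t)
        simplify = solve-∀

      cdeg-C₄ : ∀ a → cdeg C a v₄ ≡ χ p a + (χ q a + other v₄ a)
      cdeg-C₄ a = trans (cdeg-C a v₄) (trans (cong (λ t → (χ p a + χ q a) * t + other v₄ a) (cong₂ _+_ (δ-≢ n₁₄) (δ-refl v₄))) (simplify (χ p a) (χ q a) (other v₄ a)))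
        where
        simplify : ∀ p q t → (p + q) * 1 + t ≡ p + (q + t)
        simplify = solve-∀

      deg-C : ∀ {v} → T (kept v) → deg# (strip C) v ≡ 5
      deg-C {v} kv = trans (cong (λ L → deg# ((v₁ , v₄) ∷ (v₁ , v₄) ∷ (x , y) ∷ L) v) sR) (deg-N kv)

      -- The letters `a`, `b`, `d` colour the three double edges of the path, and `r` colours the
      -- edges to `x` and `y`. Only the four vertices of the path need a condition, since elsewhere
      -- the colour degrees agree with those of `C`.
      attempt : ∀ a₁ a₂ b₁ b₂ d₁ d₂ →
        Is41 (λ a → χ a₁ a + (χ a₂ a + other v₁ a)) → Is41 (λ a → χ d₁ a + (χ d₂ a + other v₄ a)) →
        Is41 (λ a → χ a₁ a + (χ a₂ a + (χ b₁ a + (χ b₂ a + χ r a)))) →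
        Is41 (λ a → χ d₁ a + (χ d₂ a + (χ b₁ a + (χ b₂ a + χ r a)))) → ⊥
      attempt a₁ a₂ b₁ b₂ d₁ d₂ ok₁ ok₄ ok₂ ok₃ = uncolourable D (∼trans (∼reflexive (cong (λ L → _ ∷ _ ∷ _ ∷ _ ∷ _ ∷ _ ∷ _ ∷ _ ∷ L) sR)) (∼sym E∼)) okD
        where
        D : List (CEdge (nV G))
        D = (a₁ , v₁ , v₂) ∷ (a₂ , v₁ , v₂) ∷ (b₁ , v₂ , v₃) ∷ (b₂ , v₂ , v₃) ∷ (d₁ , v₃ , v₄) ∷ (d₂ , v₃ , v₄) ∷ (r , v₂ , x) ∷ (r , v₃ , y) ∷ CR
        cdeg-D : ∀ a v → cdeg D a v ≡ χ a₁ a * (δ v₁ v + δ v₂ v) + (χ a₂ a * (δ v₁ v + δ v₂ v) + (χ b₁ a * (δ v₂ v + δ v₃ v) + (χ b₂ a * (δ v₂ v + δ v₃ v)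
          + (χ d₁ a * (δ v₃ v + δ v₄ v) + (χ d₂ a * (δ v₃ v + δ v₄ v) + (χ r a * (δ v₂ v + δ x v) + (χ r a * (δ v₃ v + δ y v) + cdeg CR a v)))))))
        cdeg-D a v = cong₂ _+_ (cends#-χ a v a₁ v₁ v₂) (cong₂ _+_ (cends#-χ a v a₂ v₁ v₂) (cong₂ _+_ (cends#-χ a v b₁ v₂ v₃) (cong₂ _+_ (cends#-χ a v b₂ v₂ v₃)
          (cong₂ _+_ (cends#-χ a v d₁ v₃ v₄) (cong₂ _+_ (cends#-χ a v d₂ v₃ v₄) (cong₂ _+_ (cends#-χ a v r v₂ x) (cong₂ _+_ (cends#-χ a v r v₃ y) refl)))))))
        kept-case : ∀ {v} → v₂ ≢ v → v₃ ≢ v → ∀ a → cdeg D a v ≡ (χ a₁ a + χ a₂ a) * δ v₁ v + ((χ d₁ a + χ d₂ a) * δ v₄ v + other v a)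
        kept-case {v} p₂ p₃ a rewrite cdeg-D a v | δ-≢ p₂ | δ-≢ p₃ = regroup (χ a₁ a) (χ a₂ a) (χ b₁ a) (χ b₂ a) (χ d₁ a) (χ d₂ a) (χ r a) (δ v₁ v) (δ v₄ v) (δ x v) (δ y v) (cdeg CR a v)
          where
          regroup : ∀ a₁ a₂ b₁ b₂ d₁ d₂ r s₁ s₄ x y t → a₁ * (s₁ + 0) + (a₂ * (s₁ + 0) + (b₁ * 0 + (b₂ * 0 + (d₁ * s₄ + (d₂ * s₄ + (r * x + (r * y + t))))))) ≡ (a₁ + a₂) * s₁ + ((d₁ + d₂) * s₄ + (r * (x + y) + t))
          regroup = solve-∀
        by-cases : ∀ v → Dec (v₂ ≡ v) → Dec (v₃ ≡ v) → Dec (v₁ ≡ v) → Dec (v₄ ≡ v) → OK D v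
        by-cases _ (yes refl) _ _ _ = Is41-resp eq ok₂
          where
          eq : ∀ a → cdeg D a v₂ ≡ χ a₁ a + (χ a₂ a + (χ b₁ a + (χ b₂ a + χ r a)))
          eq a rewrite cdeg-D a v₂ | δ-≢ n₁₂ | δ-refl v₂ | δ-≢ (n₂₃ ∘ sym) | δ-≢ (n₂₄ ∘ sym) | δ-≢ x≢v₂ | δ-≢ y≢v₂
            | cdeg-0 CR a v₂ (trans (cong (λ L → deg# L v₂) sR) R₂) = regroup (χ a₁ a) (χ a₂ a) (χ b₁ a) (χ b₂ a) (χ d₁ a) (χ d₂ a) (χ r a)
            where
            regroup : ∀ a₁ a₂ b₁ b₂ d₁ d₂ r → a₁ * 1 + (a₂ * 1 + (b₁ * 1 + (b₂ * 1 + (d₁ * 0 + (d₂ * 0 + (r * 1 + (r * 0 + 0))))))) ≡ a₁ + (a₂ + (b₁ + (b₂ + r)))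
            regroup = solve-∀
        by-cases _ (no _) (yes refl) _ _ = Is41-resp eq ok₃
          where
          eq : ∀ a → cdeg D a v₃ ≡ χ d₁ a + (χ d₂ a + (χ b₁ a + (χ b₂ a + χ r a)))
          eq a rewrite cdeg-D a v₃ | δ-≢ n₁₃ | δ-refl v₃ | δ-≢ n₂₃ | δ-≢ (n₃₄ ∘ sym) | δ-≢ x≢v₃ | δ-≢ y≢v₃
            | cdeg-0 CR a v₃ (trans (cong (λ L → deg# L v₃) sR) R₃) = regroup (χ a₁ a) (χ a₂ a) (χ b₁ a) (χ b₂ a) (χ d₁ a) (χ d₂ a) (χ r a)
            where
            regroup : ∀ a₁ a₂ b₁ b₂ d₁ d₂ r → a₁ * 0 + (a₂ * 0 + (b₁ * 1 + (b₂ * 1 + (d₁ * 1 + (d₂ * 1 + (r * 0 + (r * 1 + 0))))))) ≡ d₁ + (d₂ + (b₁ + (b₂ + r)))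
            regroup = solve-∀
        by-cases _ (no p₂) (no p₃) (yes refl) _ = Is41-resp (λ a → trans (kept-case p₂ p₃ a) (eq a)) ok₁
          where
          eq : ∀ a → (χ a₁ a + χ a₂ a) * δ v₁ v₁ + ((χ d₁ a + χ d₂ a) * δ v₄ v₁ + other v₁ a) ≡ χ a₁ a + (χ a₂ a + other v₁ a)
          eq a rewrite δ-refl v₁ | δ-≢ (n₁₄ ∘ sym) = regroup (χ a₁ a) (χ a₂ a) (χ d₁ a + χ d₂ a) (other v₁ a)
            where
            regroup : ∀ a b d t → (a + b) * 1 + (d * 0 + t) ≡ a + (b + t)
            regroup = solve-∀
        by-cases _ (no p₂) (no p₃) (no _) (yes refl) = Is41-resp (λ a → trans (kept-case p₂ p₃ a) (eq a)) ok₄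
          where
          eq : ∀ a → (χ a₁ a + χ a₂ a) * δ v₁ v₄ + ((χ d₁ a + χ d₂ a) * δ v₄ v₄ + other v₄ a) ≡ χ d₁ a + (χ d₂ a + other v₄ a)
          eq a rewrite δ-refl v₄ | δ-≢ n₁₄ = regroup (χ d₁ a) (χ d₂ a) (χ a₁ a + χ a₂ a) (other v₄ a)
            where
            regroup : ∀ a b d t → d * 0 + ((a + b) * 1 + t) ≡ a + (b + t)
            regroup = solve-∀
        by-cases v (no p₂) (no p₃) (no p₁) (no p₄) = OK-resp {C = C} {D} eq (ok v (kept⁺ (p₂ ∘ sym) (p₃ ∘ sym)))
          where
          eq : ∀ a → cdeg C a v ≡ cdeg D a v
          eq a rewrite kept-case p₂ p₃ a | cdeg-C a v | δ-≢ p₁ | δ-≢ p₄ = regroup (χ p a + χ q a) (χ a₁ a + χ a₂ a) (χ d₁ a + χ d₂ a) (other v a)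
            where
            regroup : ∀ p s d t → p * 0 + t ≡ s * 0 + (d * 0 + t)
            regroup = solve-∀
        okD : ∀ v → OK D v
        okD v = by-cases v (v₂ F.≟ v) (v₃ F.≟ v) (v₁ F.≟ v) (v₄ F.≟ v)

      unchanged₁ : Is41 (λ a → χ p a + (χ q a + other v₁ a))
      unchanged₁ = Is41-resp (λ a → sym (cdeg-C₁ a)) (ok v₁ (kept⁺ n₁₂ n₁₃))

      unchanged₄ : Is41 (λ a → χ p a + (χ q a + other v₄ a))
      unchanged₄ = Is41-resp (λ a → sym (cdeg-C₄ a)) (ok v₄ (kept⁺ (n₂₄ ∘ sym) (n₃₄ ∘ sym)))

      -- If both outer double edges take over `p` and `q`, nothing changes at `v₁` and `v₄`, while
      -- `v₂` and `v₃` see the same five colours; so one condition remains.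
      keep : ∀ b₁ b₂ {m s} → m ≢ s → (∀ a → χ p a + (χ q a + (χ b₁ a + (χ b₂ a + χ r a))) ≡ 4 * χ m a + χ s a) → ⊥
      keep b₁ b₂ m≢s eq = attempt p q b₁ b₂ p q unchanged₁ unchanged₄ (Is41-χ m≢s eq) (Is41-χ m≢s eq)

      major-last : ∀ m s → s + (m + (m + (m + m))) ≡ 4 * m + s
      major-last = solve-∀

      impossible : ⊥
      impossible with p N.≟ q | r N.≟ p | r N.≟ q
      -- All three new edges agree, and a second colour must be introduced on one middle edge.
      ... | yes refl | yes refl | _ = keep p (suc p) (1+n≢n ∘ sym) (λ a → regroup (χ p a) (χ (suc p) a))
        where
        regroup : ∀ m s → m + (m + (m + (s + m))) ≡ 4 * m + s
        regroup = solve-∀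
      ... | yes refl | no r≢p | _ = keep p p (r≢p ∘ sym) (λ a → regroup (χ p a) (χ r a))
        where
        regroup : ∀ m s → m + (m + (m + (m + s))) ≡ 4 * m + s
        regroup = solve-∀
      ... | no p≢q | yes refl | _ = keep p p p≢q (λ a → regroup (χ p a) (χ q a))
        where
        regroup : ∀ m s → m + (s + (m + (m + m))) ≡ 4 * m + s
        regroup = solve-∀
      ... | no p≢q | no _ | yes refl = keep q q (p≢q ∘ sym) (λ a → major-last (χ q a) (χ p a))
      ... | no p≢q | no r≢p | no r≢q
        with swap-minor C v₁ (deg-C (kept⁺ n₁₂ n₁₃)) p≢q r≢p r≢q cdeg-C₁ (ok v₁ (kept⁺ n₁₂ n₁₃))
           | swap-minor C v₄ (deg-C (kept⁺ (n₂₄ ∘ sym) (n₃₄ ∘ sym))) p≢q r≢p r≢q cdeg-C₄ (ok v₄ (kept⁺ (n₂₄ ∘ sym) (n₃₄ ∘ sym)))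
      -- Each outer double edge gets `r` and the majority colour of its outer end, the middle one
      -- gets `r` twice: four ends of colour `r` at `v₂` and at `v₃`.
      ...   | m , m≢r , is₁ | m′ , m′≢r , is₄ = attempt m r r r m′ r is₁ is₄
        (Is41-χ (m≢r ∘ sym) (λ a → major-last (χ r a) (χ m a))) (Is41-χ (m′≢r ∘ sym) (λ a → major-last (χ r a) (χ m′ a)))

    conclude : ∃[ C ] (strip C ≡ N × ∀ v → T (kept v) → OK C v) → ⊥
    conclude (C , sC , ok) with strip-∷³ C sC
    ... | p , q , r , CR , refl , sR = Extend.impossible p q r CR sR ok

    contradictory : ⊥
    contradictory = conclude coloured

  no-double-path : ¬ HasDoublePath3 G
  no-double-path (v₁ , v₂ , v₃ , v₄ , (n₁₂ , n₁₃ , n₁₄ , n₂₃ , n₂₄ , n₃₄) , d₁₂ , d₂₃ , d₃₄) = step₁ (mult-extract₂ E v₁ v₂ (DoubleEdge⇒mult G v₁ v₂ d₁₂))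
    where
    path : List (Edge (nV G)) → List (Edge (nV G))
    path = doublePath v₁ v₂ v₃ v₄

    finish : ∀ {L x L′ y R} → E ∼ path L →
      L ∼ (v₂ , x) ∷ L′ → L′ ∼ (v₃ , y) ∷ R → δ x v₂ + deg# L′ v₂ ≡ 0 → x ≢ v₃ → δ y v₃ + deg# R v₃ ≡ 0 → ⊥
    finish {L} {x} {L′} {y} {R} E∼ L∼ L′∼ e₂ x≢v₃ e₃ = Reduced.contradictory n₁₂ n₁₃ n₁₄ n₂₃ n₂₄ n₃₄ (δ≡0⇒≢ (m+n≡0⇒m≡0 _ e₂)) x≢v₃
      (δ≡0⇒≢ {y} (m+n≡0⇒n≡0 (δ v₃ v₂) (m+n≡0⇒m≡0 _ f₂))) (δ≡0⇒≢ (m+n≡0⇒m≡0 _ e₃)) (m+n≡0⇒n≡0 (ends# (v₃ , y) v₂) f₂) (m+n≡0⇒n≡0 (δ y v₃) e₃)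
      (∼trans E∼ (∼++ˡ (path []) (∼trans L∼ (∼prep L′∼))))
      where
      δ≡0⇒≢ : ∀ {z w : V} → δ z w ≡ 0 → z ≢ w
      δ≡0⇒≢ {z} eq refl = case trans (sym (δ-refl z)) eq of λ ()
      f₂ : ends# (v₃ , y) v₂ + deg# R v₂ ≡ 0
      f₂ = trans (sym (deg#-∼ L′∼ v₂)) (m+n≡0⇒n≡0 (δ x v₂) e₂)

    module Ends {L} (E∼ : E ∼ path L) where
      six : V → ℕ
      six v = deg# (path []) v
      total : ∀ v → six v + deg# L v ≡ 5
      total v = trans (sym (trans (deg#-∼ E∼ v) (deg#-++ (path []) L v))) (degE v)
      deg₂ : deg# L v₂ ≡ 1
      deg₂ = +-cancelˡ-≡ 4 _ _ (trans (cong (_+ deg# L v₂) (sym six₂)) (total v₂))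
        where
        six₂ : six v₂ ≡ 4
        six₂ rewrite δ-≢ n₁₂ | δ-refl v₂ | δ-≢ (n₂₃ ∘ sym) | δ-≢ (n₂₄ ∘ sym) = refl
      deg₃ : deg# L v₃ ≡ 1
      deg₃ = +-cancelˡ-≡ 4 _ _ (trans (cong (_+ deg# L v₃) (sym six₃)) (total v₃))
        where
        six₃ : six v₃ ≡ 4
        six₃ rewrite δ-≢ n₁₃ | δ-≢ n₂₃ | δ-refl v₃ | δ-≢ (n₃₄ ∘ sym) = refl

      step₅ : ∀ {x L′} → L ∼ (v₂ , x) ∷ L′ → δ x v₂ + deg# L′ v₂ ≡ 0 → x ≢ v₃ → deg# L′ v₃ ≡ 1 → ∃[ y ] ∃[ R ] L′ ∼ (v₃ , y) ∷ R → ⊥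
      step₅ {x} {L′} L∼ e₂ x≢v₃ d₃ (y , R , L′∼) = finish E∼ L∼ L′∼ e₂ x≢v₃
        (suc-injective (trans (sym (trans (deg#-∼ L′∼ v₃) (cong (λ t → (t + δ y v₃) + deg# R v₃) (δ-refl v₃)))) d₃))

      step₄ : ∃[ x ] ∃[ L′ ] L ∼ (v₂ , x) ∷ L′ → ⊥
      step₄ (x , L′ , L∼) = step₅ L∼ e₂ x≢v₃ d₃ (deg#-extract L′ v₃ (≤-reflexive (sym d₃)))
        where
        e₂ : δ x v₂ + deg# L′ v₂ ≡ 0
        e₂ = suc-injective (trans (sym (trans (deg#-∼ L∼ v₂) (cong (λ t → (t + δ x v₂) + deg# L′ v₂) (δ-refl v₂)))) deg₂)
        -- Otherwise the fifth edge at `v₂` would be a third edge parallel to the middle ones.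
        x≢v₃ : x ≢ v₃
        x≢v₃ refl = not-Bad₂ n₂₃ (inj₁ (≤-trans three (≤-reflexive (sym (trans (mult-∼ E∼ v₂ v₃) m₂₃)))))
          where
          one : joins (v₂ , v₃) v₂ v₃ ≡ 1
          one = joins-same (v₂ , v₃) v₂ v₃ (inj₁ (refl , refl))
          three : 3 ≤ 2 + mult L v₂ v₃
          three = s≤s (s≤s (≤-trans (≤-trans (≤-reflexive (sym one)) (m≤m+n _ (mult L′ v₂ v₃))) (≤-reflexive (sym (mult-∼ L∼ v₂ v₃)))))
          m₂₃ : mult (path L) v₂ v₃ ≡ 2 + mult L v₂ v₃
          m₂₃ rewrite one | joins-diff (v₁ , v₂) v₂ v₃ (λ { (inj₁ (p , _)) → n₁₂ p ; (inj₂ (p , _)) → n₁₃ p })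
            | joins-diff (v₃ , v₄) v₂ v₃ (λ { (inj₁ (p , _)) → n₂₃ (sym p) ; (inj₂ (_ , p)) → n₂₄ (sym p) }) = refl
        d₃ : deg# L′ v₃ ≡ 1
        d₃ = trans (sym (trans (deg#-∼ L∼ v₃) (cong₂ (λ i j → (i + j) + deg# L′ v₃) (δ-≢ n₂₃) (δ-≢ x≢v₃)))) deg₃

      conclude : ⊥
      conclude = step₄ (deg#-extract L v₂ (≤-reflexive (sym deg₂)))

    step₃ : ∀ {L₁ L₂} → E ∼ (v₁ , v₂) ∷ (v₁ , v₂) ∷ L₁ → L₁ ∼ (v₂ , v₃) ∷ (v₂ , v₃) ∷ L₂ → ∃[ L₃ ] L₂ ∼ (v₃ , v₄) ∷ (v₃ , v₄) ∷ L₃ → ⊥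
    step₃ p q (L₃ , r) = Ends.conclude (∼trans p (∼prep (∼prep (∼trans q (∼prep (∼prep r))))))

    step₂ : ∀ {L₁} → E ∼ (v₁ , v₂) ∷ (v₁ , v₂) ∷ L₁ → ∃[ L₂ ] L₁ ∼ (v₂ , v₃) ∷ (v₂ , v₃) ∷ L₂ → ⊥
    step₂ p (L₂ , q) = step₃ p q (mult-extract₂ L₂ v₃ v₄ (≤-trans (DoubleEdge⇒mult G v₃ v₄ d₃₄)
      (≤-reflexive (trans (mult-skip p ¬12 ¬12) (mult-skip q ¬23 ¬23)))))
      where
      ¬12 : ¬ Same (v₁ , v₂) (v₃ , v₄)
      ¬12 (inj₁ (p , _)) = n₁₃ p
      ¬12 (inj₂ (p , _)) = n₁₄ p
      ¬23 : ¬ Same (v₂ , v₃) (v₃ , v₄)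
      ¬23 (inj₁ (p , _)) = n₂₃ p
      ¬23 (inj₂ (p , _)) = n₂₄ p

    step₁ : ∃[ L₁ ] E ∼ (v₁ , v₂) ∷ (v₁ , v₂) ∷ L₁ → ⊥
    step₁ (L₁ , p) = step₂ p (mult-extract₂ L₁ v₂ v₃ (≤-trans (DoubleEdge⇒mult G v₂ v₃ d₂₃) (≤-reflexive (mult-skip p ¬12 ¬12))))
      where
      ¬12 : ¬ Same (v₁ , v₂) (v₂ , v₃)
      ¬12 (inj₁ (p , _)) = n₁₂ p
      ¬12 (inj₂ (p , _)) = n₁₃ p

-- Double negation, and counting on vertex sets

¬¬-em : ∀ {P : Set} → ¬ ¬ Dec P
¬¬-em ¬d = ¬d (no λ p → ¬d (yes p))

-- Lets finitely many classical decisions be made at once, as when the missable vertices and the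
-- classes in Gallai's lemma are formed.
¬¬-Fin : ∀ {m} {P : Fin m → Set} → (∀ i → ¬ ¬ P i) → ¬ ¬ (∀ i → P i)
¬¬-Fin {zero}  f ¬p = ¬p λ ()
¬¬-Fin {suc m} f ¬p = f fzero λ p₀ → ¬¬-Fin (f ∘ fsuc) λ ps → ¬p λ { fzero → p₀ ; (fsuc i) → ps i }

𝟙 : Bool → ℕ
𝟙 b = if b then 1 else 0

𝟙-true : ∀ {b} → T b → 𝟙 b ≡ 1
𝟙-true {true} _ = refl

𝟙-false : ∀ {b} → ¬ T b → 𝟙 b ≡ 0
𝟙-false {true}  ¬b = contradiction tt ¬b
𝟙-false {false} _  = refl

sumFin-+ : ∀ {m} (f g : Fin m → ℕ) → sumFin (λ i → f i + g i) ≡ sumFin f + sumFin g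
sumFin-+ {zero}  f g = refl
sumFin-+ {suc m} f g rewrite sumFin-+ (f ∘ fsuc) (g ∘ fsuc) = interchange (f fzero) (g fzero) _ _

sumFin-0 : ∀ {m} {f : Fin m → ℕ} → (∀ i → f i ≡ 0) → sumFin f ≡ 0
sumFin-0 {zero}  p = refl
sumFin-0 {suc m} p = cong₂ _+_ (p fzero) (sumFin-0 (p ∘ fsuc))

sumFin-single : ∀ {m} (f : Fin m → ℕ) e → (∀ i → e ≢ i → f i ≡ 0) → sumFin f ≡ f e
sumFin-single f e p = trans (sumFin-without f e) (trans (cong (f e +_) (sumFin-0 zero-elsewhere)) (+-identityʳ _))
  where
  zero-elsewhere : ∀ i → without e f i ≡ 0
  zero-elsewhere i with e F.≟ i
  ... | yes _  = refl
  ... | no e≢i = p i e≢i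

sumFin-δ : ∀ (x : Fin n) → sumFin (δ x) ≡ 1
sumFin-δ x = trans (sumFin-single (δ x) x (λ i → δ-≢)) (δ-refl x)

sumOn : (Fin n → Bool) → (Fin n → ℕ) → ℕ
sumOn K f = sumFin (λ v → if K v then f v else 0)

if-+ : ∀ b (x y : ℕ) → (if b then x + y else 0) ≡ (if b then x else 0) + (if b then y else 0)
if-+ true  x y = refl
if-+ false x y = refl

sumOn-+ : ∀ (K : Fin n → Bool) f g → sumOn K (λ v → f v + g v) ≡ sumOn K f + sumOn K g
sumOn-+ K f g = trans (sumFin-cong (λ v → if-+ (K v) (f v) (g v)))
  (sumFin-+ (λ v → if K v then f v else 0) (λ v → if K v then g v else 0))

sumOn-δ : ∀ (K : Fin n → Bool) x → sumOn K (δ x) ≡ 𝟙 (K x)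
sumOn-δ K x = trans (sumFin-single (λ v → if K v then δ x v else 0) x off) (at (K x))
  where
  off : ∀ i → x ≢ i → (if K i then δ x i else 0) ≡ 0
  off i x≢i rewrite δ-≢ x≢i with K i
  ... | true  = refl
  ... | false = refl
  at : ∀ b → (if b then δ x x else 0) ≡ 𝟙 b
  at true  = δ-refl x
  at false = refl

endsIn : (Fin n → Bool) → Edge n → ℕ
endsIn K (x , y) = 𝟙 (K x) + 𝟙 (K y)

-- The handshake lemma relative to `K`: both sides count the edge ends in `K`.
sumOn-deg# : ∀ (K : Fin n → Bool) L → sumOn K (deg# L) ≡ sumL (endsIn K) L
sumOn-deg# K [] = sumFin-0 λ v → if-0 (K v)
  where
  if-0 : ∀ b → (if b then 0 else 0) ≡ 0
  if-0 true  = refl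
  if-0 false = refl
sumOn-deg# K ((x , y) ∷ L) = begin
  sumOn K (λ v → (δ x v + δ y v) + deg# L v) ≡⟨ sumOn-+ K (λ v → δ x v + δ y v) (deg# L) ⟩
  sumOn K (λ v → δ x v + δ y v) + sumOn K (deg# L) ≡⟨ cong₂ _+_ (trans (sumOn-+ K (δ x) (δ y)) (cong₂ _+_ (sumOn-δ K x) (sumOn-δ K y))) (sumOn-deg# K L) ⟩
  endsIn K (x , y) + sumL (endsIn K) L ∎
  where open ≡-Reasoning

infixl 6 _∖_ _⊕_
_∖_ _⊕_ : (Fin n → Bool) → Fin n → Fin n → Bool
(X ∖ t) v = X v ∧ not ⌊ t F.≟ v ⌋
(X ⊕ t) v = X v ∨ ⌊ t F.≟ v ⌋

∖⁺ : ∀ (X : Fin n → Bool) {t v} → T (X v) → t ≢ v → T ((X ∖ t) v)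
∖⁺ X {t} {v} p t≢v with X v | t F.≟ v
... | true | yes q = t≢v q
... | true | no _  = tt

∖⁻ : ∀ (X : Fin n → Bool) {t v} → T ((X ∖ t) v) → T (X v) × t ≢ v
∖⁻ X {t} {v} p with X v | t F.≟ v
... | true | no q = tt , q

⊕-new : ∀ (X : Fin n → Bool) t → T ((X ⊕ t) t)
⊕-new X t with X t | t F.≟ t
... | true  | _     = tt
... | false | yes _ = tt
... | false | no ¬p = ¬p refl

⊕-old : ∀ (X : Fin n → Bool) {t v} → T (X v) → T ((X ⊕ t) v)
⊕-old X {t} {v} p with X v
... | true = tt

⊕⁻ : ∀ (X : Fin n → Bool) {t v} → T ((X ⊕ t) v) → T (X v) ⊎ t ≡ v
⊕⁻ X {t} {v} p with X v | t F.≟ v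
... | true  | _     = inj₁ tt
... | false | yes q = inj₂ q

count-∖ : ∀ (X : Fin n → Bool) {t} → T (X t) → count X ≡ suc (count (X ∖ t))
count-∖ X {t} Xt = trans (sumFin-cong pointwise) (trans (sumFin-+ (δ t) (𝟙 ∘ (X ∖ t))) (cong (_+ count (X ∖ t)) (sumFin-δ t)))
  where
  pointwise : ∀ v → 𝟙 (X v) ≡ δ t v + 𝟙 ((X ∖ t) v)
  pointwise v with t F.≟ v
  ... | yes refl rewrite 𝟙-true Xt = cong suc (sym (𝟙-false {X v ∧ false} (λ p → ∧-false (X v) p)))
    where
    ∧-false : ∀ b → ¬ T (b ∧ false)
    ∧-false true  ()
    ∧-false false ()
  ... | no _ with X v
  ...   | true  = refl
  ...   | false = refl

count-⊕ : ∀ (X : Fin n → Bool) {t} → ¬ T (X t) → count (X ⊕ t) ≡ suc (count X)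
count-⊕ X {t} ¬Xt = trans (sumFin-cong pointwise) (trans (sumFin-+ (δ t) (𝟙 ∘ X)) (cong (_+ count X) (sumFin-δ t)))
  where
  pointwise : ∀ v → 𝟙 ((X ⊕ t) v) ≡ δ t v + 𝟙 (X v)
  pointwise v with t F.≟ v
  ... | yes refl rewrite 𝟙-false ¬Xt = 𝟙-true {X v ∨ true} (∨-true (X v))
    where
    ∨-true : ∀ b → T (b ∨ true)
    ∨-true true  = tt
    ∨-true false = tt
  ... | no _ with X v
  ...   | true  = refl
  ...   | false = refl

Odd : (Fin n → Bool) → Set
Odd K = ∃[ j ] count K ≡ 1 + 2 * j

-- The Tutte–Berge formula

module TutteBerge {n} (R : Fin n → Fin n → Set) (R-sym : ∀ {x y} → R x y → R y x) where

  -- The bound `disjoint` also excludes loops, which contribute 2 to `deg#`; this matters as `R` may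
  -- be reflexive at some vertices.
  record Matching (X : Fin n → Bool) (M : List (Edge n)) : Set where
    field
      adjacent : All (λ (x , y) → R x y) M
      disjoint : ∀ v → deg# M v ≤ 1
      within   : All (Within X) M
  open Matching

  misses : ∀ {X M v} → Matching X M → ¬ T (X v) → deg# M v ≡ 0
  misses {X} mM ¬Xv = deg#-Avoids (All.map (Within-Avoids {S = X} ¬Xv) (within mM))

  covered : ∀ {X M v} → Matching X M → deg# M v ≢ 0 → deg# M v ≡ 1
  covered {v = v} mM nz = ≤-antisym (disjoint mM v) (n≢0⇒n>0 nz)

  Matching-∼ : ∀ {X M N} → M ∼ N → Matching X M → Matching X N
  Matching-∼ p mM .adjacent   = All-∼ R-sym p (adjacent mM)
  Matching-∼ p mM .disjoint v = subst (_≤ 1) (deg#-∼ p v) (disjoint mM v)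
  Matching-∼ p mM .within     = All-∼ (λ (a , b) → b , a) p (within mM)

  Matching-⊆ : ∀ {X Y M} → (∀ {v} → T (X v) → T (Y v)) → Matching X M → Matching Y M
  Matching-⊆ sub mM .adjacent = adjacent mM
  Matching-⊆ sub mM .disjoint = disjoint mM
  Matching-⊆ sub mM .within   = All.map (λ (a , b) → sub a , sub b) (within mM)

  Matching-[] : ∀ {X} → Matching X []
  Matching-[] .adjacent   = []
  Matching-[] .disjoint v = z≤n
  Matching-[] .within     = []

  Matching-∷ : ∀ {X M x y} → Matching X M → R x y → x ≢ y → T (X x) → T (X y) → deg# M x ≡ 0 → deg# M y ≡ 0 →
    Matching X ((x , y) ∷ M)
  Matching-∷ mM r x≢y Xx Xy px py .adjacent = r ∷ adjacent mM
  Matching-∷ mM r x≢y Xx Xy px py .within   = (Xx , Xy) ∷ within mM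
  Matching-∷ {M = M} {x} {y} mM r x≢y Xx Xy px py .disjoint v with x F.≟ v | y F.≟ v
  ... | yes refl | yes refl = contradiction refl x≢y
  ... | yes refl | no _     = s≤s (≤-reflexive px)
  ... | no _     | yes refl = s≤s (≤-reflexive py)
  ... | no _     | no _     = disjoint mM v

  -- The vertex `a` is the mate of `t`. Confining the other matching edges to the remaining vertices
  -- is what makes the induction along an alternating path possible.
  record Head (X : Fin n → Bool) (M : List (Edge n)) (t : Fin n) : Set where
    field
      {a}   : Fin n
      {M₀}  : List (Edge n)
      split : M ∼ (t , a) ∷ M₀
      adj   : R t a
      t≢a   : t ≢ a
      Xt    : T (X t)
      Xa    : T (X a)
      t∉M₀  : deg# M₀ t ≡ 0
      a∉M₀  : deg# M₀ a ≡ 0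
      rest  : Matching (X ∖ t ∖ a) M₀

  head-edge : ∀ {X M t} → Matching X M → deg# M t ≢ 0 → Head X M t
  head-edge {X} {M} {t} mM nz = from (deg#-extract M t (n≢0⇒n>0 nz))
    where
    from : ∃[ a ] ∃[ M₀ ] M ∼ (t , a) ∷ M₀ → Head X M t
    from (a , M₀ , split) = record
      { split = split ; adj = All.head (adjacent m′) ; t≢a = t≢a
      ; Xt = proj₁ (All.head (within m′)) ; Xa = proj₂ (All.head (within m′))
      ; t∉M₀ = t∉ ; a∉M₀ = a∉
      ; rest = record
        { adjacent = All.tail (adjacent m′)
        ; disjoint = λ v → ≤-trans (m≤n+m _ (ends# (t , a) v)) (disjoint m′ v)
        ; within = All.zipWith (λ (w , (p , q) , (p′ , q′)) → ∖⁺ (X ∖ t) (∖⁺ X (proj₁ w) (p ∘ sym)) (p′ ∘ sym) , ∖⁺ (X ∖ t) (∖⁺ X (proj₂ w) (q ∘ sym)) (q′ ∘ sym))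
            (All.tail (within m′) , All.zipWith id (Avoids-deg# M₀ t∉ , Avoids-deg# M₀ a∉)) } }
      where
      m′ : Matching X ((t , a) ∷ M₀)
      m′ = Matching-∼ split mM
      one-t : 1 + (δ a t + deg# M₀ t) ≤ 1
      one-t = subst (_≤ 1) (trans (+-assoc (δ t t) (δ a t) _) (cong (_+ (δ a t + deg# M₀ t)) (δ-refl t))) (disjoint m′ t)
      t∉ : deg# M₀ t ≡ 0
      t∉ = m+n≡0⇒n≡0 (δ a t) (n≤0⇒n≡0 (≤-pred one-t))
      t≢a : t ≢ a
      t≢a refl = case trans (sym (δ-refl t)) (m+n≡0⇒m≡0 _ (n≤0⇒n≡0 (≤-pred one-t))) of λ ()
      one-a : 1 + deg# M₀ a ≤ 1
      one-a = subst (_≤ 1) (cong (_+ deg# M₀ a) (cong₂ _+_ (δ-≢ t≢a) (δ-refl a))) (disjoint m′ a)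
      a∉ : deg# M₀ a ≡ 0
      a∉ = n≤0⇒n≡0 (≤-pred one-a)

  Augmented : (Fin n → Bool) → List (Edge n) → Set
  Augmented X N = ∃[ N′ ] (Matching X N′ × length N′ ≡ suc (length N))

  -- The case that the alternating path ends at a vertex `z` missed by `M`: switching `M` along it
  -- covers `z` in place of `t`, which the last equation expresses without subtraction.
  Exchanged : (Fin n → Bool) → List (Edge n) → Fin n → Set
  Exchanged X M t = ∃[ M′ ] ∃[ z ] (Matching X M′ × length M′ ≡ length M × z ≢ t × T (X z) × deg# M z ≡ 0
    × ∀ v → deg# M′ v + δ t v ≡ deg# M v + δ z v)

  -- One end of the alternating path of M and N starting at t: after deleting
  -- its first two vertices t and a, the path continues from b, the mate of a in N.
  exchange : ∀ m {X M N t} → length M ≡ m → Matching X M → Matching X N → deg# M t ≢ 0 → deg# N t ≡ 0 →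
    Augmented X N ⊎ Exchanged X M t
  exchange m {X} {M} {N} {t} len mM mN Mt Nt = start m len (head-edge mM Mt)
    where
    start : ∀ m → length M ≡ m → Head X M t → Augmented X N ⊎ Exchanged X M t
    start m len H with deg# N (Head.a H) N.≟ 0
    ... | yes Na = inj₁ (_ , Matching-∷ mN (Head.adj H) (Head.t≢a H) (Head.Xt H) (Head.Xa H) Nt Na , refl)
    ... | no ¬Na = second m len (head-edge mN ¬Na)
      where
      open Head H
      second : ∀ m → length M ≡ m → Head X N a → Augmented X N ⊎ Exchanged X M t
      second m len H′ with deg# M (Head.a H′) N.≟ 0
      ... | yes Mb = inj₂ ((a , b) ∷ M₀ , b
          , Matching-∷ (Matching-⊆ (λ p → proj₁ (∖⁻ X (proj₁ (∖⁻ (X ∖ t) p)))) rest) adj′ a≢b Xa Xb a∉M₀ b∉M₀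
          , sym (length-∼ split) , t≢b ∘ sym , Xb , Mb
          , λ v → trans (regroup (δ a v) (δ b v) (deg# M₀ v) (δ t v)) (cong (_+ δ b v) (sym (deg#-∼ split v))))
        where
        open Head H′ using () renaming (a to b; adj to adj′; t≢a to a≢b; Xa to Xb; split to split′)
        t≢b : t ≢ b
        t≢b refl = case trans (sym Nt) (trans (deg#-∼ split′ t) (cong (_+ deg# (Head.M₀ H′) t) (cong₂ _+_ (δ-≢ (t≢a ∘ sym)) (δ-refl t)))) of λ ()
        b∉M₀ : deg# M₀ b ≡ 0
        b∉M₀ = m+n≡0⇒n≡0 (ends# (t , a) b) (trans (sym (deg#-∼ split b)) Mb)
        regroup : ∀ a b m t → ((a + b) + m) + t ≡ ((t + a) + m) + b
        regroup = solve-∀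
      ... | no ¬Mb = third m len
        where
        open Head H′ using () renaming (a to b; adj to adj′; t≢a to a≢b; Xa to Xb; split to split′; M₀ to N₀; rest to rest′; a∉M₀ to b∉N₀; t∉M₀ to a∉N₀)
        Nt′ : ends# (a , b) t + deg# N₀ t ≡ 0
        Nt′ = trans (sym (deg#-∼ split′ t)) Nt
        t≢b : t ≢ b
        t≢b refl = case trans (sym (δ-refl t)) (m+n≡0⇒n≡0 (δ a t) (m+n≡0⇒m≡0 _ Nt′)) of λ ()
        X₀ : Fin n → Bool
        X₀ = X ∖ t ∖ a
        mN₀ : Matching X₀ N₀
        mN₀ = record { adjacent = adjacent rest′ ; disjoint = disjoint rest′
          ; within = All.zipWith (λ (w , (p , q)) → shrink (proj₁ w) p , shrink (proj₂ w) q) (within rest′ , Avoids-deg# N₀ (m+n≡0⇒n≡0 (ends# (a , b) t) Nt′)) }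
          where
          shrink : ∀ {v} → T ((X ∖ a ∖ b) v) → v ≢ t → T (X₀ v)
          shrink p v≢t = let q , _ = ∖⁻ (X ∖ a) p ; r , a≢v = ∖⁻ X q in ∖⁺ (X ∖ t) (∖⁺ X r (v≢t ∘ sym)) a≢v
        M₀b : deg# M₀ b ≡ deg# M b
        M₀b = sym (trans (deg#-∼ split b) (cong (_+ deg# M₀ b) (cong₂ _+_ (δ-≢ t≢b) (δ-≢ a≢b))))
        third : ∀ m → length M ≡ m → Augmented X N ⊎ Exchanged X M t
        third zero    len = contradiction (trans (sym len) (length-∼ split)) λ ()
        third (suc m) len with exchange m {X₀} {M₀} {N₀} {b} (suc-injective (trans (sym (length-∼ split)) len)) rest mN₀ (¬Mb ∘ trans (sym M₀b)) b∉N₀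
        ... | inj₁ (N′ , mN′ , len′) = inj₁ ((t , a) ∷ N′
            , Matching-∷ (Matching-⊆ (λ p → proj₁ (∖⁻ X (proj₁ (∖⁻ (X ∖ t) p)))) mN′) adj t≢a Xt Xa
                (misses mN′ (λ p → proj₂ (∖⁻ X (proj₁ (∖⁻ (X ∖ t) p))) refl)) (misses mN′ (λ p → proj₂ (∖⁻ (X ∖ t) p) refl))
            , cong suc (trans len′ (sym (length-∼ split′))))
        ... | inj₂ (M′ , z , mM′ , len′ , z≢b , X₀z , M₀z , eq) = inj₂ ((a , b) ∷ M′ , z
            , Matching-∷ (Matching-⊆ (λ p → proj₁ (∖⁻ X (proj₁ (∖⁻ (X ∖ t) p)))) mM′) adj′ a≢b Xa Xb
                (misses mM′ (λ p → proj₂ (∖⁻ (X ∖ t) p) refl)) M′b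
            , trans (cong suc len′) (sym (length-∼ split)) , t≢z ∘ sym , proj₁ (∖⁻ X X₁z)
            , trans (deg#-∼ split z) (cong₂ _+_ (cong₂ _+_ (δ-≢ t≢z) (δ-≢ a≢z)) M₀z)
            , λ v → trans (regroup (δ a v) (δ b v) (deg# M′ v) (δ t v)) (trans (cong (λ s → (δ t v + δ a v) + s) (eq v))
                (trans (sym (+-assoc (δ t v + δ a v) (deg# M₀ v) (δ z v))) (cong (_+ δ z v) (sym (deg#-∼ split v))))))
          where
          X₁z = proj₁ (∖⁻ (X ∖ t) X₀z)
          a≢z = proj₂ (∖⁻ (X ∖ t) X₀z)
          t≢z = proj₂ (∖⁻ X X₁z)
          M′b : deg# M′ b ≡ 0
          M′b = +-cancelʳ-≡ 1 _ 0 (trans (cong (deg# M′ b +_) (sym (δ-refl b))) (trans (eq b)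
            (cong₂ _+_ (trans M₀b (covered mM ¬Mb)) (δ-≢ z≢b))))
          regroup : ∀ a b m t → ((a + b) + m) + t ≡ (t + a) + (m + b)
          regroup = solve-∀

AllPairs-All : ∀ {P : A → Set} {R : A → A → Set} {xs} → All P xs → AllPairs R xs → AllPairs (λ x y → P x × P y × R x y) xs
AllPairs-All []       []         = []
AllPairs-All (p ∷ ps) (rs ∷ ap) = All.zipWith (λ (q , r) → p , q , r) (ps , rs) ∷ AllPairs-All ps ap

T-⌊⌋⁺ : ∀ {P : Set} (d : Dec P) → P → T ⌊ d ⌋
T-⌊⌋⁺ (yes _) _ = tt
T-⌊⌋⁺ (no ¬p) p = ¬p p

T-⌊⌋⁻ : ∀ {P : Set} (d : Dec P) → T ⌊ d ⌋ → P
T-⌊⌋⁻ (yes p) _ = p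

module BergeFormula {n} (R : Fin n → Fin n → Set) (R-sym : ∀ {x y} → R x y → R y x) where
  open TutteBerge R R-sym
  open Matching

  -- A certificate for the Tutte-Berge formula: `large` says that `M` misses at most `length Ks`
  -- minus `count S` vertices of `X`. By `closed`, the sets in `Ks` are unions of components of `X`
  -- minus `S`.
  record Barrier (X : Fin n → Bool) : Set where
    field
      M      : List (Edge n)
      mM     : Matching X M
      S      : Fin n → Bool
      Ks     : List (Fin n → Bool)
      S⊆X    : ∀ {v} → T (S v) → T (X v)
      odd    : All Odd Ks
      inside : All (λ K → ∀ {v} → T (K v) → T (X v) × ¬ T (S v)) Ks
      apart  : AllPairs (λ K K′ → ∀ v → T (K v) → ¬ T (K′ v)) Ks
      closed : All (λ K → ∀ {x y} → T (K x) → T (X y) → R x y → T (K y) ⊎ T (S y)) Ks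
      large  : count S + count X ≤ length Ks + 2 * length M

  sumL-endsIn : ∀ {X : Fin n → Bool} {M} → All (Within X) M → sumL (endsIn X) M ≡ 2 * length M
  sumL-endsIn []                = refl
  sumL-endsIn {X} {_ ∷ M} ((Xx , Xy) ∷ w) = trans (cong₂ _+_ (cong₂ _+_ (𝟙-true Xx) (𝟙-true Xy)) (sumL-endsIn w)) (sym (*-suc 2 (length M)))

  missed : (Fin n → Bool) → List (Edge n) → Fin n → Bool
  missed X M v = X v ∧ (deg# M v ≡ᵇ 0)

  missed⁻ : ∀ X M {v} → T (missed X M v) → T (X v) × deg# M v ≡ 0
  missed⁻ X M {v} p = let q , r = T-∧ {X v} p in q , ≡ᵇ⇒≡ _ 0 r

  count-missed : ∀ {X M} → Matching X M → count X ≡ count (missed X M) + 2 * length M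
  count-missed {X} {M} mM = begin
    count X ≡⟨ sumFin-cong (λ v → pointwise (X v) (deg# M v) (disjoint mM v)) ⟩
    sumFin (λ v → 𝟙 (missed X M v) + (if X v then deg# M v else 0)) ≡⟨ sumFin-+ (𝟙 ∘ missed X M) (λ v → if X v then deg# M v else 0) ⟩
    count (missed X M) + sumOn X (deg# M) ≡⟨ cong (count (missed X M) +_) (trans (sumOn-deg# X M) (sumL-endsIn (within mM))) ⟩
    count (missed X M) + 2 * length M ∎
    where
    open ≡-Reasoning
    pointwise : ∀ b d → d ≤ 1 → 𝟙 b ≡ 𝟙 (b ∧ (d ≡ᵇ 0)) + (if b then d else 0)
    pointwise false _ _ = refl
    pointwise true 0 _ = refl
    pointwise true 1 _ = refl
    pointwise true (suc (suc _)) (s≤s ())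

  size-bound : ∀ {X M} → Matching X M → 2 * length M ≤ count X
  size-bound {X} {M} mM = subst (2 * length M ≤_) (sym (count-missed mM)) (m≤n+m _ (count (missed X M)))

  Maximum : (Fin n → Bool) → List (Edge n) → Set
  Maximum X M = ∀ N → Matching X N → length N ≤ length M

  -- A matching has at most half as many edges as `X` has vertices, so it cannot be improved more
  -- than `count X` times.
  maximum : ∀ X → ¬ ¬ (∃[ M ] (Matching X M × Maximum X M))
  maximum X = grow (count X) [] Matching-[] (m≤m+n _ _)
    where
    grow : ∀ f M → Matching X M → count X ≤ f + length M → ¬ ¬ (∃[ M ] (Matching X M × Maximum X M))
    grow zero    M mM le none = none (M , mM , λ N mN → ≤-trans (m≤m+n _ _) (≤-trans (size-bound mN) le))
    grow (suc f) M mM le none = ¬¬-em {∃[ N ] (Matching X N × length M < length N)} λ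
      { (yes (N , mN , lt)) → grow f N mN (≤-trans le (≤-trans (≤-reflexive (sym (+-suc f (length M)))) (+-monoʳ-≤ f lt))) none
      ; (no ¬N) → none (M , mM , λ N mN → ≮⇒≥ λ lt → ¬N (N , mN , lt)) }

  -- Gallai's lemma: if every vertex is missed by some maximum matching, then
  -- "no maximum matching misses both" is an equivalence relation.
  module Gallai (X : Fin n → Bool) (M : List (Edge n)) (mM : Matching X M) (max : Maximum X M)
    (missable : ∀ v → T (X v) → ∃[ N ] (Matching X N × length N ≡ length M × deg# N v ≡ 0)) where

    Together : Fin n → Fin n → Set
    Together u v = ∃[ N ] (Matching X N × length N ≡ length M × deg# N u ≡ 0 × deg# N v ≡ 0)

    Together-sym : ∀ {u v} → Together u v → Together v u
    Together-sym (N , mN , len , p , q) = N , mN , len , q , p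

    no-larger : ∀ (N : List (Edge n)) {N′} → length N ≡ length M → Matching X N′ → length N′ ≡ suc (length N) → ⊥
    no-larger N len mN′ len′ = 1+n≰n (≤-trans (≤-reflexive (trans (cong suc (sym len)) (sym len′))) (max _ mN′))

    -- Let `L` miss `u` and `v` but cover `t`, and let a maximum matching `N` miss `t`. Exchanging
    -- along the path from `t` makes `L` miss `t` and cover a single new vertex `z`, so at least one
    -- of `u` and `v` is still missed.
    together-trans : ∀ {u t v} → T (X t) → u ≢ v → Together u v → Together u t ⊎ Together t v
    together-trans {u} {t} {v} Xt u≢v (L , mL , lenL , Lu , Lv) with deg# L t N.≟ 0
    ... | yes Lt = inj₁ (L , mL , lenL , Lu , Lt)
    ... | no ¬Lt = via (missable t Xt)
      where
      via : ∃[ N ] (Matching X N × length N ≡ length M × deg# N t ≡ 0) → Together u t ⊎ Together t v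
      via (N , mN , lenN , Nt) with exchange (length L) refl mL mN ¬Lt Nt
      ... | inj₁ (N′ , mN′ , len′) = contradiction len′ (no-larger N lenN mN′)
      ... | inj₂ (L′ , z , mL′ , len′ , z≢t , Xz , Lz , eq) = choose (z F.≟ u)
        where
        still : ∀ {w} → deg# L w ≡ 0 → z ≢ w → deg# L′ w ≡ 0
        still {w} Lw z≢w = m+n≡0⇒m≡0 _ (trans (eq w) (cong₂ _+_ Lw (δ-≢ z≢w)))
        now : deg# L′ t ≡ 0
        now = +-cancelʳ-≡ 1 _ 0 (trans (cong (deg# L′ t +_) (sym (δ-refl t))) (trans (eq t) (cong₂ _+_ (covered mL ¬Lt) (δ-≢ z≢t))))
        choose : Dec (z ≡ u) → Together u t ⊎ Together t v
        choose (no z≢u) = inj₁ (L′ , mL′ , trans len′ lenL , still Lu z≢u , now)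
        choose (yes refl) = inj₂ (L′ , mL′ , trans len′ lenL , now , still Lv u≢v)

    infix 4 _≈_
    _≈_ : Fin n → Fin n → Set
    u ≈ v = u ≡ v ⊎ ¬ Together u v

    ≈-sym : ∀ {u v} → u ≈ v → v ≈ u
    ≈-sym (inj₁ p)  = inj₁ (sym p)
    ≈-sym (inj₂ ¬p) = inj₂ (¬p ∘ Together-sym)

    ≈-trans : ∀ {u t v} → T (X t) → u ≈ t → t ≈ v → u ≈ v
    ≈-trans Xt (inj₁ refl) q = q
    ≈-trans Xt p (inj₁ refl) = p
    ≈-trans {u} {t} {v} Xt (inj₂ p) (inj₂ q) with u F.≟ v
    ... | yes u≡v = inj₁ u≡v
    ... | no u≢v  = inj₂ λ tog → case together-trans Xt u≢v tog of λ { (inj₁ r) → p r ; (inj₂ r) → q r }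

    -- A maximum matching that misses both ends of an edge could be enlarged by it.
    adjacent⇒≈ : ∀ {x y} → T (X x) → T (X y) → R x y → x ≈ y
    adjacent⇒≈ {x} {y} Xx Xy r with x F.≟ y
    ... | yes p = inj₁ p
    ... | no x≢y = inj₂ λ (N , mN , len , Nx , Ny) → no-larger N len (Matching-∷ mN r x≢y Xx Xy Nx Ny) refl

    module Classes (together? : ∀ u v → Dec (Together u v)) where

      ≈? : ∀ u v → Dec (u ≈ v)
      ≈? u v = (u F.≟ v) ⊎-dec ¬? (together? u v)

      class : Fin n → Fin n → Bool
      class u v = X v ∧ ⌊ ≈? u v ⌋

      class⁻ : ∀ {u v} → T (class u v) → T (X v) × u ≈ v
      class⁻ {u} {v} p = let q , r = T-∧ {X v} p in q , T-⌊⌋⁻ (≈? u v) r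

      class⁺ : ∀ {u v} → T (X v) → u ≈ v → T (class u v)
      class⁺ {u} {v} p q = T-∧⁺ p (T-⌊⌋⁺ (≈? u v) q)

      class-closed : ∀ {u x y} → T (class u x) → T (X y) → R x y → T (class u y)
      class-closed p Xy r = let Xx , u≈x = class⁻ p in class⁺ Xy (≈-trans Xx u≈x (adjacent⇒≈ Xx Xy r))

      -- `M` misses `u` and no other vertex of its class, for such a vertex would be missed together
      -- with `u`. As adjacent vertices are equivalent, `M` pairs up the rest of the class within
      -- itself.
      class-odd : ∀ {u} → T (missed X M u) → Odd (class u)
      class-odd {u} mu = sumL (λ (x , _) → 𝟙 (class u x)) M , (begin
        count (class u) ≡⟨ sumFin-cong pointwise ⟩
        sumFin (λ v → δ u v + (if class u v then deg# M v else 0)) ≡⟨ sumFin-+ (δ u) (λ v → if class u v then deg# M v else 0) ⟩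
        sumFin (δ u) + sumOn (class u) (deg# M) ≡⟨ cong₂ _+_ (sumFin-δ u) (trans (sumOn-deg# (class u) M) (double M (adjacent mM) (within mM))) ⟩
        1 + 2 * sumL (λ (x , _) → 𝟙 (class u x)) M ∎)
        where
        open ≡-Reasoning
        Xu = proj₁ (missed⁻ X M mu)
        Mu = proj₂ (missed⁻ X M mu)
        pointwise : ∀ v → 𝟙 (class u v) ≡ δ u v + (if class u v then deg# M v else 0)
        pointwise v = cases v (u F.≟ v) (T? (class u v))
          where
          if-true : ∀ b {d} → T b → (if b then d else 0) ≡ d
          if-true true _ = refl
          if-false : ∀ b {d} → ¬ T b → (if b then d else 0) ≡ 0
          if-false true  ¬b = contradiction tt ¬b
          if-false false _  = refl
          cases : ∀ v → Dec (u ≡ v) → Dec (T (class u v)) → 𝟙 (class u v) ≡ δ u v + (if class u v then deg# M v else 0)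
          cases _ (yes refl) _ = trans (𝟙-true cu) (sym (cong₂ _+_ (δ-refl u) (trans (if-true (class u u) cu) Mu)))
            where cu = class⁺ Xu (inj₁ refl)
          cases v (no u≢v) (yes cv) = trans (𝟙-true cv) (sym (cong₂ _+_ (δ-≢ u≢v) (trans (if-true (class u v) cv) (covered mM M-covers))))
            where
            M-covers : deg# M v ≢ 0
            M-covers Mv with proj₂ (class⁻ cv)
            ... | inj₁ u≡v  = u≢v u≡v
            ... | inj₂ ¬tog = ¬tog (M , mM , refl , Mu , Mv)
          cases v (no u≢v) (no ¬cv) = trans (𝟙-false ¬cv) (sym (cong₂ _+_ (δ-≢ u≢v) (if-false (class u v) ¬cv)))
        double : ∀ L → All (λ (x , y) → R x y) L → All (Within X) L → sumL (endsIn (class u)) L ≡ 2 * sumL (λ (x , _) → 𝟙 (class u x)) L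
        double [] _ _ = refl
        double ((x , y) ∷ L) (r ∷ rs) ((Xx , Xy) ∷ ws) = trans
          (cong₂ _+_ (cong (𝟙 (class u x) +_) (sym same)) (double L rs ws)) (regroup (𝟙 (class u x)) (sumL (λ (x , _) → 𝟙 (class u x)) L))
          where
          regroup : ∀ a b → (a + a) + 2 * b ≡ 2 * (a + b)
          regroup = solve-∀
          same : 𝟙 (class u x) ≡ 𝟙 (class u y)
          same with T? (class u x) | T? (class u y)
          ... | yes p | yes q = trans (𝟙-true p) (sym (𝟙-true q))
          ... | yes p | no ¬q = contradiction (class-closed p Xy r) ¬q
          ... | no ¬p | yes q = contradiction (class-closed q Xx (R-sym r)) ¬p
          ... | no ¬p | no ¬q = trans (𝟙-false ¬p) (sym (𝟙-false ¬q))

      U : List (Fin n)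
      U = elements (missed X M)

      -- Here `S` is empty. Distinct vertices missed by `M` are missed together, hence lie in
      -- different classes, so there is one odd class for each missed vertex.
      barrier : Barrier X
      barrier = record
        { M = M ; mM = mM ; S = λ _ → false ; Ks = map class U ; S⊆X = λ ()
        ; odd = Allₚ.map⁺ (All.map class-odd allMissed)
        ; inside = Allₚ.map⁺ (All.universal (λ u {v} p → proj₁ (class⁻ {u} {v} p) , λ ()) U)
        ; apart = APₚ.map⁺ (AP.map (λ (mu , mu′ , u≢u′) v p p′ → separate mu mu′ u≢u′ p p′) (AllPairs-All allMissed (elements-unique (missed X M))))
        ; closed = Allₚ.map⁺ (All.universal (λ u {x} {y} p Xy r → inj₁ (class-closed {u} {x} {y} p Xy r)) U)
        ; large = ≤-reflexive (trans (cong (_+ count X) (sumFin-0 {n} {λ _ → 0} (λ _ → refl))) (trans (count-missed mM)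
            (cong (_+ 2 * length M) (trans (sym (length-elements (missed X M))) (sym (Lₚ.length-map class U)))))) }
        where
        allMissed : All (T ∘ missed X M) U
        allMissed = All.tabulate (∈-elements⁻ (missed X M))
        separate : ∀ {u u′ v} → T (missed X M u) → T (missed X M u′) → u ≢ u′ → T (class u v) → ¬ T (class u′ v)
        separate mu mu′ u≢u′ p p′ with ≈-trans (proj₁ (class⁻ p)) (proj₂ (class⁻ p)) (≈-sym (proj₂ (class⁻ p′)))
        ... | inj₁ u≡u′ = u≢u′ u≡u′
        ... | inj₂ ¬tog = ¬tog (M , mM , refl , proj₂ (missed⁻ X M mu) , proj₂ (missed⁻ X M mu′))

  -- Every matching of `X` that avoids `t` is smaller than `M`, as a maximum one would have to cover
  -- `t`. So putting `t` into `S` raises the left side of `large` by 2 and the right side by at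
  -- least 2.
  add-to-barrier : ∀ {X M t} → Matching X M → Maximum X M → T (X t) →
    (∀ N → Matching X N → length N ≡ length M → deg# N t ≢ 0) → Barrier (X ∖ t) → Barrier X
  add-to-barrier {X} {M} {t} mM max Xt cov Br = record
    { M = M ; mM = mM ; S = S ⊕ t ; Ks = Ks
    ; S⊆X = λ p → case ⊕⁻ S p of λ { (inj₁ q) → proj₁ (∖⁻ X (S⊆X q)) ; (inj₂ refl) → Xt }
    ; odd = odd
    ; inside = All.map (λ f {v} p → proj₁ (∖⁻ X (proj₁ (f p))) , λ q → case ⊕⁻ S q of λ
        { (inj₁ r) → proj₂ (f p) r ; (inj₂ t≡v) → proj₂ (∖⁻ X (proj₁ (f p))) t≡v }) inside
    ; apart = apart
    ; closed = All.map (λ {K} f → λ {x} {y} p Xy r → reach {K} (t F.≟ y) (λ Xy′ → f p Xy′ r) Xy) closed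
    ; large = bound }
    where
    open Barrier Br renaming (M to M′; mM to mM′)
    reach : ∀ {K : Fin n → Bool} {y} → Dec (t ≡ y) → (T ((X ∖ t) y) → T (K y) ⊎ T (S y)) → T (X y) → T (K y) ⊎ T ((S ⊕ t) y)
    reach (yes refl) f Xy = inj₂ (⊕-new S t)
    reach (no t≢y)   f Xy with f (∖⁺ X Xy t≢y)
    ... | inj₁ p = inj₁ p
    ... | inj₂ q = inj₂ (⊕-old S q)
    mM″ : Matching X M′
    mM″ = Matching-⊆ (λ p → proj₁ (∖⁻ X p)) mM′
    shorter : suc (length M′) ≤ length M
    shorter = ≤∧≢⇒< (max M′ mM″) (λ eq → cov M′ mM″ eq (misses mM′ (λ p → proj₂ (∖⁻ X p) refl)))
    bound : count (S ⊕ t) + count X ≤ length Ks + 2 * length M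
    bound = begin
      count (S ⊕ t) + count X ≡⟨ cong₂ _+_ (count-⊕ S (λ p → proj₂ (∖⁻ X (S⊆X p)) refl)) (count-∖ X Xt) ⟩
      suc (count S) + suc (count (X ∖ t)) ≡⟨ cong suc (+-suc (count S) _) ⟩
      2 + (count S + count (X ∖ t)) ≤⟨ +-monoʳ-≤ 2 large ⟩
      2 + (length Ks + 2 * length M′) ≡⟨ regroup (length Ks) (length M′) ⟩
      length Ks + 2 * suc (length M′) ≤⟨ +-monoʳ-≤ (length Ks) (*-monoʳ-≤ 2 shorter) ⟩
      length Ks + 2 * length M ∎
      where
      open ≤-Reasoning
      regroup : ∀ k m → 2 + (k + 2 * m) ≡ k + 2 * suc m
      regroup = solve-∀

  -- Either some vertex is covered by all maximum matchings and can be moved into the barrier, or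
  -- every vertex is missable and Gallai's lemma applies.
  tutte-berge : ∀ c X → count X ≤ c → ¬ ¬ Barrier X
  tutte-berge c X le none = maximum X λ (M , mM , max) →
    ¬¬-em {∃[ t ] (T (X t) × ∀ N → Matching X N → length N ≡ length M → deg# N t ≢ 0)} λ
    { (yes (t , Xt , cov)) → recurse c le mM max Xt cov
    ; (no ¬cov) → ¬¬-Fin {P = Missable M} (λ v ¬m → ¬¬-em λ
        { (yes Xv) → ¬cov (v , Xv , λ N mN len z → ¬m λ _ → N , mN , len , z)
        ; (no ¬Xv) → ¬m λ Xv → contradiction Xv ¬Xv }) λ missable →
        ¬¬-Fin (λ u → ¬¬-Fin λ v → ¬¬-em) λ together? →
        none (Gallai.Classes.barrier X M mM max missable together?) }
    where
    Missable : List (Edge n) → Fin n → Set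
    Missable M v = T (X v) → ∃[ N ] (Matching X N × length N ≡ length M × deg# N v ≡ 0)
    recurse : ∀ c {M t} → count X ≤ c → Matching X M → Maximum X M → T (X t) →
      (∀ N → Matching X N → length N ≡ length M → deg# N t ≢ 0) → ⊥
    recurse zero    le mM max Xt cov = contradiction (subst (_≤ 0) (count-∖ X Xt) le) λ ()
    recurse (suc c) {t = t} le mM max Xt cov =
      tutte-berge c (X ∖ t) (≤-pred (subst (_≤ suc c) (count-∖ X Xt) le)) λ Br → none (add-to-barrier mM max Xt cov Br)

-- Odd sets

-- At most one entry satisfies `p`.
disjoint-sum : ∀ (p : A → Bool) b {xs} → AllPairs (λ x y → T (p x) → ¬ T (p y)) xs → All (λ x → T (p x) → 1 ≤ b) xs →
  sumL (𝟙 ∘ p) xs ≤ b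
disjoint-sum p b [] [] = z≤n
disjoint-sum p b {x ∷ xs} (d ∷ ds) (l ∷ ls) with T? (p x)
... | yes px = ≤-trans (≤-reflexive (cong₂ _+_ (𝟙-true px) (sumL-0ᴬ (All.map (λ ¬q → 𝟙-false (¬q px)) d)))) (l px)
... | no ¬px = subst (λ t → t + sumL (𝟙 ∘ p) xs ≤ b) (sym (𝟙-false ¬px)) (disjoint-sum p b ds ls)

loopIn : (Fin n → Bool) → Edge n → Bool
loopIn K (x , y) = ⌊ x F.≟ y ⌋ ∧ K x

leaves : (Fin n → Bool) → Fin n → Fin n → Bool
leaves K x y = K x ∧ not (K y)

leaves⁻ : ∀ (K : Fin n → Bool) {x y} → T (leaves K x y) → T (K x) × ¬ T (K y)
leaves⁻ K {x} {y} p with K x | K y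
... | true | false = tt , λ ()

leaves⁺ : ∀ (K : Fin n → Bool) {x y} → T (K x) → ¬ T (K y) → T (leaves K x y)
leaves⁺ K {x} {y} p q with K x | K y
... | true | true  = q tt
... | true | false = tt

cross : (Fin n → Bool) → Edge n → ℕ
cross K (x , y) = 𝟙 (leaves K x y) + 𝟙 (leaves K y x)

weight : (Fin n → Bool) → Edge n → ℕ
weight K e = 2 * 𝟙 (loopIn K e) + cross K e

loopIn-flip : ∀ (K : Fin n → Bool) x y → loopIn K (x , y) ≡ loopIn K (y , x)
loopIn-flip K x y with x F.≟ y | y F.≟ x
... | yes refl | yes _ = refl
... | yes refl | no ¬p = contradiction refl ¬p
... | no ¬p | yes refl = contradiction refl ¬p
... | no _ | no _ = refl

weight-flip : ∀ (K : Fin n → Bool) x y → weight K (x , y) ≡ weight K (y , x)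
weight-flip K x y = cong₂ (λ b t → 2 * 𝟙 b + t) (loopIn-flip K x y) (+-comm (𝟙 (leaves K x y)) (𝟙 (leaves K y x)))

sumL-*ˡ : ∀ c (f : A → ℕ) xs → sumL (λ x → c * f x) xs ≡ c * sumL f xs
sumL-*ˡ c f []       = sym (*-zeroʳ c)
sumL-*ˡ c f (x ∷ xs) = trans (cong (c * f x +_) (sumL-*ˡ c f xs)) (sym (*-distribˡ-+ c (f x) _))

-- The ambient set `C` is the whole vertex set in the final count, and a smallest light odd set in
-- `near-perfect`.
module Counting {n} (R : Fin n → Fin n → Set) (R-sym : ∀ {x y} → R x y → R y x) (C S : Fin n → Bool)
  (Ks : List (Fin n → Bool))
  (inside : All (λ K → ∀ {v} → T (K v) → T (C v) × ¬ T (S v)) Ks)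
  (apart  : AllPairs (λ K K′ → ∀ v → T (K v) → ¬ T (K′ v)) Ks)
  (closed : All (λ K → ∀ {x y} → T (K x) → T (C y) → R x y → T (K y) ⊎ T (S y)) Ks) where

  -- By `closed`, an edge that leaves `K` ends in `S` or leaves `C` as well; by disjointness its
  -- starting point lies in only one of the `Ks`.
  leaving : ∀ x y → R x y → sumL (λ K → 𝟙 (leaves K x y)) Ks ≤ 𝟙 (S y) + 𝟙 (leaves C x y)
  leaving x y r = disjoint-sum (λ K → leaves K x y) _
    (AP.map (λ {K} {K′} ap p q → ap x (proj₁ (leaves⁻ K p)) (proj₁ (leaves⁻ K′ q))) apart)
    (All.tabulate (λ {K} K∈ p → bound K (All.lookup inside K∈) (All.lookup closed K∈) (leaves⁻ K p)))
    where
    bound : ∀ K → (∀ {v} → T (K v) → T (C v) × ¬ T (S v)) → (∀ {x y} → T (K x) → T (C y) → R x y → T (K y) ⊎ T (S y)) →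
      T (K x) × ¬ T (K y) → 1 ≤ 𝟙 (S y) + 𝟙 (leaves C x y)
    bound K ins cl (Kx , ¬Ky) with T? (C y)
    ... | no ¬Cy = ≤-trans (≤-reflexive (sym (𝟙-true (leaves⁺ C (proj₁ (ins Kx)) ¬Cy)))) (m≤n+m _ (𝟙 (S y)))
    ... | yes Cy with cl Kx Cy r
    ...   | inj₁ Ky = contradiction Ky ¬Ky
    ...   | inj₂ Sy = ≤-trans (≤-reflexive (sym (𝟙-true Sy))) (m≤m+n _ _)

  weight-edge : ∀ x y → R x y → sumL (λ K → weight K (x , y)) Ks ≤ weight C (x , y) + endsIn S (x , y)
  weight-edge x y r = begin
    sumL (λ K → weight K (x , y)) Ks
      ≡⟨ sumL-+ (λ K → 2 * 𝟙 (loopIn K (x , y))) (λ K → cross K (x , y)) Ks ⟩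
    sumL (λ K → 2 * 𝟙 (loopIn K (x , y))) Ks + sumL (λ K → cross K (x , y)) Ks
      ≡⟨ cong₂ _+_ (sumL-*ˡ 2 _ Ks) (sumL-+ (λ K → 𝟙 (leaves K x y)) (λ K → 𝟙 (leaves K y x)) Ks) ⟩
    2 * sumL (λ K → 𝟙 (loopIn K (x , y))) Ks + (sumL (λ K → 𝟙 (leaves K x y)) Ks + sumL (λ K → 𝟙 (leaves K y x)) Ks)
      ≤⟨ +-mono-≤ (*-monoʳ-≤ 2 loops) (+-mono-≤ (leaving x y r) (leaving y x (R-sym r))) ⟩
    2 * 𝟙 (loopIn C (x , y)) + ((𝟙 (S y) + 𝟙 (leaves C x y)) + (𝟙 (S x) + 𝟙 (leaves C y x)))
      ≡⟨ regroup (2 * 𝟙 (loopIn C (x , y))) (𝟙 (S x)) (𝟙 (S y)) (𝟙 (leaves C x y)) (𝟙 (leaves C y x)) ⟩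
    weight C (x , y) + endsIn S (x , y) ∎
    where
    open ≤-Reasoning
    regroup : ∀ l s t u w → l + ((t + u) + (s + w)) ≡ (l + (u + w)) + (s + t)
    regroup = solve-∀
    loops : sumL (λ K → 𝟙 (loopIn K (x , y))) Ks ≤ 𝟙 (loopIn C (x , y))
    loops = disjoint-sum (λ K → loopIn K (x , y)) _
      (AP.map (λ ap p q → ap x (proj₂ (T-∧ {⌊ x F.≟ y ⌋} p)) (proj₂ (T-∧ {⌊ x F.≟ y ⌋} q))) apart)
      (All.map (λ {K} ins p → let l , Kx = T-∧ {⌊ x F.≟ y ⌋} p in
        ≤-reflexive (sym (𝟙-true (T-∧⁺ l (proj₁ (ins Kx)))))) inside)

  total-weight : ∀ {L} → All (λ (x , y) → R x y) L →
    sumL (λ K → sumL (weight K) L) Ks ≤ sumL (weight C) L + sumL (endsIn S) L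
  total-weight {L} adj = begin
    sumL (λ K → sumL (weight K) L) Ks ≡⟨ sumL-swap weight Ks L ⟩
    sumL (λ e → sumL (λ K → weight K e) Ks) L ≤⟨ sumL-≤ᴬ (All.map (λ {(x , y)} r → weight-edge x y r) adj) ⟩
    sumL (λ e → weight C e + endsIn S e) L ≡⟨ sumL-+ (weight C) (endsIn S) L ⟩
    sumL (weight C) L + sumL (endsIn S) L ∎
    where open ≤-Reasoning

  -- The edge touches none of the `Ks`, yet it leaves `C` and has an end in `S`. This is the extra 2
  -- that `near-perfect` gains.
  special-edge : ∀ {s x} → T (S s) → T (C s) → ¬ T (C x) →
    sumL (λ K → weight K (s , x)) Ks + 2 ≤ weight C (s , x) + endsIn S (s , x)
  special-edge {s} {x} Ss Cs ¬Cx = subst (λ t → t + 2 ≤ weight C (s , x) + endsIn S (s , x)) (sym (sumL-0ᴬ (All.map (λ {K} → none {K}) inside)))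
    (+-mono-≤ {1} {weight C (s , x)} {1} crossing (≤-trans (≤-reflexive (sym (𝟙-true Ss))) (m≤m+n _ _)))
    where
    crossing : 1 ≤ weight C (s , x)
    crossing = ≤-trans (≤-trans (≤-reflexive (sym (𝟙-true (leaves⁺ C Cs ¬Cx)))) (m≤m+n _ _)) (m≤n+m _ (2 * 𝟙 (loopIn C (s , x))))
    none : ∀ {K} → (∀ {v} → T (K v) → T (C v) × ¬ T (S v)) → weight K (s , x) ≡ 0
    none {K} ins = cong₂ (λ a b → 2 * a + b) (𝟙-false (λ p → ¬Ks (proj₂ (T-∧ {⌊ s F.≟ x ⌋} p))))
      (cong₂ _+_ (𝟙-false (λ p → ¬Ks (proj₁ (leaves⁻ K p)))) (𝟙-false (λ p → ¬Cx (proj₁ (ins (proj₁ (leaves⁻ K p)))))))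
      where
      ¬Ks : ¬ T (K s)
      ¬Ks Ks = proj₂ (ins Ks) Ss

parity : ∀ a b → 1 + 2 * a ≢ 2 * b
parity a b eq = contradiction (trans (sym (trans (cong (λ t → suc t % 2) (*-comm 2 a)) ([m+kn]%n≡m%n 1 a 2))) (trans (cong (_% 2) (trans eq (*-comm 2 b))) (m*n%n≡0 b 2))) λ ()

joins≤ends# : ∀ (e : Edge n) x y → joins e x y ≤ ends# e x
joins≤ends# e@(a , b) x y with same? e (x , y)
... | no _ = z≤n
... | yes (inj₁ (refl , refl)) = ≤-trans (≤-reflexive (sym (δ-refl x))) (m≤m+n _ _)
... | yes (inj₂ (refl , refl)) = ≤-trans (≤-reflexive (sym (δ-refl x))) (m≤n+m _ (δ y x))

joined : List (Edge n) → Edge n → Set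
joined L (x , y) = 1 ≤ mult L x y

-- A matching has no repeated edges, so its multiplicities are at most 1 and it suffices that its
-- edges occur in `L`.
matching-sub : ∀ (L M : List (Edge n)) → (∀ v → deg# M v ≤ 1) → All (joined L) M → ∃[ Q ] L ∼ M ++ Q
matching-sub L M deg≤1 js = mult-sub M L le
  where
  le : ∀ x y → mult M x y ≤ mult L x y
  le x y with mult M x y N.≟ 0
  ... | yes z = ≤-trans (≤-reflexive z) z≤n
  ... | no nz = ≤-trans (≤-trans (sumL-≤ (λ e → joins≤ends# e x y) M) (deg≤1 x)) (from (mult-extract M x y (n≢0⇒n>0 nz)))
    where
    from : ∃[ M′ ] M ∼ (x , y) ∷ M′ → 1 ≤ mult L x y
    from (M′ , M∼) = All.head (All-∼ {P = joined L} (λ {x} {y} p → ≤-trans p (≤-reflexive (mult-sym L x y))) M∼ js)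

all-joined : ∀ (L : List (Edge n)) → All (joined L) L
all-joined L = All.tabulate λ {(x , y)} e∈ → ≤-trans (≤-reflexive (sym (joins-same (x , y) x y (inj₁ (refl , refl))))) (sumL-∈ (λ e → joins e x y) e∈)
  where
  sumL-∈ : ∀ (f : Edge _ → ℕ) {e L} → e ∈ L → f e ≤ sumL f L
  sumL-∈ f (here refl) = m≤m+n _ _
  sumL-∈ f (there {x} e∈) = ≤-trans (sumL-∈ f e∈) (m≤n+m _ (f x))

count-0 : ∀ {X : Fin n → Bool} → count X ≡ 0 → ∀ v → ¬ T (X v)
count-0 {X = X} z v Xv = case trans (sym z) (count-∖ X Xv) of λ ()

count-⊆ : ∀ {X Y : Fin n → Bool} → (∀ {v} → T (X v) → T (Y v)) → count X ≤ count Y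
count-⊆ {X = X} {Y} sub = sumFin-≤ pointwise
  where
  pointwise : ∀ v → 𝟙 (X v) ≤ 𝟙 (Y v)
  pointwise v with T? (X v)
  ... | yes p = ≤-reflexive (trans (𝟙-true p) (sym (𝟙-true (sub p))))
  ... | no ¬p = ≤-trans (≤-reflexive (𝟙-false ¬p)) z≤n

5*-cancel : ∀ {a b w} → 5 * (a + b) ≤ w + 5 * a → 5 * b ≤ w
5*-cancel {a} {b} {w} le = +-cancelˡ-≤ (5 * a) _ _ (subst₂ _≤_ (*-distribˡ-+ 5 a b) (+-comm w (5 * a)) le)

-- Weights of odd sets in a minimal counterexample, and the five loops

module ManyLoops (G : Graph) (mc : MinimalCounterexample G) where
  open Minimal G mc
  open Cutting G mc

  R : V → V → Set
  R x y = 1 ≤ mult E x y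

  R-sym : ∀ {x y} → R x y → R y x
  R-sym {x} {y} p = ≤-trans p (≤-reflexive (mult-sym E x y))

  open TutteBerge R R-sym
  open BergeFormula R R-sym

  W : (V → Bool) → ℕ
  W K = sumL (weight K) E

  sumL-endsIn-E : ∀ S → sumL (endsIn S) E ≡ 5 * count S
  sumL-endsIn-E S = trans (sym (sumOn-deg# S E)) (trans (sumFin-cong pointwise) (scale (𝟙 ∘ S)))
    where
    pointwise : ∀ v → (if S v then deg# E v else 0) ≡ 5 * 𝟙 (S v)
    pointwise v rewrite degE v with S v
    ... | true  = refl
    ... | false = refl
    scale : ∀ {m} (f : Fin m → ℕ) → sumFin (λ i → 5 * f i) ≡ 5 * sumFin f
    scale {zero}  f = refl
    scale {suc m} f = trans (cong (5 * f fzero +_) (scale (f ∘ fsuc))) (sym (*-distribˡ-+ 5 (f fzero) _))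

  sum-≥5 : ∀ {Ks : List (V → Bool)} → All (λ K → 5 ≤ W K) Ks → 5 * length Ks ≤ sumL W Ks
  sum-≥5 []                 = z≤n
  sum-≥5 {_ ∷ Ks} (p ∷ ps) = ≤-trans (≤-reflexive (*-suc 5 (length Ks))) (+-mono-≤ p (sum-≥5 ps))

  -- Since `count X` is even, a matching that is not perfect misses at least two vertices.
  deficient : ∀ {X} (Br : Barrier X) → ∃[ j ] count X ≡ 2 * j → 2 * length (Barrier.M Br) ≢ count X →
    count (Barrier.S Br) + 2 ≤ length (Barrier.Ks Br)
  deficient {X} Br (j , even) ≢X = +-cancelʳ-≤ (2 * length M) _ _ (begin
    (count S + 2) + 2 * length M ≡⟨ regroup (count S) (length M) ⟩
    count S + 2 * suc (length M) ≤⟨ +-monoʳ-≤ (count S) (*-monoʳ-≤ 2 smaller) ⟩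
    count S + 2 * j ≡⟨ cong (count S +_) even ⟨
    count S + count X ≤⟨ large ⟩
    length Ks + 2 * length M ∎)
    where
    open Barrier Br
    open ≤-Reasoning
    regroup : ∀ s m → (s + 2) + 2 * m ≡ s + 2 * suc m
    regroup = solve-∀
    smaller : length M < j
    smaller = *-cancelˡ-< 2 _ _ (subst (2 * length M <_) even (≤∧≢⇒< (size-bound mM) ≢X))

  Perfect : (V → Bool) → List (Edge (nV G)) → Set
  Perfect X M = Matching X M × ∀ v → T (X v) → deg# M v ≡ 1

  perfect : ∀ {X M} → Matching X M → 2 * length M ≡ count X → Perfect X M
  perfect {X} {M} mM eq = mM , λ v Xv → covered mM λ z →
    count-0 {X = missed X M} none v (T-∧⁺ Xv (≡⇒≡ᵇ _ 0 z))
    where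
    none : count (missed X M) ≡ 0
    none = +-cancelʳ-≡ (2 * length M) _ 0 (trans (sym (count-missed mM)) (sym eq))

  -- The matching edges and the edge (s , x) get colour m, all other edges meeting C get colour l.
  inner-colouring : ∀ (C : V → Bool) {s x B I R₀ M} → E ∼ I ++ ((s , x) ∷ B) ++ R₀ → T (C s) → ¬ T (C x) →
    All (Crosses C) B → All (Outside C) R₀ → Perfect (C ∖ s) M → ∀ {m l} → m ≢ l →
    ∃[ D ] (strip D ≡ I × ∀ v → T (C v) → OK (D ++ (m , s , x) ∷ paint l B) v)
  inner-colouring C {s} {x} {B} {I} {R₀} {M} E∼ Cs ¬Cx crB oR (mM , pM) {m} {l} m≢l =
    use (matching-sub I M (Matching.disjoint mM) (All.zipWith inner (Matching.adjacent mM , Matching.within mM)))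
    where
    inner : ∀ {e} → (1 ≤ mult E (proj₁ e) (proj₂ e)) × Within (C ∖ s) e → joined I e
    inner {a , b} (r , (wa , wb)) = ≤-trans r (≤-reflexive (trans (mult-∼ E∼ a b) (trans (sumL-++ _ I (((s , x) ∷ B) ++ R₀))
      (trans (cong (mult I a b +_) (sumL-0ᴬ {f = λ e → joins e a b} (Allₚ.++⁺ (none (Cs , ¬Cx) ∷ All.map none crB) (All.map none′ oR)))) (+-identityʳ _)))))
      where
      Ca = proj₁ (∖⁻ C wa)
      Cb = proj₁ (∖⁻ C wb)
      none : ∀ {e} → Crosses C e → joins e a b ≡ 0
      none {e} (_ , ¬y) = joins-diff e a b λ { (inj₁ (refl , refl)) → ¬y Cb ; (inj₂ (refl , refl)) → ¬y Ca }
      none′ : ∀ {e} → Outside C e → joins e a b ≡ 0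
      none′ {e} (¬x , ¬y) = joins-diff e a b λ { (inj₁ (refl , refl)) → ¬y Cb ; (inj₂ (refl , refl)) → ¬y Ca }
    use : ∃[ F ] I ∼ M ++ F → ∃[ D ] (strip D ≡ I × ∀ v → T (C v) → OK (D ++ (m , s , x) ∷ paint l B) v)
    use (F , I∼) = reorder (recolour (∼sym I∼) (paint m M ++ paint l F) (trans (strip-++ (paint m M) _) (cong₂ _++_ (strip-paint m M) (strip-paint l F))))
      where
      five : ∀ {v} → T (C v) → (deg# M v + ends# (s , x) v) + (deg# F v + deg# B v) ≡ 5
      five {v} Cv = begin
        (deg# M v + ends# (s , x) v) + (deg# F v + deg# B v) ≡⟨ regroup (deg# M v) (ends# (s , x) v) (deg# F v) (deg# B v) ⟩
        (deg# M v + deg# F v) + ((ends# (s , x) v + deg# B v) + 0) ≡⟨ cong (λ t → (deg# M v + deg# F v) + ((ends# (s , x) v + deg# B v) + t)) (deg#-Avoids (All.map (Outside-Avoids {S = C} Cv) oR)) ⟨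
        (deg# M v + deg# F v) + ((ends# (s , x) v + deg# B v) + deg# R₀ v) ≡⟨ cong₂ _+_ (deg#-++ M F v) (deg#-++ ((s , x) ∷ B) R₀ v) ⟨
        deg# (M ++ F) v + deg# (((s , x) ∷ B) ++ R₀) v ≡⟨ cong (_+ deg# (((s , x) ∷ B) ++ R₀) v) (deg#-∼ I∼ v) ⟨
        deg# I v + deg# (((s , x) ∷ B) ++ R₀) v ≡⟨ deg#-++ I _ v ⟨
        deg# (I ++ (((s , x) ∷ B) ++ R₀)) v ≡⟨ deg#-∼ E∼ v ⟨
        deg# E v ≡⟨ degE v ⟩
        5 ∎
        where
        open ≡-Reasoning
        regroup : ∀ a b c d → (a + b) + (c + d) ≡ (a + c) + ((b + d) + 0)
        regroup = solve-∀
      reorder : ∃[ D ] (strip D ≡ I × ∀ a v → cdeg (paint m M ++ paint l F) a v ≡ cdeg D a v) →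
        ∃[ D ] (strip D ≡ I × ∀ v → T (C v) → OK (D ++ (m , s , x) ∷ paint l B) v)
      reorder (D , sD , same) = D , sD , λ v Cv → l , m , m≢l ∘ sym , major Cv , minor Cv
        where
        cdeg-D : ∀ a v → cdeg (D ++ (m , s , x) ∷ paint l B) a v ≡ (cdeg (paint m M) a v + cdeg (paint l F) a v) + (cends# a v (m , s , x) + cdeg (paint l B) a v)
        cdeg-D a v = trans (cdeg-++ D _ a v) (cong (_+ (cends# a v (m , s , x) + cdeg (paint l B) a v))
          (trans (sym (same a v)) (cdeg-++ (paint m M) (paint l F) a v)))
        once : ∀ {v} → T (C v) → deg# M v + ends# (s , x) v ≡ 1
        once {v} Cv with s F.≟ v
        ... | yes refl = cong₂ _+_ (misses mM (λ p → proj₂ (∖⁻ C p) refl)) (cong suc (δ-≢ (λ r → ¬Cx (subst (T ∘ C) (sym r) Cv))))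
        ... | no s≢v   = cong₂ _+_ (pM v (∖⁺ C Cv s≢v)) (δ-≢ (λ r → ¬Cx (subst (T ∘ C) (sym r) Cv)))
        minor : ∀ {v} → T (C v) → cdeg (D ++ (m , s , x) ∷ paint l B) m v ≡ 1
        minor {v} Cv = trans (cdeg-D m v) (trans (cong₂ _+_ (cong₂ _+_ (cdeg-paint m M v) (cdeg-paint-≢ (m≢l ∘ sym) F v))
          (cong₂ _+_ (cends#-same m v (s , x)) (cdeg-paint-≢ (m≢l ∘ sym) B v)))
          (trans (cong₂ _+_ (+-identityʳ (deg# M v)) (+-identityʳ (ends# (s , x) v))) (once Cv)))
        major : ∀ {v} → T (C v) → cdeg (D ++ (m , s , x) ∷ paint l B) l v ≡ 4
        major {v} Cv = trans (cdeg-D l v) (trans (cong₂ _+_ (cong₂ _+_ (cdeg-paint-≢ m≢l M v) (cdeg-paint l F v))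
          (cong₂ _+_ (cends#-diff m≢l v (s , x)) (cdeg-paint l B v)))
          (+-cancelˡ-≡ 1 _ 4 (trans (cong (_+ (deg# F v + deg# B v)) (sym (once Cv))) (five Cv))))

  -- The odd sets K of a barrier of C ∖ s weigh at least 5 each, while the edge (s , x) is counted
  -- twice on the right of total-weight and not at all on the left.
  near-perfect : ∀ C → (∀ K → Odd K → count K < count C → 5 ≤ W K) → Odd C → W C ≤ 4 →
    ∀ {s x} → T (C s) → ¬ T (C x) → ∀ {E′} → E ∼ (s , x) ∷ E′ → ¬ ¬ (∃[ M ] Perfect (C ∖ s) M)
  near-perfect C ih (j , odd) light {s} {x} Cs ¬Cx {E′} E∼ none = tutte-berge (count (C ∖ s)) (C ∖ s) ≤-refl λ Br → decide Br (2 * length (Barrier.M Br) N.≟ count (C ∖ s))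
    where
    even : count (C ∖ s) ≡ 2 * j
    even = suc-injective (trans (sym (count-∖ C Cs)) odd)
    decide : (Br : Barrier (C ∖ s)) → Dec (2 * length (Barrier.M Br) ≡ count (C ∖ s)) → ⊥
    decide Br (yes eq) = none (Barrier.M Br , perfect (Barrier.mM Br) eq)
    decide Br (no ≢) = contradiction (≤-trans seven light) λ { (s≤s (s≤s (s≤s (s≤s ())))) }
      where
      open Barrier Br hiding (M; mM)
      S′ : V → Bool
      S′ = S ⊕ s
      inside′ : All (λ K → ∀ {v} → T (K v) → T (C v) × ¬ T (S′ v)) Ks
      inside′ = All.map (λ f {v} p → proj₁ (∖⁻ C (proj₁ (f p))) , λ q → case ⊕⁻ S q of λ
        { (inj₁ r) → proj₂ (f p) r ; (inj₂ s≡v) → proj₂ (∖⁻ C (proj₁ (f p))) s≡v }) inside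
      closed′ : All (λ K → ∀ {x y} → T (K x) → T (C y) → R x y → T (K y) ⊎ T (S′ y)) Ks
      closed′ = All.map (λ {K} f {x} {y} p Cy r → reach {K} (s F.≟ y) (λ q → f p q r) Cy) closed
        where
        reach : ∀ {K : V → Bool} {y} → Dec (s ≡ y) → (T ((C ∖ s) y) → T (K y) ⊎ T (S y)) → T (C y) → T (K y) ⊎ T (S′ y)
        reach (yes refl) f Cy = inj₂ (⊕-new S s)
        reach (no s≢y)   f Cy with f (∖⁺ C Cy s≢y)
        ... | inj₁ p = inj₁ p
        ... | inj₂ q = inj₂ (⊕-old S q)
      open Counting R R-sym C S′ Ks inside′ apart closed′
      heavy : All (λ K → 5 ≤ W K) Ks
      heavy = All.tabulate λ {K} K∈ → ih K (All.lookup (Barrier.odd Br) K∈)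
        (≤-trans (s≤s (count-⊆ {X = K} {C ∖ s} (λ p → proj₁ (All.lookup inside K∈ p)))) (≤-reflexive (sym (count-∖ C Cs))))
      adj : All (λ (x , y) → R x y) ((s , x) ∷ E′)
      adj = All-∼ R-sym E∼ (all-joined E)
      W≡ : ∀ K → W K ≡ weight K (s , x) + sumL (weight K) E′
      W≡ K = sumL-∼ (weight-flip K) E∼
      total : sumL W Ks + 2 ≤ W C + 5 * count S′
      total = begin
        sumL W Ks + 2 ≡⟨ cong (_+ 2) (trans (sumL-cong W≡ Ks) (sumL-+ (λ K → weight K (s , x)) (λ K → sumL (weight K) E′) Ks)) ⟩
        (sumL (λ K → weight K (s , x)) Ks + sumL (λ K → sumL (weight K) E′) Ks) + 2 ≡⟨ regroup₁ (sumL (λ K → weight K (s , x)) Ks) _ ⟩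
        (sumL (λ K → weight K (s , x)) Ks + 2) + sumL (λ K → sumL (weight K) E′) Ks ≤⟨ +-mono-≤ (special-edge (⊕-new S s) Cs ¬Cx) (total-weight (All.tail adj)) ⟩
        (weight C (s , x) + endsIn S′ (s , x)) + (sumL (weight C) E′ + sumL (endsIn S′) E′) ≡⟨ interchange (weight C (s , x)) _ _ _ ⟩
        (weight C (s , x) + sumL (weight C) E′) + (endsIn S′ (s , x) + sumL (endsIn S′) E′) ≡⟨ cong₂ _+_ (W≡ C) (sumL-∼ (λ x y → +-comm (𝟙 (S′ x)) (𝟙 (S′ y))) E∼) ⟨
        W C + sumL (endsIn S′) E ≡⟨ cong (W C +_) (sumL-endsIn-E S′) ⟩
        W C + 5 * count S′ ∎
        where
        open ≤-Reasoning
        regroup₁ : ∀ a b → (a + b) + 2 ≡ (a + 2) + b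
        regroup₁ = solve-∀
      -- Adding `s` to the barrier uses up one of the two surplus odd sets.
      enough : count S′ + 1 ≤ length Ks
      enough = ≤-trans (≤-reflexive (trans (cong (_+ 1) (count-⊕ S (λ p → proj₂ (∖⁻ C (S⊆X p)) refl))) (regroup (count S)))) (deficient Br (j , even) ≢)
        where
        regroup : ∀ a → suc a + 1 ≡ a + 2
        regroup = solve-∀
      seven : 7 ≤ W C
      seven = +-cancelʳ-≤ (5 * count S′) _ _ (begin
        7 + 5 * count S′ ≡⟨ regroup (count S′) ⟩
        5 * (count S′ + 1) + 2 ≤⟨ +-monoˡ-≤ 2 (≤-trans (*-monoʳ-≤ 5 enough) (sum-≥5 heavy)) ⟩
        sumL W Ks + 2 ≤⟨ total ⟩
        W C + 5 * count S′ ∎)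
        where
        open ≤-Reasoning
        regroup : ∀ a → 7 + 5 * a ≡ 5 * (a + 1) + 2
        regroup = solve-∀

  -- The vertices `s₀` and `t₀` ensure that contracting `C` to one vertex makes the graph smaller.
  module Boundary (C : V → Bool) (ih : ∀ K → Odd K → count K < count C → 5 ≤ W K) (oddC : Odd C) (light : W C ≤ 4)
    {s₀ t₀} (Cs₀ : T (C s₀)) (Ct₀ : T (C t₀)) (s₀≢t₀ : s₀ ≢ t₀)
    {I R₀ : List (Edge (nV G))} (wI : All (Within C) I) (oR : All (Outside C) R₀) where

    -- The cut edge keeps its colour `c`, which the perfect matching of the rest of `C` shares;
    -- `suc c` is the majority colour throughout `C`.
    one-edge : ∀ {s x} → E ∼ I ++ ((s , x) ∷ []) ++ R₀ → T (C s) → ¬ T (C x) → ⊥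
    one-edge {s} {x} E∼ Cs ¬Cx = near-perfect C ih oddC light Cs ¬Cx (∼trans E∼ (↭⇒∼ (Permₚ.shift (s , x) I R₀))) λ (M , pM) →
      no-extendable-cut C Cs₀ Ct₀ s₀≢t₀ E∼ wI ((Cs , ¬Cx) ∷ []) oR (extend pM)
      where
      extend : ∀ {M} → Perfect (C ∖ s) M → ∀ D → strip D ≡ (s , x) ∷ [] → Paired (map proj₁ D) →
        ∃[ D′ ] (strip D′ ≡ I × ∀ v → T (C v) → OK (D′ ++ D) v)
      extend pM ((c , _) ∷ []) refl _ = inner-colouring C {B = []} {I} {R₀} E∼ Cs ¬Cx [] oR pM (1+n≢n {c} ∘ sym)

    -- `N` is `G` with `C` contracted to `s₁`, where a loop completes the three cut edges to degree
    -- 5.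
    module ThreeEdges {s₁ x₁ s₂ x₂ s₃ x₃} (E∼ : E ∼ I ++ ((s₁ , x₁) ∷ (s₂ , x₂) ∷ (s₃ , x₃) ∷ []) ++ R₀)
      (crB : All (Crosses C) ((s₁ , x₁) ∷ (s₂ , x₂) ∷ (s₃ , x₃) ∷ [])) where

      B₀ N : List (Edge (nV G))
      B₀ = (s₁ , x₁) ∷ (s₂ , x₂) ∷ (s₃ , x₃) ∷ []
      N = (s₁ , x₁) ∷ (s₁ , x₂) ∷ (s₁ , x₃) ∷ (s₁ , s₁) ∷ R₀

      Cs₁ = proj₁ (All.head crB)
      Cs₂ = proj₁ (All.head (All.tail crB))
      Cs₃ = proj₁ (All.head (All.tail (All.tail crB)))
      ¬Cx₁ = proj₂ (All.head crB)
      ¬Cx₂ = proj₂ (All.head (All.tail crB))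
      ¬Cx₃ = proj₂ (All.head (All.tail (All.tail crB)))

      -- The pendant test for a one-element list is a way to keep `s₁` along with the complement of
      -- `C`.
      kept : V → Bool
      kept = keptBy C ((s₁ , x₁) ∷ [])

      kept-s₁ : T (kept s₁)
      kept-s₁ = keptBy-pendant C ((s₁ , x₁) ∷ []) (T-⌊⌋⁺ (s₁ F.≟ s₁) refl)

      out : ∀ {v} → ¬ T (C v) → T (kept v)
      out = keptBy-out C ((s₁ , x₁) ∷ [])

      deleted : ∃[ v ] ¬ T (kept v)
      deleted with s₁ F.≟ s₀
      ... | no s₁≢s₀ = s₀ , λ k → case keptBy-cases C ((s₁ , x₁) ∷ []) k of λ
        { (inj₁ ¬Cs₀) → ¬Cs₀ Cs₀ ; (inj₂ (_ , p)) → s₁≢s₀ (T-⌊⌋⁻ (s₁ F.≟ s₀) p) }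
      ... | yes refl = t₀ , λ k → case keptBy-cases C ((s₁ , x₁) ∷ []) k of λ
        { (inj₁ ¬Ct₀) → ¬Ct₀ Ct₀ ; (inj₂ (_ , p)) → s₀≢t₀ (T-⌊⌋⁻ (s₁ F.≟ t₀) p) }

      within-N : All (Within kept) N
      within-N = (kept-s₁ , out ¬Cx₁) ∷ (kept-s₁ , out ¬Cx₂) ∷ (kept-s₁ , out ¬Cx₃) ∷ (kept-s₁ , kept-s₁) ∷
        All.map (λ (p , q) → out p , out q) oR

      x≢ : ∀ {x v} → ¬ T (C x) → T (C v) → x ≢ v
      x≢ ¬Cx Cv refl = ¬Cx Cv

      deg-N : ∀ v → T (kept v) → deg# N v ≡ 5
      deg-N v kv = by-side (keptBy-cases C ((s₁ , x₁) ∷ []) kv)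
        where
        by-side : ¬ T (C v) ⊎ (T (C v) × T ⌊ s₁ F.≟ v ⌋) → deg# N v ≡ 5
        by-side (inj₂ (Cv , p)) with refl ← T-⌊⌋⁻ (s₁ F.≟ v) p
          rewrite δ-refl s₁ | δ-≢ (x≢ ¬Cx₁ Cv) | δ-≢ (x≢ ¬Cx₂ Cv) | δ-≢ (x≢ ¬Cx₃ Cv)
            | deg#-Avoids (All.map (Outside-Avoids {S = C} Cv) oR) = refl
        by-side (inj₁ ¬Cv) = trans (sym (trans (deg#-∼ E∼ v) (trans (deg#-++ I (B₀ ++ R₀) v)
          (cong₂ _+_ (deg#-Avoids (All.map (Within-Avoids {S = C} ¬Cv) wI)) collapse)))) (degE v)
          where
          collapse : deg# (B₀ ++ R₀) v ≡ deg# N v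
          collapse rewrite δ-≢ (separated C Cs₁ ¬Cv) | δ-≢ (separated C Cs₂ ¬Cv) | δ-≢ (separated C Cs₃ ¬Cv) = refl

      module Coloured (c₁ c₂ c₃ l : ℕ) (D : List (CEdge (nV G))) (sD : strip D ≡ R₀)
        (ok : ∀ v → T (kept v) → OK ((c₁ , s₁ , x₁) ∷ (c₂ , s₁ , x₂) ∷ (c₃ , s₁ , x₃) ∷ (l , s₁ , s₁) ∷ D) v) where

        CN : List (CEdge (nV G))
        CN = (c₁ , s₁ , x₁) ∷ (c₂ , s₁ , x₂) ∷ (c₃ , s₁ , x₃) ∷ (l , s₁ , s₁) ∷ D

        cdeg-out : ∀ {v} → ¬ T (C v) → ∀ a → cdeg CN a v ≡ χ c₁ a * δ x₁ v + (χ c₂ a * δ x₂ v + (χ c₃ a * δ x₃ v + cdeg D a v))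
        cdeg-out {v} ¬Cv a rewrite cends#-χ a v c₁ s₁ x₁ | cends#-χ a v c₂ s₁ x₂ | cends#-χ a v c₃ s₁ x₃ | cends#-χ a v l s₁ s₁
          | δ-≢ (separated C Cs₁ ¬Cv) | *-zeroʳ (χ l a) = refl

        cdeg-in : ∀ a → cdeg CN a s₁ ≡ χ c₁ a + (χ c₂ a + (χ c₃ a + 2 * χ l a))
        cdeg-in a rewrite cends#-χ a s₁ c₁ s₁ x₁ | cends#-χ a s₁ c₂ s₁ x₂ | cends#-χ a s₁ c₃ s₁ x₃ | cends#-χ a s₁ l s₁ s₁
          | δ-refl s₁ | δ-≢ (x≢ ¬Cx₁ Cs₁) | δ-≢ (x≢ ¬Cx₂ Cs₁) | δ-≢ (x≢ ¬Cx₃ Cs₁)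
          | cdeg-0 D a s₁ (trans (cong (λ L → deg# L s₁) sD) (deg#-Avoids (All.map (Outside-Avoids {S = C} Cs₁) oR))) =
          regroup (χ c₁ a) (χ c₂ a) (χ c₃ a) (χ l a)
          where
          regroup : ∀ p q r t → p * 1 + (q * 1 + (r * 1 + (t * 2 + 0))) ≡ p + (q + (r + 2 * t))
          regroup = solve-∀

        -- The cut edge whose colour `m` differs from `l` is moved to the front. A perfect matching
        -- of `C` minus its inner end then provides the minority edges in `C`, which agree with `m`
        -- and `l` on the cut.
        settle : ∀ {s x y z t u m} → B₀ ↭ (s , x) ∷ (t , y) ∷ (u , z) ∷ [] → m ≢ l →
          (∀ {v} → ¬ T (C v) → ∀ a → cdeg CN a v ≡ χ m a * δ x v + (χ l a * δ y v + (χ l a * δ z v + cdeg D a v))) → ⊥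
        settle {s} {x} {y} {z} {t} {u} {m} perm m≢l eq =
          near-perfect C ih oddC light Cs ¬Cx (∼trans E∼′ (↭⇒∼ (Permₚ.shift (s , x) I (B₁ ++ R₀)))) λ (M , pM) →
            conclude (inner-colouring C E∼′ Cs ¬Cx (All.tail crB′) oR pM m≢l)
          where
          B₁ : List (Edge (nV G))
          B₁ = (t , y) ∷ (u , z) ∷ []
          crB′ : All (Crosses C) ((s , x) ∷ B₁)
          crB′ = Permₚ.All-resp-↭ perm crB
          Cs = proj₁ (All.head crB′)
          ¬Cx = proj₂ (All.head crB′)
          Ct = proj₁ (All.head (All.tail crB′))
          Cu = proj₁ (All.head (All.tail (All.tail crB′)))
          E∼′ : E ∼ I ++ ((s , x) ∷ B₁) ++ R₀
          E∼′ = ∼trans E∼ (∼++ˡ I (∼++ʳ R₀ (↭⇒∼ perm)))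
          okOut : ∀ v → ¬ T (C v) → OK (((m , s , x) ∷ paint l B₁) ++ D) v
          okOut v ¬Cv = OK-resp {C = CN} {((m , s , x) ∷ paint l B₁) ++ D} (λ a → trans (eq ¬Cv a) (sym (flat a))) (ok v (out ¬Cv))
            where
            flat : ∀ a → cdeg (((m , s , x) ∷ paint l B₁) ++ D) a v ≡ χ m a * δ x v + (χ l a * δ y v + (χ l a * δ z v + cdeg D a v))
            flat a rewrite cends#-χ a v m s x | cends#-χ a v l t y | cends#-χ a v l u z
              | δ-≢ (separated C Cs ¬Cv) | δ-≢ (separated C Ct ¬Cv) | δ-≢ (separated C Cu ¬Cv) = refl
          conclude : ∃[ D′ ] (strip D′ ≡ I × ∀ v → T (C v) → OK (D′ ++ (m , s , x) ∷ paint l B₁) v) → ⊥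
          conclude (D′ , sD′ , okIn) = glue C E∼′ wI oR D′ ((m , s , x) ∷ paint l B₁) D sD′ refl sD okIn okOut

        -- The loop makes l the majority colour at s₁, so exactly one of c₁, c₂, c₃ differs from l.
        impossible : ⊥
        impossible = by-cases (Is41-resp (λ a → sym (cdeg-in a)) (ok s₁ kept-s₁))
          where
          χ≤1 : ∀ c a → χ c a ≤ 1
          χ≤1 c a with ⌊ c N.≟ a ⌋
          ... | true  = ≤-refl
          ... | false = z≤n
          minority : Dec (c₁ ≡ l) → Dec (c₂ ≡ l) → Dec (c₃ ≡ l) → χ c₁ l + (χ c₂ l + (χ c₃ l + 2)) ≡ 4 → ⊥
          minority (no p) (yes refl) (yes refl) _ = settle Perm.refl p cdeg-out
          minority (yes refl) (no p) (yes refl) _ = settle (Perm.swap _ _ Perm.refl) p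
            (λ {v} ¬Cv a → trans (cdeg-out ¬Cv a) (swap-heads (χ l a * δ x₁ v) (χ c₂ a * δ x₂ v) _))
          minority (yes refl) (yes refl) (no p) _ = settle (Perm.trans (Perm.prep _ (Perm.swap _ _ Perm.refl)) (Perm.swap _ _ Perm.refl)) p
            (λ {v} ¬Cv a → trans (cdeg-out ¬Cv a) (trans (cong (χ l a * δ x₁ v +_) (swap-heads (χ l a * δ x₂ v) (χ c₃ a * δ x₃ v) _))
              (swap-heads (χ l a * δ x₁ v) (χ c₃ a * δ x₃ v) _)))
          minority (yes refl) (yes refl) (yes refl) eq rewrite χ-refl l = case eq of λ ()
          minority (no p) (no q) c eq rewrite χ-≢ p | χ-≢ q = <⇒≢ (s≤s (+-monoˡ-≤ 2 (χ≤1 c₃ l))) eq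
          minority (no p) b (no q) eq rewrite χ-≢ p | χ-≢ q = <⇒≢ (s≤s (+-monoˡ-≤ 2 (χ≤1 c₂ l))) eq
          minority a (no p) (no q) eq rewrite χ-≢ p | χ-≢ q = <⇒≢ (s≤s (+-monoˡ-≤ 2 (χ≤1 c₁ l))) eq
          by-cases : Is41 (λ a → χ c₁ a + (χ c₂ a + (χ c₃ a + 2 * χ l a))) → ⊥
          by-cases (a , b , a≢b , p , q) = major (l N.≟ a) p
            where
            major : ∀ {a} → Dec (l ≡ a) → χ c₁ a + (χ c₂ a + (χ c₃ a + 2 * χ l a)) ≡ 4 → ⊥
            major (yes refl) p = minority (c₁ N.≟ l) (c₂ N.≟ l) (c₃ N.≟ l)
              (trans (sym (cong (λ t → χ c₁ l + (χ c₂ l + (χ c₃ l + 2 * t))) (χ-refl l))) p)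
            major {a} (no l≢a) p = <⇒≢ (s≤s (+-mono-≤ (χ≤1 c₁ a) (+-mono-≤ (χ≤1 c₂ a) (+-mono-≤ (χ≤1 c₃ a) (≤-reflexive (cong (2 *_) (χ-≢ l≢a))))))) p

      three-edges : ⊥
      three-edges = conclude (smaller-colourable kept N within-N deg-N (s₁ , kept-s₁) deleted)
        where
        strip-∷⁴ : ∀ (C : List (CEdge (nV G))) {e f g h L} → strip C ≡ e ∷ f ∷ g ∷ h ∷ L →
          ∃[ p ] ∃[ q ] ∃[ r ] ∃[ t ] ∃[ D ] (C ≡ (p , e) ∷ (q , f) ∷ (r , g) ∷ (t , h) ∷ D × strip D ≡ L)
        strip-∷⁴ ((p , _) ∷ (q , _) ∷ (r , _) ∷ (t , _) ∷ D) refl = p , q , r , t , D , refl , refl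
        conclude : ∃[ C′ ] (strip C′ ≡ N × ∀ v → T (kept v) → OK C′ v) → ⊥
        conclude (C′ , sC′ , ok) with strip-∷⁴ C′ sC′
        ... | c₁ , c₂ , c₃ , l , D , refl , sD = Coloured.impossible c₁ c₂ c₃ l D sD ok

  module Light (C : V → Bool) (ih : ∀ K → Odd K → count K < count C → 5 ≤ W K) (oddC : Odd C) (light : W C ≤ 4) where

    -- At an isolated member of the family every edge end belongs to a loop or to a leaving edge, so
    -- the weight is at least the degree 5.
    singleton : count C ≡ 1 → ⊥
    singleton one = contradiction (≤-trans heavy light) λ { (s≤s (s≤s (s≤s (s≤s ())))) }
      where
      unique : ∀ {x y} → T (C x) → T (C y) → x ≡ y
      unique {x} {y} Cx Cy with x F.≟ y
      ... | yes p = p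
      ... | no x≢y = contradiction (trans (sym one) (trans (count-∖ C Cx) (cong suc (count-∖ (C ∖ x) (∖⁺ C Cy x≢y))))) λ ()
      pointwise : ∀ e → endsIn C e ≤ weight C e
      pointwise (x , y) = cases (T? (C x)) (T? (C y))
        where
        cases : Dec (T (C x)) → Dec (T (C y)) → endsIn C (x , y) ≤ weight C (x , y)
        cases (yes Cx) (yes Cy) = ≤-trans (≤-reflexive (trans (cong₂ _+_ (𝟙-true Cx) (𝟙-true Cy))
          (cong (2 *_) (sym (𝟙-true {loopIn C (x , y)} (T-∧⁺ (T-⌊⌋⁺ (x F.≟ y) (unique Cx Cy)) Cx)))))) (m≤m+n _ _)
        cases (yes Cx) (no ¬Cy) = ≤-trans (≤-reflexive (trans (cong₂ _+_ (𝟙-true Cx) (𝟙-false ¬Cy)) (sym (𝟙-true (leaves⁺ C Cx ¬Cy)))))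
          (≤-trans (m≤m+n _ _) (m≤n+m _ (2 * 𝟙 (loopIn C (x , y)))))
        cases (no ¬Cx) (yes Cy) = ≤-trans (≤-reflexive (trans (cong₂ _+_ (𝟙-false ¬Cx) (𝟙-true Cy)) (sym (𝟙-true (leaves⁺ C Cy ¬Cx)))))
          (≤-trans (m≤n+m _ (𝟙 (leaves C x y))) (m≤n+m _ (2 * 𝟙 (loopIn C (x , y)))))
        cases (no ¬Cx) (no ¬Cy) = ≤-trans (≤-reflexive (cong₂ _+_ (𝟙-false ¬Cx) (𝟙-false ¬Cy))) z≤n
      heavy : 5 ≤ W C
      heavy = ≤-trans (≤-reflexive (sym (trans (sumL-endsIn-E C) (cong (5 *_) one)))) (sumL-≤ pointwise E)

    module BoundarySize {I B R₀ : List (Edge (nV G))} (E∼ : E ∼ I ++ B ++ R₀)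
      (wI : All (Within C) I) (crB : All (Crosses C) B) (oR : All (Outside C) R₀) where

      sum-const : ∀ {f : Edge (nV G) → ℕ} c {L} → All (λ e → f e ≡ c) L → sumL f L ≡ c * length L
      sum-const c {[]}    []       = sym (*-zeroʳ c)
      sum-const c {e ∷ L} (p ∷ ps) = trans (cong₂ _+_ p (sum-const c ps)) (sym (*-suc c (length L)))

      sum-split : ∀ {f : Edge (nV G) → ℕ} → (∀ x y → f (x , y) ≡ f (y , x)) → ∀ {a b} →
        (∀ {e} → Within C e → f e ≡ a) → (∀ {e} → Crosses C e → f e ≡ b) → (∀ {e} → Outside C e → f e ≡ 0) →
        sumL f E ≡ a * length I + b * length B
      sum-split {f} flip {a} {b} p q r = trans (sumL-∼ flip E∼) (trans (sumL-++ f I (B ++ R₀))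
        (cong₂ _+_ (sum-const a (All.map p wI)) (trans (sumL-++ f B R₀)
          (trans (cong₂ _+_ (sum-const b (All.map q crB)) (sumL-0ᴬ (All.map r oR))) (+-identityʳ _)))))

      half-degrees : 5 * count C ≡ 2 * length I + 1 * length B
      half-degrees = trans (sym (sumL-endsIn-E C)) (sum-split (λ x y → +-comm (𝟙 (C x)) (𝟙 (C y)))
        (λ (p , q) → cong₂ _+_ (𝟙-true p) (𝟙-true q)) (λ (p , q) → cong₂ _+_ (𝟙-true p) (𝟙-false q)) (λ (p , q) → cong₂ _+_ (𝟙-false p) (𝟙-false q)))

      boundary≤4 : length B ≤ 4
      boundary≤4 = ≤-trans (≤-trans (≤-reflexive (sym (trans crossing (+-identityʳ _)))) (sumL-≤ (λ e → m≤n+m (cross C e) (2 * 𝟙 (loopIn C e))) E)) light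
        where
        stay : ∀ {x y} → T (C y) → 𝟙 (leaves C x y) ≡ 0
        stay Cy = 𝟙-false (λ p → proj₂ (leaves⁻ C p) Cy)
        away : ∀ {x y} → ¬ T (C x) → 𝟙 (leaves C x y) ≡ 0
        away ¬Cx = 𝟙-false (λ p → ¬Cx (proj₁ (leaves⁻ C p)))
        crossing : sumL (cross C) E ≡ 0 * length I + 1 * length B
        crossing = sum-split (λ x y → +-comm (𝟙 (leaves C x y)) (𝟙 (leaves C y x)))
          (λ {(x , y)} (p , q) → cong₂ _+_ (stay {x} {y} q) (stay {y} {x} p))
          (λ {(x , y)} (p , q) → cong₂ _+_ (𝟙-true (leaves⁺ C p q)) (away {y} {x} q))
          (λ {(x , y)} (p , q) → cong₂ _+_ (away {x} {y} p) (away {y} {x} q))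

      -- The degree sum over `C` is five times an odd number, and edges inside `C` contribute an
      -- even part of it.
      odd-boundary : ∀ b → length B ≢ 2 * b
      odd-boundary b eq = parity (2 + 5 * proj₁ oddC) (length I + b) (trans (regroup₁ (proj₁ oddC))
        (trans (cong (5 *_) (sym (proj₂ oddC))) (trans half-degrees (trans (cong (λ t → 2 * length I + 1 * t) eq) (regroup₂ (length I) b)))))
        where
        regroup₁ : ∀ j → 1 + 2 * (2 + 5 * j) ≡ 5 * (1 + 2 * j)
        regroup₁ = solve-∀
        regroup₂ : ∀ i b → 2 * i + 1 * (2 * b) ≡ 2 * (i + b)
        regroup₂ = solve-∀

    refuted : ∀ {s₀ t₀} → T (C s₀) → T (C t₀) → s₀ ≢ t₀ → ∀ {I} B {R₀} → E ∼ I ++ B ++ R₀ →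
      All (Within C) I → All (Crosses C) B → All (Outside C) R₀ → ⊥
    refuted Cs Ct s≢t [] E∼ wI crB oR = BoundarySize.odd-boundary E∼ wI crB oR 0 refl
    refuted Cs Ct s≢t (_ ∷ []) E∼ wI ((p , q) ∷ []) oR = Boundary.one-edge C ih oddC light Cs Ct s≢t wI oR E∼ p q
    refuted Cs Ct s≢t (_ ∷ _ ∷ []) E∼ wI crB oR = BoundarySize.odd-boundary E∼ wI crB oR 1 refl
    refuted Cs Ct s≢t (_ ∷ _ ∷ _ ∷ []) E∼ wI crB oR = Boundary.ThreeEdges.three-edges C ih oddC light Cs Ct s≢t wI oR E∼ crB
    refuted Cs Ct s≢t (_ ∷ _ ∷ _ ∷ _ ∷ []) E∼ wI crB oR = BoundarySize.odd-boundary E∼ wI crB oR 2 refl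
    refuted Cs Ct s≢t (_ ∷ _ ∷ _ ∷ _ ∷ _ ∷ _) E∼ wI crB oR with BoundarySize.boundary≤4 E∼ wI crB oR
    ... | s≤s (s≤s (s≤s (s≤s ())))

    light-impossible : ⊥
    light-impossible = by-size oddC
      where
      conclude : ∃[ s ] ∃[ t ] (T (C s) × T (C t) × s ≢ t) → ∃[ I ] ∃[ B ] ∃[ R₀ ]
        (E ∼ I ++ B ++ R₀ × All (Within C) I × All (Crosses C) B × All (Outside C) R₀) → ⊥
      conclude (s , t , Cs , Ct , s≢t) (I , B , R₀ , E∼ , wI , crB , oR) = refuted Cs Ct s≢t B E∼ wI crB oR
      by-size : Odd C → ⊥
      by-size (zero  , one) = singleton one
      by-size (suc j , eq)  = conclude (two-elements C (≤-trans (s≤s (s≤s z≤n)) (≤-reflexive (sym eq)))) (classify C E)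

  -- Induction on the size, as the barrier sets in `near-perfect` lie in `C` minus a vertex.
  odd-sets-heavy : ∀ c C → count C ≤ c → Odd C → 5 ≤ W C
  odd-sets-heavy zero    C le (j , eq) = contradiction (subst (_≤ 0) eq le) λ ()
  odd-sets-heavy (suc c) C le oddC = ≮⇒≥ λ lt → Light.light-impossible C
    (λ K oddK lt′ → odd-sets-heavy c K (≤-pred (≤-trans lt′ le)) oddK) oddC (≤-pred lt)

  everything : V → Bool
  everything _ = true

  -- Colouring the matching 1 and all other edges 0 would colour `G`.
  no-perfect-matching : ∀ {M} → ¬ Perfect everything M
  no-perfect-matching {M} (mM , pM) = conclude (matching-sub E M (Matching.disjoint mM) (Matching.adjacent mM))
    where
    conclude : ∃[ Q ] E ∼ M ++ Q → ⊥
    conclude (Q , E∼) = uncolourable (paint 1 M ++ paint 0 Q)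
      (∼trans (∼reflexive (trans (strip-++ (paint 1 M) _) (cong₂ _++_ (strip-paint 1 M) (strip-paint 0 Q)))) (∼sym E∼))
      λ v → 0 , 1 , (λ ())
        , trans (cdeg-++ (paint 1 M) _ 0 v) (cong₂ _+_ (cdeg-paint-≢ (λ ()) M v) (trans (cdeg-paint 0 Q v) (four v)))
        , trans (cdeg-++ (paint 1 M) _ 1 v) (cong₂ _+_ (trans (cdeg-paint 1 M v) (pM v tt)) (cdeg-paint-≢ (λ ()) Q v))
      where
      four : ∀ v → deg# Q v ≡ 4
      four v = suc-injective (trans (cong (_+ deg# Q v) (sym (pM v tt))) (trans (sym (deg#-++ M Q v)) (trans (sym (deg#-∼ E∼ v)) (degE v))))

  -- No edge leaves the whole vertex set, so only loops have weight.
  W-everything : W everything ≡ 2 * numLoops G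
  W-everything = trans (sumL-cong pointwise E) (trans (sumL-*ˡ 2 loop E) (cong (2 *_) (sumL-tabulate loop (ends G))))
    where
    loop : Edge (nV G) → ℕ
    loop (x , y) = if ⌊ x F.≟ y ⌋ then 1 else 0
    pointwise : ∀ e → weight everything e ≡ 2 * loop e
    pointwise (x , y) with ⌊ x F.≟ y ⌋
    ... | true  = refl
    ... | false = refl

  -- The degree sum `5 * count everything` is even while 5 is odd.
  even-order : ∃[ j ] count everything ≡ 2 * j
  even-order = halve (count everything) (length E) (trans (sym (sumL-endsIn-E everything)) (sumL-endsIn {everything} (All.universal (λ _ → tt , tt) E)))
    where
    halve : ∀ c m → 5 * c ≡ 2 * m → ∃[ j ] c ≡ 2 * j
    halve c m eq with c % 2 | m≡m%n+[m/n]*n c 2 | m%n<n c 2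
    ... | 0 | p | _ = c / 2 , trans p (*-comm (c / 2) 2)
    ... | 1 | p | _ = contradiction (trans (regroup (c / 2)) (trans (cong (5 *_) (sym p)) eq)) (parity (2 + 5 * (c / 2)) m)
      where
      regroup : ∀ j → 1 + 2 * (2 + 5 * j) ≡ 5 * (1 + j * 2)
      regroup = solve-∀
    ... | suc (suc _) | _ | s≤s (s≤s ())

  at-least-5-loops : 5 ≤ numLoops G
  at-least-5-loops = ≮⇒≥ λ few → tutte-berge (count everything) everything ≤-refl λ Br → conclude few Br (2 * length (Barrier.M Br) N.≟ count everything)
    where
    conclude : numLoops G < 5 → (Br : Barrier everything) → Dec (2 * length (Barrier.M Br) ≡ count everything) → ⊥
    conclude few Br (yes eq) = no-perfect-matching (perfect (Barrier.mM Br) eq)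
    conclude few Br (no ≢)   = <⇒≱ few (*-cancelˡ-≤ 2 (subst (10 ≤_) W-everything (5*-cancel {count S} {2} (begin
      5 * (count S + 2) ≤⟨ *-monoʳ-≤ 5 (deficient Br even-order ≢) ⟩
      5 * length Ks ≤⟨ sum-≥5 (All.map (λ {K} → odd-sets-heavy (count K) K ≤-refl) odd) ⟩
      sumL W Ks ≤⟨ total-weight (all-joined E) ⟩
      W everything + sumL (endsIn S) E ≡⟨ cong (W everything +_) (sumL-endsIn-E S) ⟩
      W everything + 5 * count S ∎))))
      where
      open Barrier Br
      open Counting R R-sym everything S Ks inside apart closed
      open ≤-Reasoning

theorem6 : (G : Graph) → MinimalCounterexample G →
    ¬ Has4RegularSubgraph G
    × ¬ Has3ParallelEdges G
    × ¬ HasDoublePath3 G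
    × (∀ v w → HasLoop G v → v ≢ w → ¬ DoubleEdge G v w)
    × (∀ u v → HasLoop G u → HasLoop G v → ¬ Adj G u v)
    × 5 ≤ numLoops G
    × ¬ HasLoopK33 G
    × (∀ v → ¬ AdjToFourLooped G v)
    × ¬ HasDense4Subgraph G
theorem6 G mc = no-4-regular-subgraph , no-3-parallel-edges , no-double-path , no-loop-at-double-edge , looped-not-adjacent , at-least-5-loops , no-looped-K₃₃ , no-four-looped-neighbours , no-dense-4-subgraph
  where
  open FourRegular G mc using (no-4-regular-subgraph)
  open GadgetParts G mc using (no-3-parallel-edges; no-loop-at-double-edge; looped-not-adjacent; no-looped-K₃₃; no-four-looped-neighbours; no-dense-4-subgraph)
  open DoublePath G mc using (no-double-path)
  open ManyLoops G mc using (at-least-5-loops)
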